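{- Let $q=p^f$ be a prime power, $N>2$ an integer with $N\mid(q-1)$, $\gamma$ a primitive element of $\mathbb{F}_q$, and $C_0=\langle\gamma^N\rangle$. Let $t$ be the largest power of $p$ dividing $G_q(\chi)$ for all nontrivial multiplicative characters $\chi$ of $\mathbb{F}_q$ trivial on $C_0$. Assume there are positive integers $u,v,r,s$ such that (i) $t(-ur+vs)\equiv -1\pmod N$; (ii) $(N-1)q+t^2(-ur+vs)^2=Nt^2(u^2r+v^2s)$. Let $m=\gcd\{\mathrm{ord}_n(p): n>1,\ n\mid N\}$ and assume $m\ge2$. If one of the following holds: (1) $u=s=1$, $v(v+1)<2m$, and $r+1<N$; (2) $u=s=1$, $v(v+1)=2m$, and $r+v^2<N$; (3) $v=r=1$, $u(u+1)<2m$, and $s+1<N$; (4) $v=r=1$, $u(u+1)=2m$, and $s+u^2<N$; (5) $u=v=1$, $s=m$, and $r+m<N$; (6) $u=v=1$, $r=m$, and $s+m<N$, then the Gauss periods $\eta_a=\sum_{x\in\gamma^aC_0}\psi(x)$, $0\le a\le N-1$, take exactly three values.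
   Context: $\psi$ is the canonical additive character of $\mathbb{F}_q$: $\psi(x)=\xi_p^{\mathrm{Tr}_{q/p}(x)}$. For a multiplicative character $\chi$, $G_q(\chi)=\sum_{a\in\mathbb{F}_q^*}\chi(a)\psi(a)$; divisibility is in the ring of algebraic integers. $\mathrm{ord}_n(p)$ is the multiplicative order of $p$ modulo $n$. -}

module Defs where

open import Level using (Level; _⊔_; suc)
open import Algebra.Apartness.Bundles using (HeytingCommutativeRing; HeytingField)
open import Algebra.Bundles using (CommutativeRing; Semiring)
import Algebra.Definitions.RawSemiring as RawSemiringDefs
open import Data.Bool.Base using (if_then_else_)
open import Data.Fin.Base using (Fin; toℕ; fromℕ<)
open import Data.Fin.Properties as Finₚ using (any?; pigeonhole; toℕ<n; toℕ-fromℕ<)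
open import Data.Integer.Base as ℤ using (ℤ; +_; -[1+_])
import Data.Integer.Divisibility as ℤDiv
open import Data.List.Base using (List; []; _∷_)
open import Data.Nat.Base as ℕ using (ℕ; NonZero)
open import Data.Nat.Divisibility using (_∣_)
open import Data.Nat.Induction using (<-rec)
import Data.Nat.Properties as ℕₚ
open import Data.Product.Base using (∃; ∃-syntax; _×_; _,_; proj₁; proj₂)
open import Function.Bundles using (Inverse; Injection)
open import Function.Properties.Inverse using (Inverse⇒Injection)
open import Relation.Binary.Definitions using (Decidable)
open import Relation.Binary.PropositionalEquality as ≡ using (_≡_; _≢_)
import Relation.Binary.Reasoning.Setoid as SetoidReasoning
open import Relation.Nullary.Decidable using (Dec; yes; no; does; ¬?; map′; _×-dec_; via-injection)
open import Relation.Nullary.Negation using (¬_)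
open import Relation.Unary using (Pred) renaming (Decidable to Decidable₁)

private
  variable
    c ℓ₁ ℓ₂ c′ ℓ₁′ ℓ₂′ : Level

infix 4 _≡_[mod_]

_≡_[mod_] : ℤ → ℤ → ℕ → Set
a ≡ b [mod n ] = + n ℤDiv.∣ (a ℤ.- b)

IsMultiplicativeOrder : (n b k : ℕ) → Set
IsMultiplicativeOrder n b k =
  1 ℕ.≤ k
  × + (b ℕ.^ k) ≡ + 1 [mod n ]
  × (∀ j → 1 ℕ.≤ j → + (b ℕ.^ j) ≡ + 1 [mod n ] → k ℕ.≤ j)

IsGCDOf : (ℕ → Set) → ℕ → Set
IsGCDOf P m = (∀ k → P k → m ∣ k) × (∀ d → (∀ k → P k → d ∣ k) → d ∣ m)

-- The set { ord_n(p) : n > 1, n ∣ N }.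
OrderModDivisor : (p N : ℕ) → ℕ → Set
OrderModDivisor p N k = ∃[ n ] (1 ℕ.< n × n ∣ N × IsMultiplicativeOrder n p k)

module FieldNotation (K : HeytingField c ℓ₁ ℓ₂) where
  open HeytingField K public
  open HeytingCommutativeRing heytingCommutativeRing public using (commutativeRing)
  open CommutativeRing commutativeRing public using (_≉_; semiring)
  open Semiring semiring public using (rawSemiring)
  open RawSemiringDefs rawSemiring public
    using (_^_; sum) renaming (_×_ to _·_)

-- Stands in for ℂ, with ζ n in the role of exp(2πi/n).  Being apart from 0 is
-- the positive form of being nonzero; for a classical field take x # y to
-- be ¬ (x ≈ y).
record CharZeroFieldWithRootsOfUnity c ℓ₁ ℓ₂ : Set (suc (c ⊔ ℓ₁ ⊔ ℓ₂)) where
  field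
    heytingField : HeytingField c ℓ₁ ℓ₂
  open FieldNotation heytingField public
  field
    charZero : ∀ n → .{{NonZero n}} → n · 1# # 0#
    ζ        : ℕ → Carrier
    ζ-root   : ∀ n → .{{NonZero n}} → ζ n ^ n ≈ 1#
    ζ-prim   : ∀ n k → 1 ℕ.≤ k → k ℕ.< n → ζ n ^ k # 1#

  fromℤ : ℤ → Carrier
  fromℤ (+ n)    = n · 1#
  fromℤ -[1+ n ] = - (ℕ.suc n · 1#)

  -- The monic polynomial c₀ + c₁x + ⋯ + c_{d-1}x^{d-1} + x^d, where the list
  -- is [c₀, …, c_{d-1}].
  evalMonic : List ℤ → Carrier → Carrier
  evalMonic []       x = 1#
  evalMonic (a ∷ as) x = fromℤ a + x * evalMonic as x

  IsAlgebraicInteger : Carrier → Set ℓ₁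
  IsAlgebraicInteger x = ∃[ as ] evalMonic as x ≈ 0#

  _∣ᴬ_ : ℕ → Carrier → Set (c ⊔ ℓ₁)
  n ∣ᴬ z = ∃[ w ] (IsAlgebraicInteger w × z ≈ (n · 1#) * w)

record FiniteField c ℓ₁ ℓ₂ (q : ℕ) : Set (suc (c ⊔ ℓ₁ ⊔ ℓ₂)) where
  field
    heytingField : HeytingField c ℓ₁ ℓ₂
  open FieldNotation heytingField public
  field
    enumeration : Inverse setoid (≡.setoid (Fin q))
  open Inverse enumeration public using ()
    renaming (to to index; from to element; strictlyInverseʳ to element-index)

  open Injection (Inverse⇒Injection enumeration) public using ()
    renaming (injective to index-injective)

  infix 4 _≟_
  _≟_ : Decidable _≈_
  _≟_ = via-injection (Inverse⇒Injection enumeration) Finₚ._≟_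

  search : ∀ {ℓ} {P : Pred Carrier ℓ} → (∀ {x y} → x ≈ y → P x → P y) →
           Decidable₁ P → Dec (∃ P)
  search resp P? = map′
    (λ { (i , Pi) → element i , Pi })
    (λ { (x , Px) → index x , resp (sym (element-index x)) Px })
    (any? (λ i → P? (element i)))

  ⟨_⟩ : Carrier → Pred Carrier ℓ₁
  ⟨ g ⟩ x = ∃[ k ] x ≈ g ^ k

  IsPrimitiveElement : Pred Carrier (c ⊔ ℓ₁)
  IsPrimitiveElement γ = γ ≉ 0# × (∀ x → x ≉ 0# → ⟨ γ ⟩ x)

  C₀ : (γ : Carrier) (N : ℕ) → Pred Carrier ℓ₁
  C₀ γ N = ⟨ γ ^ N ⟩

  coset : (γ : Carrier) (N a : ℕ) → Pred Carrier (c ⊔ ℓ₁)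
  coset γ N a x = ∃[ h ] (C₀ γ N h × x ≈ γ ^ a * h)

  private
    ^-+ : ∀ g m n → g ^ (m ℕ.+ n) ≈ g ^ m * g ^ n
    ^-+ g ℕ.zero    n = sym (*-identityˡ _)
    ^-+ g (ℕ.suc m) n = trans (*-cong refl (^-+ g m n)) (sym (*-assoc _ _ _))

    boundedPower : ∀ g k → ∃[ i ] g ^ k ≈ g ^ toℕ {q} i
    boundedPower g = <-rec _ step
      where
      open SetoidReasoning setoid
      step : ∀ k → (∀ {l} → l ℕ.< k → ∃[ i ] g ^ l ≈ g ^ toℕ {q} i) →
             ∃[ i ] g ^ k ≈ g ^ toℕ {q} i
      step k rec with k ℕₚ.<? q
      ... | yes k<q = fromℕ< k<q , reflexive (≡.cong (g ^_) (≡.sym (toℕ-fromℕ< k<q)))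
      ... | no k≮q
        with i , j , i<j , eq ← pigeonhole (ℕₚ.n<1+n q) (λ n → index (g ^ toℕ n))
        with l , k≡j+l ← ℕₚ.m≤n⇒∃[o]m+o≡n
               (ℕₚ.≤-trans (ℕ.s≤s⁻¹ (toℕ<n j)) (ℕₚ.≮⇒≥ k≮q))
        with h , gʰ ← rec {toℕ i ℕ.+ l}
               (≡.subst (_ ℕ.<_) k≡j+l (ℕₚ.+-monoˡ-< l i<j))
        = h , (begin
          g ^ k                 ≡⟨ ≡.cong (g ^_) (≡.sym k≡j+l) ⟩
          g ^ (toℕ j ℕ.+ l)     ≈⟨ ^-+ g (toℕ j) l ⟩
          g ^ toℕ j * g ^ l     ≈⟨ *-cong (index-injective eq) refl ⟨
          g ^ toℕ i * g ^ l     ≈⟨ ^-+ g (toℕ i) l ⟨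
          g ^ (toℕ i ℕ.+ l)     ≈⟨ gʰ ⟩
          g ^ toℕ h             ∎)

  ⟨_⟩? : ∀ g → Decidable₁ ⟨ g ⟩
  ⟨ g ⟩? x = map′
    (λ { (i , x≈gⁱ) → toℕ i , x≈gⁱ })
    (λ { (k , x≈gᵏ) → let i , gᵏ≈gⁱ = boundedPower g k in i , trans x≈gᵏ gᵏ≈gⁱ })
    (any? (λ (i : Fin q) → x ≟ g ^ toℕ i))

  coset? : ∀ γ N a → Decidable₁ (coset γ N a)
  coset? γ N a x = search
    (λ { h≈h′ ((k , h≈) , x≈) →
         (k , trans (sym h≈h′) h≈) , trans x≈ (*-cong refl h≈h′) })
    (λ h → ⟨ γ ^ N ⟩? h ×-dec (x ≟ γ ^ a * h))

module CharacterSums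
  (K : CharZeroFieldWithRootsOfUnity c ℓ₁ ℓ₂)
  (p f : ℕ)
  {q : ℕ} (F : FiniteField c′ ℓ₁′ ℓ₂′ q)
  where

  private
    module K = CharZeroFieldWithRootsOfUnity K
    module F = FiniteField F

  sumOver : ∀ {ℓ} {P : Pred F.Carrier ℓ} → Decidable₁ P →
            (F.Carrier → K.Carrier) → K.Carrier
  sumOver P? g =
    K.sum {q} λ i → if does (P? (F.element i)) then g (F.element i) else K.0#

  trace : F.Carrier → F.Carrier
  trace x = F.sum {f} λ i → x F.^ (p ℕ.^ toℕ i)

  -- The representative in {0,…,p-1} of an element of the prime field.  When
  -- q = p^f the trace lies in the prime field, so the value 0 assigned to
  -- other elements plays no role in ψ.
  residue : F.Carrier → ℕ
  residue y with any? (λ (i : Fin p) → (toℕ i F.· F.1#) F.≟ y)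
  ... | yes (i , _) = toℕ i
  ... | no  _       = 0

  ψ : F.Carrier → K.Carrier
  ψ x = K.ζ p K.^ residue (trace x)

  -- Only the restriction of χ to nonzero elements matters: the value at 0 is
  -- unconstrained and never used.
  record MultiplicativeCharacter : Set (c ⊔ ℓ₁ ⊔ c′ ⊔ ℓ₁′) where
    field
      χ      : F.Carrier → K.Carrier
      χ-cong : ∀ {x y} → x F.≈ y → χ x K.≈ χ y
      χ-1    : χ F.1# K.≈ K.1#
      χ-*    : ∀ x y → x F.≉ F.0# → y F.≉ F.0# → χ (x F.* y) K.≈ χ x K.* χ y

  open MultiplicativeCharacter

  IsTrivial : MultiplicativeCharacter → Set (ℓ₁ ⊔ c′ ⊔ ℓ₁′)
  IsTrivial X = ∀ x → x F.≉ F.0# → χ X x K.≈ K.1#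

  IsTrivialOn : ∀ {ℓ} → Pred F.Carrier ℓ → MultiplicativeCharacter → Set (ℓ₁ ⊔ c′ ⊔ ℓ)
  IsTrivialOn H X = ∀ x → H x → χ X x K.≈ K.1#

  G : MultiplicativeCharacter → K.Carrier
  G X = sumOver (λ a → ¬? (a F.≟ F.0#)) (λ a → χ X a K.* ψ a)

  DividesGaussSums : (γ : F.Carrier) (N : ℕ) → ℕ → Set (c ⊔ ℓ₁ ⊔ c′ ⊔ ℓ₁′)
  DividesGaussSums γ N d =
    ∀ X → ¬ IsTrivial X → IsTrivialOn (F.C₀ γ N) X → d K.∣ᴬ G X

  IsLargestPowerDividingGaussSums :
    (γ : F.Carrier) (N : ℕ) → ℕ → Set (c ⊔ ℓ₁ ⊔ c′ ⊔ ℓ₁′)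
  IsLargestPowerDividingGaussSums γ N t =
    (∃[ k ] t ≡ p ℕ.^ k)
    × DividesGaussSums γ N t
    × (∀ j → DividesGaussSums γ N (p ℕ.^ j) → p ℕ.^ j ℕ.≤ t)

  η : (γ : F.Carrier) (N : ℕ) → Fin N → K.Carrier
  η γ N a = sumOver (F.coset? γ N (toℕ a)) ψ

  TakesExactlyThreeValues : ∀ {N} → (Fin N → K.Carrier) → Set (c ⊔ ℓ₁ ⊔ ℓ₂)
  TakesExactlyThreeValues g =
    ∃ λ (w : Fin 3 → K.Carrier) →
      (∀ i j → i ≢ j → w i K.# w j)
      × (∀ i → ∃[ a ] g a K.≈ w i)
      × (∀ a → ∃[ i ] g a K.≈ w i)

{-# OPTIONS --safe #-}

-- Since m ≥ 2, no prime factor of N divides p - 1, so the prime field lies in C₀ and the Gauss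
-- periods are rational.  By Fourier inversion N η_a + 1 is an integral combination of Gauss sums,
-- hence divisible by t, and (i) turns this into η_a = t y_a - e with y_a ∈ ℤ.  Now Σ y_a = v s - u r,
-- and (ii) says Σ y_a² = u² r + v² s.
--
-- After replacing y by -y if necessary, Σ y_a (y_a + 1) ≤ 2m.  Every y_a (y_a + 1) is nonnegative, is
-- at least 2 unless y_a ∈ {0, -1}, and is constant on the orbits of multiplication by p, which have
-- at least m elements for a ≠ 0.  So all values outside {0, -1} equal one c, taken on 1 or m classes.
-- If -1 is not taken, c divides every y_a; the correlation of η with a translate shows c ∣ q, so c = ±1
-- by maximality of t, and the size conditions exclude this.  They also exclude that 0 is not taken.
module Submission where

open import Defs
import Algebra.Apartness.Properties.HeytingCommutativeRing as HeytingProperties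
import Algebra.Properties.AbelianGroup as AbelianGroupProperties
import Algebra.Properties.CommutativeSemigroup as CommutativeSemigroupProperties
import Algebra.Properties.CommutativeSemiring.Binomial as Binomial
import Algebra.Properties.CommutativeSemiring.Exp as ExpProperties
import Algebra.Properties.Monoid.Mult as MonoidMultProperties
import Algebra.Properties.Ring as RingProperties
import Algebra.Properties.Semiring.Mult as MultProperties
import Algebra.Properties.Semiring.Sum as SumProperties
import Algebra.Solver.Ring as RingSolver
open import Algebra.Apartness.Bundles using (HeytingCommutativeRing; HeytingField)
open import Algebra.Bundles using (CommutativeRing)
open import Algebra.Solver.Ring.AlmostCommutativeRing using (fromCommutativeRing; _-Raw-AlmostCommutative⟶_)
open import Data.Bool.Base using (if_then_else_)
open import Data.Fin.Base as Fin using (Fin; toℕ; fromℕ<; punchOut)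
open import Data.Fin.Permutation using (permutation)
import Data.Fin.Properties as Finₚ
open Finₚ using (any?)
open import Data.Integer.Base as ℤ using (ℤ; +_; -[1+_])
import Data.Integer.Divisibility.Signed as ℤ∣
import Data.Integer.Properties as ℤₚ
import Data.Integer.Tactic.RingSolver as ℤSolver
open import Data.List.Base as List using (List; []; _∷_; _++_; length)
open import Data.List.Relation.Unary.All as All using (All; []; _∷_)
open import Data.Maybe.Base using (Maybe; just; nothing)
open import Data.Nat.Base as ℕ using (ℕ; zero; suc; s≤s; z≤n; _!; NonZero)
open import Data.Nat.Combinatorics using (nCn≡1; [n∸k]!k!∣n!) renaming (_C_ to _choose_)
open import Data.Nat.Combinatorics.Specification using (nCk≡n!/k![n-k]!)
open import Data.Nat.Coprimality as Coprimality using (Coprime; coprime-Bézout; coprime-divisor)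
open import Data.Nat.Divisibility as ℕ∣ using () renaming (_∣_ to _∣ℕ_)
open import Data.Nat.DivMod using (_%_; _/_; m≡m%n+[m/n]*n; m%n<n; m<n⇒m%n≡m; m%n%n≡m%n; [m+kn]%n≡m%n; %-distribˡ-*; m/n*n≡m; m∣n⇒o%n%m≡o%m)
open import Data.Nat.GCD using (gcd; gcd[m,n]∣m; gcd[m,n]∣n; module Bézout)
open import Data.Nat.Induction using (<-rec)
open import Data.Nat.ListAction using (product)
open import Data.Nat.Primality using (Prime; euclidsLemma; ¬prime[0]; ¬prime[1]; prime⇒irreducible; prime⇒nonZero; prime⇒nonTrivial)
open import Data.Nat.Primality.Factorisation using (factorise; PrimeFactorisation)
import Data.Nat.Properties as ℕₚ
open ℕₚ using (_!*_!≢0)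
import Data.Nat.Tactic.RingSolver as ℕSolver
open import Data.Product.Base using (∃; ∃-syntax; _×_; _,_; proj₁; proj₂)
open import Data.Sum.Base using (_⊎_; inj₁; inj₂; [_,_]′)
open import Function.Base using (_∘_; id)
open import Function.Bundles using (Inverse)
open import Level using (Level; _⊔_)
open import Relation.Binary.Definitions using (tri<; tri≈; tri>)
open import Relation.Binary.PropositionalEquality as ≡ using (_≡_; _≢_)
import Relation.Binary.Reasoning.Setoid as SetoidReasoning
open import Relation.Nullary.Decidable using (Dec; yes; no; does; dec-true; dec-false; _×-dec_; ¬?)
open import Relation.Nullary.Negation using (¬_; contradiction)
open import Relation.Unary using (Pred) renaming (Decidable to Decidable₁)

-- `K` is only a Heyting field of characteristic zero with roots of unity: it carries no decidable
-- equality and no chosen cyclotomic subfield. So integrality is built from finitely generated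
-- ℤ-modules, rationality of η_a comes from an explicit average rather than from Galois theory, and
-- every case distinction is made on the integers y_a.
--
-- With d = v s - u r, the constant e is (t d + 1) / N, forced by Σ η_a = -1 and Σ y_a = d. It also
-- ties the maximality of t to the y_a: a nontrivial χ is orthogonal to the constant e, so its Gauss
-- sum is t Σ χ(γ^a) y_a, and a prime p dividing all y_a would enlarge t.
--
-- The budget 2m is the price of one orbit: a nonzero class outside {0, -1} brings at least m
-- classes costing at least 2 each. Either this happens once, with equality everywhere, or only the
-- class 0, fixed by multiplication by p, can leave {0, -1}. If c is taken on μ classes, missing the
-- value 0 gives d + N = μ (c + 1), and missing -1 gives 2d = Σ y_a (y_a + 1).

-- Integer multiples of 1, and a ring solver with integer coefficients

module IntegerScalars {c ℓ} (R : CommutativeRing c ℓ) where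
  open CommutativeRing R hiding (zero)
  open RingProperties ring
  open MultProperties semiring using (×-homo-+; ×-homo-1) renaming (_×_ to _·_)
  open SetoidReasoning setoid

  -- The clauses of `fromℤ`, but over an arbitrary commutative ring, so that one solver serves both
  -- fields and ℤ itself.
  ι : ℤ → Carrier
  ι (+ n)    = n · 1#
  ι -[1+ n ] = - (suc n · 1#)

  ι-⊖ : ∀ m n → ι (m ℤ.⊖ n) ≈ m · 1# - n · 1#
  ι-⊖ zero    zero    = sym (-‿inverseʳ 0#)
  ι-⊖ zero    (suc n) = sym (+-identityˡ _)
  ι-⊖ (suc m) zero    = sym (trans (+-congˡ -0#≈0#) (+-identityʳ _))
  ι-⊖ (suc m) (suc n) = begin
    ι (suc m ℤ.⊖ suc n)  ≡⟨ ≡.cong ι (ℤₚ.[1+m]⊖[1+n]≡m⊖n m n) ⟩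
    ι (m ℤ.⊖ n)  ≈⟨ ι-⊖ m n ⟩
    m · 1# - n · 1#  ≈⟨ +-congʳ (+-identityˡ _) ⟨
    0# + m · 1# - n · 1#  ≈⟨ +-congʳ (+-congʳ (-‿inverseʳ 1#)) ⟨
    (1# - 1#) + m · 1# - n · 1#          ≈⟨ +-congʳ (+-assoc _ _ _) ⟩
    1# + (- 1# + m · 1#) - n · 1#        ≈⟨ +-congʳ (+-congˡ (+-comm _ _)) ⟩
    1# + (m · 1# - 1#) - n · 1#          ≈⟨ +-congʳ (+-assoc _ _ _) ⟨
    1# + m · 1# - 1# - n · 1#            ≈⟨ +-assoc _ _ _ ⟩
    1# + m · 1# + (- 1# - n · 1#)        ≈⟨ +-congˡ (-‿+-comm _ _) ⟩
    1# + m · 1# - (1# + n · 1#)          ∎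

  ι-neg : ∀ i → ι (ℤ.- i) ≈ - ι i
  ι-neg (+ zero)  = sym -0#≈0#
  ι-neg (+ suc n) = refl
  ι-neg -[1+ n ]  = sym (-‿involutive _)

  ι-+ : ∀ i j → ι (i ℤ.+ j) ≈ ι i + ι j
  ι-+ (+ m)    (+ n)    = ×-homo-+ 1# m n
  ι-+ (+ m)    -[1+ n ] = ι-⊖ m (suc n)
  ι-+ -[1+ m ] (+ n)    = trans (ι-⊖ n (suc m)) (+-comm _ _)
  ι-+ -[1+ m ] -[1+ n ] = begin
    - (suc (suc (m ℕ.+ n)) · 1#)     ≡⟨ ≡.cong (λ l → - (suc l · 1#)) (ℕₚ.+-suc m n) ⟨
    - ((suc m ℕ.+ suc n) · 1#)       ≈⟨ -‿cong (×-homo-+ 1# (suc m) (suc n)) ⟩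
    - (suc m · 1# + suc n · 1#)      ≈⟨ -‿+-comm _ _ ⟨
    - (suc m · 1#) - suc n · 1#      ∎

  ι-*⁺ : ∀ m j → ι (+ m ℤ.* j) ≈ m · 1# * ι j
  ι-*⁺ zero    j = sym (zeroˡ _)
  ι-*⁺ (suc m) j = begin
    ι (+ suc m ℤ.* j)          ≡⟨ ≡.cong ι (ℤₚ.suc-* (+ m) j) ⟩
    ι (j ℤ.+ + m ℤ.* j)        ≈⟨ ι-+ j (+ m ℤ.* j) ⟩
    ι j + ι (+ m ℤ.* j)        ≈⟨ +-cong (sym (*-identityˡ _)) (ι-*⁺ m j) ⟩
    1# * ι j + m · 1# * ι j    ≈⟨ distribʳ _ _ _ ⟨
    (1# + m · 1#) * ι j        ∎

  ι-* : ∀ i j → ι (i ℤ.* j) ≈ ι i * ι j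
  ι-* (+ m)    j = ι-*⁺ m j
  ι-* -[1+ m ] j = begin
    ι (-[1+ m ] ℤ.* j)         ≡⟨ ≡.cong ι (ℤₚ.neg-distribˡ-* (+ suc m) j) ⟨
    ι (ℤ.- (+ suc m ℤ.* j))    ≈⟨ ι-neg (+ suc m ℤ.* j) ⟩
    - ι (+ suc m ℤ.* j)        ≈⟨ -‿cong (ι-*⁺ (suc m) j) ⟩
    - (suc m · 1# * ι j)       ≈⟨ -‿distribˡ-* _ _ ⟩
    - (suc m · 1#) * ι j       ∎

  ι-1 : ι (+ 1) ≈ 1#
  ι-1 = ×-homo-1 1#

  private
    morphism : ℤ.+-*-rawRing -Raw-AlmostCommutative⟶ fromCommutativeRing R
    morphism = record
      { ⟦_⟧ = ι ; +-homo = ι-+ ; *-homo = ι-* ; -‿homo = ι-neg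
      ; 0-homo = refl ; 1-homo = ι-1 }

    coefficient≟ : ∀ i j → Maybe (ι i ≈ ι j)
    coefficient≟ i j with i ℤₚ.≟ j
    ... | yes ≡.refl = just refl
    ... | no  _      = nothing

  open RingSolver ℤ.+-*-rawRing (fromCommutativeRing R) morphism coefficient≟ public
    using (solve; _:+_; _:*_; _:-_; :-_; _:=_; con; _:^_)

-- Sums over initial segments of ℕ, periodicity and residues

module RangeSum {c ℓ} (R : CommutativeRing c ℓ) where
  open CommutativeRing R hiding (zero)
  open SumProperties semiring
  open IntegerScalars R
  open RingProperties ring using (+-cancelˡ)
  open SetoidReasoning setoid

  -- Summands are functions on ℕ rather than on `Fin n`, so that shifts, blocks and periodicity of
  -- the index need no casts.
  ∑ : ℕ → (ℕ → Carrier) → Carrier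
  ∑ zero    f = 0#
  ∑ (suc n) f = f 0 + ∑ n (f ∘ suc)

  ∑≈sum : ∀ n f → ∑ n f ≈ sum {n} (λ i → f (toℕ i))
  ∑≈sum zero    f = refl
  ∑≈sum (suc n) f = +-congˡ (∑≈sum n (f ∘ suc))

  ∑-cong : ∀ n {f g : ℕ → Carrier} → (∀ i → i ℕ.< n → f i ≈ g i) → ∑ n f ≈ ∑ n g
  ∑-cong zero    eq = refl
  ∑-cong (suc n) eq = +-cong (eq 0 (s≤s z≤n)) (∑-cong n (λ i i<n → eq (suc i) (s≤s i<n)))

  ∑-+ : ∀ n f g → ∑ n (λ i → f i + g i) ≈ ∑ n f + ∑ n g
  ∑-+ zero    f g = sym (+-identityʳ 0#)
  ∑-+ (suc n) f g = trans (+-congˡ (∑-+ n (f ∘ suc) (g ∘ suc)))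
    (solve 4 (λ a b x y → (a :+ b) :+ (x :+ y) := (a :+ x) :+ (b :+ y)) refl _ _ _ _)

  ∑-*ˡ : ∀ n x f → ∑ n (λ i → x * f i) ≈ x * ∑ n f
  ∑-*ˡ zero    x f = sym (zeroʳ x)
  ∑-*ˡ (suc n) x f = trans (+-congˡ (∑-*ˡ n x (f ∘ suc))) (sym (distribˡ _ _ _))

  ∑-*ʳ : ∀ n x f → ∑ n (λ i → f i * x) ≈ ∑ n f * x
  ∑-*ʳ n x f = trans (∑-cong n (λ _ _ → *-comm _ _)) (trans (∑-*ˡ n x f) (*-comm _ _))

  ∑-const : ∀ n x → ∑ n (λ _ → x) ≈ ι (+ n) * x
  ∑-const zero    x = sym (zeroˡ x)
  ∑-const (suc n) x = begin
    x + ∑ n (λ _ → x)       ≈⟨ +-cong (sym (*-identityˡ x)) (∑-const n x) ⟩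
    1# * x + ι (+ n) * x    ≈⟨ distribʳ _ _ _ ⟨
    (1# + ι (+ n)) * x      ∎

  ∑-0 : ∀ n {f : ℕ → Carrier} → (∀ i → i ℕ.< n → f i ≈ 0#) → ∑ n f ≈ 0#
  ∑-0 n f≈0 = trans (∑-cong n f≈0) (trans (∑-const n 0#) (zeroʳ _))

  ∑-swap : ∀ m n (f : ℕ → ℕ → Carrier) →
           ∑ m (λ i → ∑ n (λ j → f i j)) ≈ ∑ n (λ j → ∑ m (λ i → f i j))
  ∑-swap zero    n f = sym (∑-0 n (λ _ _ → refl))
  ∑-swap (suc m) n f = trans (+-congˡ (∑-swap m n (f ∘ suc))) (sym (∑-+ n _ _))

  ∑-split : ∀ m n f → ∑ (m ℕ.+ n) f ≈ ∑ m f + ∑ n (λ i → f (m ℕ.+ i))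
  ∑-split zero    n f = sym (+-identityˡ _)
  ∑-split (suc m) n f = trans (+-congˡ (∑-split m n (f ∘ suc))) (sym (+-assoc _ _ _))

  ∑-last : ∀ n f → ∑ (suc n) f ≈ ∑ n f + f n
  ∑-last n f = begin
    ∑ (suc n) f             ≡⟨ ≡.cong (λ l → ∑ l f) (ℕₚ.+-comm 1 n) ⟩
    ∑ (n ℕ.+ 1) f           ≈⟨ ∑-split n 1 f ⟩
    ∑ n f + (f (n ℕ.+ 0) + 0#) ≈⟨ +-congˡ (+-identityʳ _) ⟩
    ∑ n f + f (n ℕ.+ 0)     ≡⟨ ≡.cong (λ l → ∑ n f + f l) (ℕₚ.+-identityʳ n) ⟩
    ∑ n f + f n             ∎

  -- Moving the window by one drops f l and gains f (l + P), which is the same by periodicity: both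
  -- sides of `step` are the sum over a window of length P + 1.
  ∑-shift : ∀ P {f : ℕ → Carrier} → (∀ i → f (P ℕ.+ i) ≈ f i) →
            ∀ l → ∑ P (λ i → f (l ℕ.+ i)) ≈ ∑ P f
  ∑-shift P {f} per zero    = refl
  ∑-shift P {f} per (suc l) = trans (+-cancelˡ (f (l ℕ.+ 0)) _ _ step) (∑-shift P per l)
    where
    step : f (l ℕ.+ 0) + ∑ P (λ i → f (suc l ℕ.+ i)) ≈ f (l ℕ.+ 0) + ∑ P (λ i → f (l ℕ.+ i))
    step = begin
      f (l ℕ.+ 0) + ∑ P (λ i → f (suc l ℕ.+ i))
        ≈⟨ +-congˡ (∑-cong P (λ i _ → reflexive (≡.cong f (ℕₚ.+-suc l i)))) ⟨
      ∑ (suc P) (λ i → f (l ℕ.+ i))               ≈⟨ ∑-last P _ ⟩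
      ∑ P (λ i → f (l ℕ.+ i)) + f (l ℕ.+ P)       ≈⟨ +-comm _ _ ⟩
      f (l ℕ.+ P) + ∑ P (λ i → f (l ℕ.+ i))       ≈⟨ +-congʳ (reflexive (≡.cong f (ℕₚ.+-comm l P))) ⟩
      f (P ℕ.+ l) + ∑ P (λ i → f (l ℕ.+ i))       ≈⟨ +-congʳ (per l) ⟩
      f l + ∑ P (λ i → f (l ℕ.+ i))               ≈⟨ +-congʳ (reflexive (≡.cong f (ℕₚ.+-identityʳ l))) ⟨
      f (l ℕ.+ 0) + ∑ P (λ i → f (l ℕ.+ i))       ∎

  ∑-residues : ∀ k N f → ∑ (k ℕ.* N) f ≈ ∑ N (λ a → ∑ k (λ j → f (a ℕ.+ j ℕ.* N)))
  ∑-residues zero    N f = sym (∑-0 N (λ _ _ → refl))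
  ∑-residues (suc k) N f = begin
    ∑ (N ℕ.+ k ℕ.* N) f  ≈⟨ ∑-split N (k ℕ.* N) f ⟩
    ∑ N f + ∑ (k ℕ.* N) (λ i → f (N ℕ.+ i))             ≈⟨ +-congˡ (∑-residues k N _) ⟩
    ∑ N f + ∑ N (λ a → ∑ k (λ j → f (N ℕ.+ (a ℕ.+ j ℕ.* N))))
      ≈⟨ +-cong (∑-cong N (λ a _ → reflexive (≡.cong f (≡.sym (ℕₚ.+-identityʳ a)))))
                (∑-cong N (λ a _ → ∑-cong k (λ j _ → reflexive (≡.cong f (comm a (j ℕ.* N)))))) ⟩
    ∑ N (λ a → f (a ℕ.+ 0)) + ∑ N (λ a → ∑ k (λ j → f (a ℕ.+ (N ℕ.+ j ℕ.* N))))
      ≈⟨ ∑-+ N _ _ ⟨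
    ∑ N (λ a → ∑ (suc k) (λ j → f (a ℕ.+ j ℕ.* N)))     ∎
    where
    comm : ∀ a b → N ℕ.+ (a ℕ.+ b) ≡ a ℕ.+ (N ℕ.+ b)
    comm a b = ≡.trans (≡.sym (ℕₚ.+-assoc N a b))
      (≡.trans (≡.cong (ℕ._+ b) (ℕₚ.+-comm N a)) (ℕₚ.+-assoc a N b))

  ∑-single : ∀ n {f : ℕ → Carrier} a → a ℕ.< n → (∀ i → i ℕ.< n → i ≢ a → f i ≈ 0#) → ∑ n f ≈ f a
  ∑-single (suc n) {f} zero    a<n f≈0 = trans
    (+-congˡ (∑-0 n (λ i i<n → f≈0 (suc i) (s≤s i<n) λ ()))) (+-identityʳ _)
  ∑-single (suc n) {f} (suc a) (s≤s a<n) f≈0 = trans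
    (+-cong (f≈0 0 (s≤s z≤n) λ ())
            (∑-single n {f ∘ suc} a a<n (λ i i<n i≢a → f≈0 (suc i) (s≤s i<n) (i≢a ∘ ℕₚ.suc-injective))))
    (+-identityˡ _)

  periodic-% : ∀ k → .{{_ : NonZero k}} → ∀ {f : ℕ → Carrier} → (∀ i → f (k ℕ.+ i) ≈ f i) → ∀ i → f i ≈ f (i % k)
  periodic-% k {f} per i = trans (reflexive (≡.cong f (≡.trans (m≡m%n+[m/n]*n i k) (ℕₚ.+-comm (i % k) _)))) (go (i / k))
    where
    go : ∀ l → f (l ℕ.* k ℕ.+ i % k) ≈ f (i % k)
    go zero    = refl
    go (suc l) = trans (reflexive (≡.cong f (ℕₚ.+-assoc k (l ℕ.* k) (i % k)))) (trans (per _) (go l))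

  -- The congruence makes i ↦ m i a permutation of the residues modulo k. It is applied with m = p,
  -- whose inverse modulo k is p^f.
  ∑-scale : ∀ k → .{{_ : NonZero k}} → ∀ m m′ → (m ℕ.* m′) % k ≡ 1 % k →
            ∀ {f : ℕ → Carrier} → (∀ i → f (k ℕ.+ i) ≈ f i) → ∑ k (λ i → f (m ℕ.* i)) ≈ ∑ k f
  ∑-scale k m m′ mm′≡1 {f} per = sym (begin
    ∑ k f  ≈⟨ ∑≈sum k f ⟩
    sum {k} (λ i → f (toℕ i))  ≈⟨ ∑-permute (λ i → f (toℕ i)) (permutation (times m) (times m′) (inverse m m′ mm′≡1)
                                                        (inverse m′ m (≡.trans (≡.cong (_% k) (ℕₚ.*-comm m′ m)) mm′≡1))) ⟩
    sum {k} (λ i → f (toℕ (times m i)))            ≈⟨ sum-cong-≋ {k} {λ i → f (toℕ (times m i))} {λ i → f (m ℕ.* toℕ i)} (λ i →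
                                                        trans (reflexive (≡.cong f (Finₚ.toℕ-fromℕ< (m%n<n (m ℕ.* toℕ i) k)))) (sym (periodic-% k per (m ℕ.* toℕ i)))) ⟩
    sum {k} (λ i → f (m ℕ.* toℕ i))  ≈⟨ ∑≈sum k (λ i → f (m ℕ.* i)) ⟨
    ∑ k (λ i → f (m ℕ.* i))  ∎)
    where
    times : ℕ → Fin k → Fin k
    times n i = fromℕ< (m%n<n (n ℕ.* toℕ i) k)

    inverse : ∀ m m′ → (m ℕ.* m′) % k ≡ 1 % k → ∀ i → times m (times m′ i) ≡ i
    inverse m m′ mm′≡1 i = Finₚ.toℕ-injective (≡.trans (Finₚ.toℕ-fromℕ< _) (≡.trans
      (≡.cong (λ r → (m ℕ.* r) % k) (Finₚ.toℕ-fromℕ< (m%n<n (m′ ℕ.* toℕ i) k))) (E.begin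
      (m ℕ.* ((m′ ℕ.* toℕ i) % k)) % k              E.≡⟨ %-distribˡ-* m _ k ⟩
      (m % k ℕ.* ((m′ ℕ.* toℕ i) % k % k)) % k      E.≡⟨ ≡.cong (λ r → (m % k ℕ.* r) % k) (m%n%n≡m%n (m′ ℕ.* toℕ i) k) ⟩
      (m % k ℕ.* ((m′ ℕ.* toℕ i) % k)) % k          E.≡⟨ %-distribˡ-* m (m′ ℕ.* toℕ i) k ⟨
      (m ℕ.* (m′ ℕ.* toℕ i)) % k  E.≡⟨ ≡.cong (_% k) (ℕₚ.*-assoc m m′ (toℕ i)) ⟨
      (m ℕ.* m′ ℕ.* toℕ i) % k  E.≡⟨ %-distribˡ-* (m ℕ.* m′) (toℕ i) k ⟩
      ((m ℕ.* m′) % k ℕ.* (toℕ i % k)) % k          E.≡⟨ ≡.cong (λ r → (r ℕ.* (toℕ i % k)) % k) mm′≡1 ⟩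
      (1 % k ℕ.* (toℕ i % k)) % k  E.≡⟨ %-distribˡ-* 1 (toℕ i) k ⟨
      (1 ℕ.* toℕ i) % k  E.≡⟨ ≡.cong (_% k) (ℕₚ.*-identityˡ (toℕ i)) ⟩
      toℕ i % k  E.≡⟨ m<n⇒m%n≡m (Finₚ.toℕ<n i) ⟩
      toℕ i  E.∎)))
      where module E = ≡.≡-Reasoning

-- Cancellation and geometric sums in a Heyting field

module HeytingFieldProperties {c ℓ₁ ℓ₂} (H : HeytingField c ℓ₁ ℓ₂) where
  open HeytingField H hiding (zero)
  open HeytingCommutativeRing heytingCommutativeRing using (commutativeRing)
  open CommutativeRing commutativeRing using (ring; commutativeSemiring)
  open IntegerScalars commutativeRing
  open RangeSum commutativeRing
  open ExpProperties commutativeSemiring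
  open HeytingProperties heytingCommutativeRing public
  open RingProperties ring using (x∙y⁻¹≈ε⇒x≈y)
  open SetoidReasoning setoid

  1≉0 : ¬ (1# ≈ 0#)
  1≉0 1≈0 = #-irrefl 1≈0 1#0

  #0⇒cancel : ∀ {x y} → x # 0# → x * y ≈ 0# → y ≈ 0#
  #0⇒cancel {x} {y} x#0 xy≈0 with x⁻¹ , left , _ ← #⇒invertible x#0 = begin
    y                     ≈⟨ *-identityˡ y ⟨
    1# * y  ≈⟨ *-congʳ left ⟨
    x⁻¹ * (x - 0#) * y    ≈⟨ solve 3 (λ a x y → a :* (x :- con (+ 0)) :* y := a :* (x :* y)) refl x⁻¹ x y ⟩
    x⁻¹ * (x * y)         ≈⟨ *-congˡ xy≈0 ⟩
    x⁻¹ * 0#              ≈⟨ zeroʳ _ ⟩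
    0#  ∎

  -- Equality is ¬¬-stable by tightness, so x ≉ 0 suffices although x need not be apart from 0.
  ≉0⇒cancel : ∀ {x y} → ¬ (x ≈ 0#) → x * y ≈ 0# → y ≈ 0#
  ≉0⇒cancel {x} {y} x≉0 xy≈0 = proj₁ (tight y 0#)
    λ y#0 → x≉0 (#0⇒cancel y#0 (trans (*-comm y x) xy≈0))

  ≉0⇒cancelˡ : ∀ {x y z} → ¬ (x ≈ 0#) → x * y ≈ x * z → y ≈ z
  ≉0⇒cancelˡ {x} {y} {z} x≉0 xy≈xz = x∙y⁻¹≈ε⇒x≈y y z (≉0⇒cancel x≉0 (begin
    x * (y - z)      ≈⟨ solve 3 (λ x y z → x :* (y :- z) := x :* y :- x :* z) refl x y z ⟩
    x * y - x * z    ≈⟨ +-congʳ xy≈xz ⟩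
    x * z - x * z    ≈⟨ -‿inverseʳ _ ⟩
    0#               ∎))

  *-≉0 : ∀ {x y} → ¬ (x ≈ 0#) → ¬ (y ≈ 0#) → ¬ (x * y ≈ 0#)
  *-≉0 x≉0 y≉0 = y≉0 ∘ ≉0⇒cancel x≉0

  ^-≉0 : ∀ {x} n → ¬ (x ≈ 0#) → ¬ (x ^ n ≈ 0#)
  ^-≉0 zero    x≉0 = 1≉0
  ^-≉0 (suc n) x≉0 = *-≉0 x≉0 (^-≉0 n x≉0)

  1^n≈1 : ∀ n → 1# ^ n ≈ 1#
  1^n≈1 zero    = refl
  1^n≈1 (suc n) = trans (*-identityˡ _) (1^n≈1 n)

  ^-multiple : ∀ {ω} D → ω ^ D ≈ 1# → ∀ k → ω ^ (D ℕ.* k) ≈ 1#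
  ^-multiple {ω} D ωᴰ≈1 k = trans (sym (^-assocʳ ω D k)) (trans (^-congˡ k ωᴰ≈1) (1^n≈1 k))

  ^-mod : ∀ {ω} D → .{{_ : NonZero D}} → ω ^ D ≈ 1# → ∀ k → ω ^ k ≈ ω ^ (k % D)
  ^-mod {ω} D ωᴰ≈1 k = begin
    ω ^ k  ≡⟨ ≡.cong (ω ^_) (m≡m%n+[m/n]*n k D) ⟩
    ω ^ (k % D ℕ.+ k / D ℕ.* D)        ≈⟨ ^-homo-* ω (k % D) _ ⟩
    ω ^ (k % D) * ω ^ (k / D ℕ.* D)    ≡⟨ ≡.cong (λ e → ω ^ (k % D) * ω ^ e) (ℕₚ.*-comm (k / D) D) ⟩
    ω ^ (k % D) * ω ^ (D ℕ.* (k / D))  ≈⟨ *-congˡ (^-multiple D ωᴰ≈1 (k / D)) ⟩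
    ω ^ (k % D) * 1#  ≈⟨ *-identityʳ _ ⟩
    ω ^ (k % D)  ∎

  ^-cong-% : ∀ {ω} D → .{{_ : NonZero D}} → ω ^ D ≈ 1# → ∀ {i j} → i % D ≡ j % D → ω ^ i ≈ ω ^ j
  ^-cong-% {ω} D ωᴰ≈1 {i} {j} eq =
    trans (^-mod D ωᴰ≈1 i) (trans (reflexive (≡.cong (ω ^_) eq)) (sym (^-mod D ωᴰ≈1 j)))

  -- Multiplication by ω - 1 telescopes to ω^n - 1 = 0. Inequality of ω and 1 is enough, because
  -- `≉0⇒cancel` asks for no apartness.
  geometricSum : ∀ n {ω} → ω ^ n ≈ 1# → ¬ (ω ≈ 1#) → ∑ n (ω ^_) ≈ 0#
  geometricSum n {ω} ωⁿ≈1 ω≉1 =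
    ≉0⇒cancel (λ eq → ω≉1 (x∙y⁻¹≈ε⇒x≈y ω 1# eq)) (begin
      (ω - 1#) * ∑ n (ω ^_)           ≈⟨ solve 3 (λ ω s one → (ω :- one) :* s := ω :* s :- one :* s) refl ω _ 1# ⟩
      ω * ∑ n (ω ^_) - 1# * ∑ n (ω ^_) ≈⟨ +-cong (sym (∑-*ˡ n ω (ω ^_))) (-‿cong (*-identityˡ _)) ⟩
      S′ - S  ≈⟨ solve 3 (λ a s s′ → s′ :- s := (a :+ s′) :- (s :+ a)) refl 1# S S′ ⟩
      ∑ (suc n) (ω ^_) - (S + 1#)     ≈⟨ +-congʳ (∑-last n (ω ^_)) ⟩
      (S + ω ^ n) - (S + 1#)          ≈⟨ +-congʳ (+-congˡ ωⁿ≈1) ⟩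
      (S + 1#) - (S + 1#)             ≈⟨ -‿inverseʳ _ ⟩
      0#  ∎)
    where
    S  = ∑ n (ω ^_)
    S′ = ∑ n (λ i → ω ^ suc i)

open AbelianGroupProperties ℤₚ.+-0-abelianGroup using (inverseˡ-unique)

-- Algebraic integers form a ring, and the rational ones are integers

module AlgebraicIntegers {c ℓ₁ ℓ₂} (K : CharZeroFieldWithRootsOfUnity c ℓ₁ ℓ₂) where
  open CharZeroFieldWithRootsOfUnity K hiding (zero; sum; _^_; _·_)
  open CommutativeRing commutativeRing using (commutativeSemiring)
  open IntegerScalars commutativeRing
  open RangeSum commutativeRing
  open ExpProperties commutativeSemiring
  open HeytingFieldProperties heytingField
  open SetoidReasoning setoid

  fromℤ≡ι : ∀ i → fromℤ i ≡ ι i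
  fromℤ≡ι (+ n)    = ≡.refl
  fromℤ≡ι -[1+ n ] = ≡.refl

  ι#0 : ∀ {i} → i ≢ + 0 → ι i # 0#
  ι#0 {+ zero}   i≢0 = contradiction ≡.refl i≢0
  ι#0 {+ suc n}  i≢0 = charZero (suc n)
  ι#0 { -[1+ n ]} i≢0 with y , left , _ ← #⇒invertible (charZero (suc n)) =
    invertibleˡ⇒# (- y , trans
      (solve 2 (λ y x → :- y :* (:- x :- con (+ 0)) := y :* (x :- con (+ 0))) refl y _) left)

  ι≈0⇒≡0 : ∀ {i} → ι i ≈ 0# → i ≡ + 0
  ι≈0⇒≡0 {i} ιi≈0 with i ℤₚ.≟ + 0
  ... | yes i≡0 = i≡0
  ... | no  i≢0 = contradiction (ι#0 i≢0) (#-irrefl ιi≈0)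

  ι-injective : ∀ {i j} → ι i ≈ ι j → i ≡ j
  ι-injective {i} {j} eq = ℤₚ.i-j≡0⇒i≡j i j (ι≈0⇒≡0 (begin
    ι (i ℤ.- j)      ≈⟨ trans (ι-+ i (ℤ.- j)) (+-congˡ (ι-neg j)) ⟩
    ι i - ι j        ≈⟨ +-congʳ eq ⟩
    ι j - ι j        ≈⟨ -‿inverseʳ _ ⟩
    0#               ∎))

  -- The ℤ-module generated by a list. Integrality of w will be equivalent to the existence of such
  -- a module that contains 1 and is stable under w, a criterion that passes to sums and products.
  data Span : List Carrier → Carrier → Set (c ⊔ ℓ₁) where
    []  : ∀ {x} → x ≈ 0# → Span [] x
    cons : ∀ {e es x y} a → Span es y → x ≈ ι a * e + y → Span (e ∷ es) x

  Span-resp : ∀ {es x y} → x ≈ y → Span es x → Span es y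
  Span-resp x≈y ([] x≈0)        = [] (trans (sym x≈y) x≈0)
  Span-resp x≈y (cons a s x≈)   = cons a s (trans (sym x≈y) x≈)

  Span-0 : ∀ es → Span es 0#
  Span-0 []       = [] refl
  Span-0 (e ∷ es) = cons (+ 0) (Span-0 es) (sym (trans (+-identityʳ _) (zeroˡ e)))

  Span-+ : ∀ {es x y} → Span es x → Span es y → Span es (x + y)
  Span-+ ([] x≈0) ([] y≈0) = [] (trans (+-cong x≈0 y≈0) (+-identityˡ 0#))
  Span-+ {e ∷ _} {x} {y} (cons {y = x′} a s x≈) (cons {y = y′} b t y≈) = cons (a ℤ.+ b) (Span-+ s t) (begin
    x + y  ≈⟨ +-cong x≈ y≈ ⟩
    (ι a * e + x′) + (ι b * e + y′)        ≈⟨ solve 5 (λ a b e x y → (a :* e :+ x) :+ (b :* e :+ y) := (a :+ b) :* e :+ (x :+ y)) refl (ι a) (ι b) e x′ y′ ⟩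
    (ι a + ι b) * e + (x′ + y′)            ≈⟨ +-congʳ (*-congʳ (ι-+ a b)) ⟨
    ι (a ℤ.+ b) * e + (x′ + y′)            ∎)

  Span-scale : ∀ {es x} b → Span es x → Span es (ι b * x)
  Span-scale b ([] x≈0) = [] (trans (*-congˡ x≈0) (zeroʳ _))
  Span-scale {e ∷ _} {x} b (cons {y = x′} a s x≈) = cons (b ℤ.* a) (Span-scale b s) (begin
    ι b * x  ≈⟨ *-congˡ x≈ ⟩
    ι b * (ι a * e + x′)        ≈⟨ solve 4 (λ a b e x → b :* (a :* e :+ x) := b :* a :* e :+ b :* x) refl (ι a) (ι b) e x′ ⟩
    ι b * ι a * e + ι b * x′    ≈⟨ +-congʳ (*-congʳ (ι-* b a)) ⟨
    ι (b ℤ.* a) * e + ι b * x′  ∎)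

  Span-neg : ∀ {es x} → Span es x → Span es (- x)
  Span-neg {x = x} s = Span-resp (solve 1 (λ x → con (ℤ.- + 1) :* x := :- x) refl x) (Span-scale (ℤ.- + 1) s)

  Span-map⁺ : ∀ {es x} w → Span es x → Span (List.map (w *_) es) (w * x)
  Span-map⁺ w ([] x≈0) = [] (trans (*-congˡ x≈0) (zeroʳ w))
  Span-map⁺ {e ∷ _} w (cons {y = x′} a s x≈) = cons a (Span-map⁺ w s) (trans (*-congˡ x≈)
    (solve 4 (λ w a e x → w :* (a :* e :+ x) := a :* (w :* e) :+ w :* x) refl w (ι a) e x′))

  Span-map⁻ : ∀ {es x} w → Span (List.map (w *_) es) x → ∃[ y ] Span es y × x ≈ w * y
  Span-map⁻ {[]}    w ([] x≈0) = 0# , [] refl , trans x≈0 (sym (zeroʳ w))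
  Span-map⁻ {e ∷ _} w (cons a s x≈) with y , t , eq ← Span-map⁻ w s =
    ι a * e + y , cons a t refl , trans (trans x≈ (+-congˡ eq))
      (solve 4 (λ w a e x → a :* (w :* e) :+ w :* x := w :* (a :* e :+ x)) refl w (ι a) e y)

  Span-++⁺ : ∀ {es fs x y} → Span es x → Span fs y → Span (es ++ fs) (x + y)
  Span-++⁺ ([] x≈0) t = Span-resp (sym (trans (+-congʳ x≈0) (+-identityˡ _))) t
  Span-++⁺ (cons a s x≈) t = cons a (Span-++⁺ s t) (trans (+-congʳ x≈) (+-assoc _ _ _))

  Span-++⁻ : ∀ es {fs x} → Span (es ++ fs) x → ∃[ y ] ∃[ z ] Span es y × Span fs z × x ≈ y + z
  Span-++⁻ []       t = 0# , _ , [] refl , t , sym (+-identityˡ _)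
  Span-++⁻ (e ∷ es) (cons a s x≈) with y , z , s₁ , s₂ , eq ← Span-++⁻ es s =
    ι a * e + y , z , cons a s₁ refl , s₂ , trans (trans x≈ (+-congˡ eq)) (sym (+-assoc _ _ _))

  Span-generators : ∀ es → All (Span es) es
  Span-generators []       = []
  Span-generators (e ∷ es) =
    cons (+ 1) (Span-0 es) (sym (trans (+-identityʳ _) (trans (*-congʳ ι-1) (*-identityˡ e))))
    ∷ All.map (λ s → cons (+ 0) s (sym (trans (+-congʳ (zeroˡ e)) (+-identityˡ _)))) (Span-generators es)

  Span-annihilated : ∀ {es x} w → All (λ e → w * e ≈ 0#) es → Span es x → w * x ≈ 0#
  Span-annihilated w []         ([] x≈0)      = trans (*-congˡ x≈0) (zeroʳ w)
  Span-annihilated w (we ∷ wes) (cons {e = e} {x = x} {y = y} a s x≈) = begin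
    w * x  ≈⟨ *-congˡ x≈ ⟩
    w * (ι a * e + y)             ≈⟨ solve 4 (λ w a e y → w :* (a :* e :+ y) := a :* (w :* e) :+ w :* y) refl w (ι a) e y ⟩
    ι a * (w * e) + w * y         ≈⟨ +-cong (trans (*-congˡ we) (zeroʳ _)) (Span-annihilated w wes s) ⟩
    0# + 0#  ≈⟨ +-identityˡ 0# ⟩
    0#  ∎

  Stabilises : Carrier → List Carrier → Set (c ⊔ ℓ₁)
  Stabilises w es = ∀ {x} → Span es x → Span es (w * x)

  module Adjoin (w : Carrier) (es : List Carrier) where
    -- Generators w^i e with i < d. Once d is the degree of a monic equation of w, their span is
    -- stable under w.
    powers : ℕ → List Carrier
    powers zero    = []
    powers (suc d) = es ++ List.map (w *_) (powers d)

    powers-suc⁺ : ∀ d {x y} → Span es x → Span (powers d) y → Span (powers (suc d)) (x + w * y)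
    powers-suc⁺ d s t = Span-++⁺ s (Span-map⁺ w t)

    powers-suc⁻ : ∀ d {z} → Span (powers (suc d)) z →
                  ∃[ x ] ∃[ y ] Span es x × Span (powers d) y × z ≈ x + w * y
    powers-suc⁻ d u with x , y′ , s , t′ , eq ← Span-++⁻ es u
      with y , t , eq′ ← Span-map⁻ w t′ = x , y , s , t , trans eq (+-congˡ eq′)

    powers-stable : ∀ {v} → Stabilises v es → ∀ d → Stabilises v (powers d)
    powers-stable {v} stable zero    ([] x≈0) = [] (trans (*-congˡ x≈0) (zeroʳ _))
    powers-stable {v} stable (suc d) u with x , y , s , t , eq ← powers-suc⁻ d u =
      Span-resp (trans (solve 4 (λ v w x y → v :* x :+ w :* (v :* y) := v :* (x :+ w :* y)) refl v w x y) (*-congˡ (sym eq)))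
        (powers-suc⁺ d (stable s) (powers-stable stable d t))

    powers-top : ∀ d {z} → Span (powers (suc d)) z →
                 ∃[ y ] ∃[ x ] Span (powers d) y × Span es x × z ≈ y + w ^ d * x
    powers-top zero    u with x , y , s , [] y≈0 , eq ← powers-suc⁻ 0 u =
      0# , x , [] refl , s , (begin
        _               ≈⟨ eq ⟩
        x + w * y       ≈⟨ +-congˡ (trans (*-congˡ y≈0) (zeroʳ w)) ⟩
        x + 0#          ≈⟨ +-comm _ _ ⟩
        0# + x          ≈⟨ +-congˡ (*-identityˡ x) ⟨
        0# + 1# * x     ∎)
    powers-top (suc d) u with x , y , s , t , eq ← powers-suc⁻ (suc d) u
      with y′ , x′ , t′ , s′ , eq′ ← powers-top d t =
      x + w * y′ , x′ , powers-suc⁺ d s t′ , s′ , trans (trans eq (+-congˡ (*-congˡ eq′)))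
        (solve 5 (λ x w y′ p x′ → x :+ w :* (y′ :+ p :* x′) := (x :+ w :* y′) :+ w :* p :* x′) refl x w y′ (w ^ d) x′)

    leadingTerm : ∀ as {x} → Span es x →
                  ∃[ z ] Span (powers (length as)) z × evalMonic as w * x ≈ w ^ length as * x + z
    leadingTerm []       s = 0# , [] refl , sym (+-identityʳ _)
    leadingTerm (a ∷ as) {x} s with z , t , eq ← leadingTerm as s =
      ι a * x + w * z , powers-suc⁺ (length as) (Span-scale a s) t , (begin
        (fromℤ a + w * E) * x               ≡⟨ ≡.cong (λ b → (b + w * E) * x) (fromℤ≡ι a) ⟩
        (ι a + w * E) * x  ≈⟨ solve 4 (λ a w e x → (a :+ w :* e) :* x := a :* x :+ w :* (e :* x)) refl (ι a) w E x ⟩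
        ι a * x + w * (E * x)               ≈⟨ +-congˡ (*-congˡ eq) ⟩
        ι a * x + w * (w ^ n * x + z)       ≈⟨ solve 5 (λ a w p x z → a :* x :+ w :* (p :* x :+ z) := w :* p :* x :+ (a :* x :+ w :* z)) refl (ι a) w (w ^ n) x z ⟩
        w ^ suc n * x + (ι a * x + w * z)   ∎)
      where
      E = evalMonic as w
      n = length as

    -- Multiplication by w creates a single new top term w^d x, and the monic equation multiplied by
    -- x trades it for lower powers.
    powers-stable-root : ∀ as → evalMonic as w ≈ 0# → Stabilises w (powers (length as))
    powers-stable-root as root {z} u
      with y , x , t , s , eq ← powers-top (length as) (powers-suc⁺ (length as) (Span-0 es) u)
      with z′ , t′ , eq′ ← leadingTerm as s = Span-resp (begin
        y - z′  ≈⟨ +-congˡ (-‿cong (solve 2 (λ z′ p → z′ := (p :+ z′) :- p) refl z′ P)) ⟩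
        y - ((P + z′) - P)              ≈⟨ +-congˡ (-‿cong (+-congʳ eq′)) ⟨
        y - (evalMonic as w * x - P)    ≈⟨ +-congˡ (-‿cong (+-congʳ (trans (*-congʳ root) (zeroˡ x)))) ⟩
        y - (0# - P)  ≈⟨ solve 2 (λ y p → y :- (con (+ 0) :- p) := y :+ p) refl y P ⟩
        y + P  ≈⟨ eq ⟨
        0# + w * z  ≈⟨ +-identityˡ _ ⟩
        w * z  ∎) (Span-+ t (Span-neg t′))
      where P = w ^ length as * x

  -- The last component allows iteration: a module already stable under one integer stays so while a
  -- second one is adjoined.
  adjoin : ∀ {w} → IsAlgebraicInteger w → ∀ es → Span es 1# →
           ∃[ fs ] Span fs 1# × Stabilises w fs × (∀ v → Stabilises v es → Stabilises v fs)
  adjoin     ([] , 1≈0) es 1∈es = contradiction 1≈0 1≉0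
  adjoin {w} (as@(_ ∷ bs) , root) es 1∈es =
    powers (length as)
    , Span-resp (trans (+-congˡ (zeroʳ w)) (+-identityʳ 1#)) (powers-suc⁺ (length bs) 1∈es (Span-0 (powers (length bs))))
    , powers-stable-root as root
    , λ v stable → powers-stable stable (length as)
    where open Adjoin w es

  -- Elimination over ℤ[w]: a stable module yields a monic equation

  module Elimination (w : Carrier) where

    data Low : ℕ → Carrier → Set (c ⊔ ℓ₁) where
      zero : ∀ {x} → x ≈ 0# → Low 0 x
      suc  : ∀ {d x y} a → Low d y → x ≈ ι a + w * y → Low (suc d) x

    Low-resp : ∀ {d x y} → x ≈ y → Low d x → Low d y
    Low-resp x≈y (zero x≈0)   = zero (trans (sym x≈y) x≈0)
    Low-resp x≈y (suc a l x≈) = suc a l (trans (sym x≈y) x≈)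

    Low-0 : ∀ d → Low d 0#
    Low-0 zero    = zero refl
    Low-0 (suc d) = suc (+ 0) (Low-0 d) (sym (trans (+-identityˡ _) (zeroʳ w)))

    Low-+ : ∀ {d x y} → Low d x → Low d y → Low d (x + y)
    Low-+ (zero x≈0) (zero y≈0) = zero (trans (+-cong x≈0 y≈0) (+-identityˡ 0#))
    Low-+ {_} {x} {y} (suc {y = x′} a l x≈) (suc {y = y′} b m y≈) = suc (a ℤ.+ b) (Low-+ l m) (begin
      x + y  ≈⟨ +-cong x≈ y≈ ⟩
      (ι a + w * x′) + (ι b + w * y′)     ≈⟨ solve 5 (λ a b w x y → (a :+ w :* x) :+ (b :+ w :* y) := (a :+ b) :+ w :* (x :+ y)) refl (ι a) (ι b) w x′ y′ ⟩
      (ι a + ι b) + w * (x′ + y′)         ≈⟨ +-congʳ (ι-+ a b) ⟨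
      ι (a ℤ.+ b) + w * (x′ + y′)         ∎)

    Low-scale : ∀ {d x} b → Low d x → Low d (ι b * x)
    Low-scale b (zero x≈0) = zero (trans (*-congˡ x≈0) (zeroʳ _))
    Low-scale b (suc {x = x} {y = x′} a l x≈) = suc (b ℤ.* a) (Low-scale b l) (begin
      ι b * x  ≈⟨ *-congˡ x≈ ⟩
      ι b * (ι a + w * x′)        ≈⟨ solve 4 (λ a b w x → b :* (a :+ w :* x) := b :* a :+ w :* (b :* x)) refl (ι a) (ι b) w x′ ⟩
      ι b * ι a + w * (ι b * x′)  ≈⟨ +-congʳ (ι-* b a) ⟨
      ι (b ℤ.* a) + w * (ι b * x′) ∎)

    Low-neg : ∀ {d x} → Low d x → Low d (- x)
    Low-neg {x = x} l = Low-resp (solve 1 (λ x → con (ℤ.- + 1) :* x := :- x) refl x) (Low-scale (ℤ.- + 1) l)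

    Low-suc : ∀ {d x} → Low d x → Low (suc d) x
    Low-suc (zero x≈0)   = Low-resp (sym x≈0) (Low-0 1)
    Low-suc (suc a l x≈) = suc a (Low-suc l) x≈

    Low-pad : ∀ k {d x} → Low d x → Low (k ℕ.+ d) x
    Low-pad zero    l = l
    Low-pad (suc k) l = Low-suc (Low-pad k l)

    Low-w* : ∀ {d x} → Low d x → Low (suc d) (w * x)
    Low-w* l = suc (+ 0) l (sym (+-identityˡ _))

    Low-w^* : ∀ k {d x} → Low d x → Low (k ℕ.+ d) (w ^ k * x)
    Low-w^* zero    l = Low-resp (sym (*-identityˡ _)) l
    Low-w^* (suc k) l = Low-resp (sym (*-assoc _ _ _)) (Low-w* (Low-w^* k l))

    Low-* : ∀ {d d′ x y} → Low d x → Low d′ y → Low (d ℕ.+ d′) (x * y)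
    Low-* {d′ = d′} {y = y} (zero x≈0) m = Low-resp (sym (trans (*-congʳ x≈0) (zeroˡ y))) (Low-0 d′)
    Low-* {suc d} {y = y} (suc {x = x} {y = x′} a l x≈) m =
      Low-resp (trans (solve 4 (λ a w x y → a :* y :+ w :* (x :* y) := (a :+ w :* x) :* y) refl (ι a) w x′ y) (*-congʳ (sym x≈)))
        (Low-+ (Low-pad (suc d) (Low-scale a m)) (Low-w* (Low-* l m)))

    -- Values at w of integer polynomials: Low d for degree below d, Monic d for monic of degree d.
    Monic : ℕ → Carrier → Set (c ⊔ ℓ₁)
    Monic d x = Low d (x - w ^ d)

    Monic-sub : ∀ {d x y} → Monic d x → Low d y → Monic d (x - y)
    Monic-sub {d} {x} {y} m l = Low-resp
      (solve 3 (λ x y p → (x :- p) :- y := (x :- y) :- p) refl x y (w ^ d)) (Low-+ m (Low-neg l))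

    Monic-*Low : ∀ {d d′ x y} → Monic d x → Low d′ y → Low (d ℕ.+ d′) (x * y)
    Monic-*Low {d} {x = x} {y} m l = Low-resp
      (solve 3 (λ x y p → (x :- p) :* y :+ p :* y := x :* y) refl x y (w ^ d))
      (Low-+ (Low-* m l) (Low-w^* d l))

    Monic-* : ∀ {d d′ x y} → Monic d x → Monic d′ y → Monic (d ℕ.+ d′) (x * y)
    Monic-* {d} {d′} {x} {y} m m′ = Low-resp (begin
      x * (y - w ^ d′) + w ^ d′ * (x - w ^ d)
        ≈⟨ solve 4 (λ x y p p′ → x :* (y :- p′) :+ p′ :* (x :- p) := x :* y :- p :* p′) refl x y (w ^ d) (w ^ d′) ⟩
      x * y - w ^ d * w ^ d′      ≈⟨ +-congˡ (-‿cong (^-homo-* w d d′)) ⟨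
      x * y - w ^ (d ℕ.+ d′)      ∎)
      (Low-+ (Monic-*Low m m′)
             (≡.subst (λ n → Low n (w ^ d′ * (x - w ^ d))) (ℕₚ.+-comm d′ d) (Low-w^* d′ m)))

    Monic⇒integral : ∀ {d} → Monic d 0# → IsAlgebraicInteger w
    Monic⇒integral {d} m = coefficients m , (begin
      evalMonic (coefficients m) w      ≈⟨ evaluate m ⟩
      (0# - w ^ d) + w ^ d              ≈⟨ solve 1 (λ p → (con (+ 0) :- p) :+ p := con (+ 0)) refl (w ^ d) ⟩
      0#  ∎)
      where
      coefficients : ∀ {d x} → Low d x → List ℤ
      coefficients (zero _)    = []
      coefficients (suc a l _) = a ∷ coefficients l

      evaluate : ∀ {d x} (l : Low d x) → evalMonic (coefficients l) w ≈ x + w ^ d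
      evaluate (zero x≈0) = sym (trans (+-congʳ x≈0) (+-identityˡ 1#))
      evaluate {suc d} (suc {x = x} {y = y} a l x≈) = begin
        fromℤ a + w * evalMonic (coefficients l) w  ≈⟨ +-cong (reflexive (fromℤ≡ι a)) (*-congˡ (evaluate l)) ⟩
        ι a + w * (y + w ^ d)  ≈⟨ solve 4 (λ a w y p → a :+ w :* (y :+ p) := (a :+ w :* y) :+ w :* p) refl (ι a) w y (w ^ d) ⟩
        (ι a + w * y) + w ^ suc d  ≈⟨ +-congʳ x≈ ⟨
        x + w ^ suc d  ∎

    -- The rows of the linear system: like `Span`, with coefficients that are polynomials in w of
    -- degree below d.
    data LowSpan (d : ℕ) : List Carrier → Carrier → Set (c ⊔ ℓ₁) where
      []   : ∀ {x} → x ≈ 0# → LowSpan d [] x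
      cons : ∀ {e es x y g} → Low d g → LowSpan d es y → x ≈ g * e + y → LowSpan d (e ∷ es) x

    LowSpan-resp : ∀ {d es x y} → x ≈ y → LowSpan d es x → LowSpan d es y
    LowSpan-resp x≈y ([] x≈0)      = [] (trans (sym x≈y) x≈0)
    LowSpan-resp x≈y (cons g s x≈) = cons g s (trans (sym x≈y) x≈)

    LowSpan-+ : ∀ {d es x y} → LowSpan d es x → LowSpan d es y → LowSpan d es (x + y)
    LowSpan-+ ([] x≈0) ([] y≈0) = [] (trans (+-cong x≈0 y≈0) (+-identityˡ 0#))
    LowSpan-+ {es = e ∷ _} (cons {y = x′} {g = g} l s x≈) (cons {y = y′} {g = h} m t y≈) =
      cons (Low-+ l m) (LowSpan-+ s t) (trans (+-cong x≈ y≈)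
        (solve 5 (λ a b e x y → (a :* e :+ x) :+ (b :* e :+ y) := (a :+ b) :* e :+ (x :+ y)) refl g h e x′ y′))

    LowSpan-* : ∀ {d d′ es x v} → (∀ {g} → Low d g → Low d′ (v * g)) → LowSpan d es x → LowSpan d′ es (v * x)
    LowSpan-* {v = v} f ([] x≈0) = [] (trans (*-congˡ x≈0) (zeroʳ v))
    LowSpan-* {es = e ∷ _} {v = v} f (cons {y = y} {g = g} l s x≈) = cons (f l) (LowSpan-* f s)
      (trans (*-congˡ x≈) (solve 4 (λ v g e y → v :* (g :* e :+ y) := v :* g :* e :+ v :* y) refl v g e y))

    Span⇒LowSpan : ∀ {es x} → Span es x → LowSpan 1 es x
    Span⇒LowSpan ([] x≈0)      = [] x≈0
    Span⇒LowSpan (cons a s x≈) =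
      cons (suc a (zero refl) (sym (trans (+-congˡ (zeroʳ w)) (+-identityʳ _)))) (Span⇒LowSpan s) x≈

    LowSpan-annihilated : ∀ {d es f z} → All (λ e → f * e ≈ 0#) es → LowSpan d es z → f * z ≈ 0#
    LowSpan-annihilated [] ([] z≈0) = trans (*-congˡ z≈0) (zeroʳ _)
    LowSpan-annihilated {f = f} (fe ∷ fes) (cons {e = e} {x = z} {y = y} {g = g} _ s z≈) = begin
      f * z  ≈⟨ *-congˡ z≈ ⟩
      f * (g * e + y)           ≈⟨ solve 4 (λ f g e y → f :* (g :* e :+ y) := g :* (f :* e) :+ f :* y) refl f g e y ⟩
      g * (f * e) + f * y       ≈⟨ +-cong (trans (*-congˡ fe) (zeroʳ g)) (LowSpan-annihilated fes s) ⟩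
      0# + 0#  ≈⟨ +-identityˡ 0# ⟩
      0#  ∎

    -- Gaussian elimination on f e ∈ Low · es: the pivot f − (low) stays monic, so no division is needed.
    eliminate : ∀ es {d f} → Monic d f → All (λ e → LowSpan d es (f * e)) es →
                ∃[ d′ ] ∃[ f′ ] Monic d′ f′ × All (λ e → f′ * e ≈ 0#) es
    eliminate []       {d} {f} m []  = d , f , m , []
    eliminate (e ∷ es) {d} {f} m (cons {y = y} {g = g} l s fe≈ ∷ rows) =
      let d″ , f″ , m″ , annihilates = eliminate es (Monic-* (Monic-sub m l) m) (All.map row rows)
      in d″ ℕ.+ d , f″ * h , Monic-* m″ (Monic-sub m l)
      , (begin
          f″ * h * e       ≈⟨ *-assoc _ _ _ ⟩
          f″ * (h * e)     ≈⟨ *-congˡ he≈y ⟩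
          f″ * y           ≈⟨ LowSpan-annihilated annihilates s ⟩
          0#               ∎)
        ∷ All.map (λ {e′} f″e′≈0 → trans (solve 3 (λ f h e → f :* h :* e := h :* (f :* e)) refl f″ h e′)
                                         (trans (*-congˡ f″e′≈0) (zeroʳ h))) annihilates
      where
      h = f - g
      he≈y : h * e ≈ y
      he≈y = begin
        (f - g) * e            ≈⟨ solve 3 (λ f g e → (f :- g) :* e := f :* e :- g :* e) refl f g e ⟩
        f * e - g * e          ≈⟨ +-congʳ fe≈ ⟩
        (g * e + y) - g * e    ≈⟨ solve 2 (λ p y → (p :+ y) :- p := y) refl (g * e) y ⟩
        y                      ∎
      -- Multiplying by the pivot h replaces h e by y, which removes e from the row. The degree
      -- bound doubles, and so does the degree of the new leading factor h f.
      row : ∀ {e′} → LowSpan d (e ∷ es) (f * e′) → LowSpan (d ℕ.+ d) es (h * f * e′)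
      row {e′} (cons {y = y′} {g = g′} l′ s′ fe′≈) = LowSpan-resp (begin
        g′ * y + h * y′  ≈⟨ +-congʳ (*-congˡ he≈y) ⟨
        g′ * (h * e) + h * y′          ≈⟨ solve 4 (λ g h e y → g :* (h :* e) :+ h :* y := h :* (g :* e :+ y)) refl g′ h e y′ ⟩
        h * (g′ * e + y′)              ≈⟨ *-congˡ fe′≈ ⟨
        h * (f * e′)  ≈⟨ *-assoc _ _ _ ⟨
        h * f * e′  ∎)
        (LowSpan-+ (LowSpan-* (Low-* l′) s) (LowSpan-* (Monic-*Low (Monic-sub m l)) s′))

  -- Elimination starts with f = w, monic of degree one, and constant rows. The monic f that it
  -- returns kills every generator, hence also 1, so f = 0 is a monic equation for w.
  stabilises⇒integral : ∀ {w} es → Span es 1# → Stabilises w es → IsAlgebraicInteger w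
  stabilises⇒integral {w} es 1∈es stable =
    let d , f , m , annihilates = eliminate es w-monic (All.map (λ s → Span⇒LowSpan (stable s)) (Span-generators es))
    in Monic⇒integral (Low-resp (+-congʳ (begin
        f         ≈⟨ *-identityʳ f ⟨
        f * 1#    ≈⟨ Span-annihilated f annihilates 1∈es ⟩
        0#        ∎)) m)
    where
    open Elimination w
    w-monic : Monic 1 w
    w-monic = Low-resp (sym (trans (+-congˡ (-‿cong (*-identityʳ w))) (-‿inverseʳ w))) (Low-0 1)

  integral-resp : ∀ {x y} → x ≈ y → IsAlgebraicInteger x → IsAlgebraicInteger y
  integral-resp {x} {y} x≈y (as , root) = as , trans (sym (evalMonic-cong as)) root
    where
    evalMonic-cong : ∀ as → evalMonic as x ≈ evalMonic as y
    evalMonic-cong []       = refl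
    evalMonic-cong (a ∷ as) = +-congˡ (*-cong x≈y (evalMonic-cong as))

  integral-ι : ∀ i → IsAlgebraicInteger (ι i)
  integral-ι i = ℤ.- i ∷ [] , (begin
    fromℤ (ℤ.- i) + ι i * 1#    ≈⟨ +-cong (trans (reflexive (fromℤ≡ι (ℤ.- i))) (ι-neg i)) (*-identityʳ _) ⟩
    - ι i + ι i  ≈⟨ -‿inverseˡ _ ⟩
    0#  ∎)

  -- The equation is x^n - 1 = 0, presented to `Monic⇒integral` by reading -1 as a polynomial of
  -- degree below n with value 0 - ω^n.
  integral-root : ∀ n → 1 ℕ.≤ n → ∀ {ω} → ω ^ n ≈ 1# → IsAlgebraicInteger ω
  integral-root (suc n) _ {ω} ωⁿ≈1 = Monic⇒integral (Low-resp
      (trans (solve 1 (λ w → con (ℤ.- + 1) := con (+ 0) :- con (+ 1)) refl ω) (+-congˡ (-‿cong (trans ι-1 (sym ωⁿ≈1)))))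
      (≡.subst (λ d → Low d (ι (ℤ.- + 1))) (ℕₚ.+-comm n 1)
        (Low-pad n (suc (ℤ.- + 1) (zero refl) (sym (trans (+-congˡ (zeroʳ ω)) (+-identityʳ _)))))))
    where open Elimination ω

  private
    common : ∀ {x y} → IsAlgebraicInteger x → IsAlgebraicInteger y →
             ∃[ es ] Span es 1# × Stabilises x es × Stabilises y es
    common x-int y-int
      with es , 1∈es , x-stable , _ ← adjoin x-int (1# ∷ [])
             (cons (+ 1) ([] refl) (sym (trans (+-identityʳ _) (trans (*-identityʳ _) ι-1))))
      with fs , 1∈fs , y-stable , inherit ← adjoin y-int es 1∈es
      = fs , 1∈fs , inherit _ x-stable , y-stable

  integral-+ : ∀ {x y} → IsAlgebraicInteger x → IsAlgebraicInteger y → IsAlgebraicInteger (x + y)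
  integral-+ x-int y-int with es , 1∈es , x-stable , y-stable ← common x-int y-int =
    stabilises⇒integral es 1∈es (λ s → Span-resp (sym (distribʳ _ _ _)) (Span-+ (x-stable s) (y-stable s)))

  integral-* : ∀ {x y} → IsAlgebraicInteger x → IsAlgebraicInteger y → IsAlgebraicInteger (x * y)
  integral-* x-int y-int with es , 1∈es , x-stable , y-stable ← common x-int y-int =
    stabilises⇒integral es 1∈es (λ s → Span-resp (sym (*-assoc _ _ _)) (x-stable (y-stable s)))

  integral-^ : ∀ n {x} → IsAlgebraicInteger x → IsAlgebraicInteger (x ^ n)
  integral-^ zero    x-int = integral-resp ι-1 (integral-ι (+ 1))
  integral-^ (suc n) x-int = integral-* x-int (integral-^ n x-int)

  integral-∑ : ∀ n {f : ℕ → Carrier} → (∀ i → i ℕ.< n → IsAlgebraicInteger (f i)) → IsAlgebraicInteger (∑ n f)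
  integral-∑ zero    f-int = integral-ι (+ 0)
  integral-∑ (suc n) f-int = integral-+ (f-int 0 (s≤s z≤n)) (integral-∑ n (λ i i<n → f-int (suc i) (s≤s i<n)))

  private
    -- Clearing denominators in a monic equation for y = n / D.
    clear : ∀ as {y} D n → ι D * y ≈ ι n →
            ∃[ z ] ι (D ℤ.^ length as) * evalMonic as y ≈ ι (n ℤ.^ length as ℤ.+ D ℤ.* z)
    clear []       {y} D n Dy≈n = + 0 , (begin
      ι (+ 1) * 1#              ≈⟨ *-identityʳ _ ⟩
      ι (+ 1)  ≡⟨ ≡.cong (λ i → ι (+ 1 ℤ.+ i)) (ℤₚ.*-zeroʳ D) ⟨
      ι (+ 1 ℤ.+ D ℤ.* + 0)     ∎)
    clear (a ∷ as) {y} D n Dy≈n with z , eq ← clear as D n Dy≈n =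
      a ℤ.* D ℤ.^ l ℤ.+ n ℤ.* z , (begin
        ι (D ℤ.* D ℤ.^ l) * (fromℤ a + y * E)             ≈⟨ *-cong (ι-* D (D ℤ.^ l)) (+-congʳ (reflexive (fromℤ≡ι a))) ⟩
        ι D * ι (D ℤ.^ l) * (ι a + y * E)  ≈⟨ solve 5 (λ d p a y e → d :* p :* (a :+ y :* e) := d :* (a :* p) :+ d :* y :* (p :* e)) refl (ι D) (ι (D ℤ.^ l)) (ι a) y E ⟩
        ι D * (ι a * ι (D ℤ.^ l)) + ι D * y * (ι (D ℤ.^ l) * E)
          ≈⟨ +-cong (*-congˡ (sym (ι-* a (D ℤ.^ l)))) (*-cong Dy≈n (trans eq (trans (ι-+ (n ℤ.^ l) (D ℤ.* z)) (+-congˡ (ι-* D z))))) ⟩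
        ι D * ι (a ℤ.* D ℤ.^ l) + ι n * (ι (n ℤ.^ l) + ι D * ι z)
          ≈⟨ solve 5 (λ d b n p z → d :* b :+ n :* (p :+ d :* z) := n :* p :+ d :* (b :+ n :* z)) refl (ι D) (ι (a ℤ.* D ℤ.^ l)) (ι n) (ι (n ℤ.^ l)) (ι z) ⟩
        ι n * ι (n ℤ.^ l) + ι D * (ι (a ℤ.* D ℤ.^ l) + ι n * ι z)
          ≈⟨ +-cong (ι-* n (n ℤ.^ l)) (*-congˡ (trans (ι-+ (a ℤ.* D ℤ.^ l) (n ℤ.* z)) (+-congˡ (ι-* n z)))) ⟨
        ι (n ℤ.* n ℤ.^ l) + ι D * ι (a ℤ.* D ℤ.^ l ℤ.+ n ℤ.* z)
          ≈⟨ trans (ι-+ (n ℤ.* n ℤ.^ l) (D ℤ.* z′)) (+-congˡ (ι-* D z′)) ⟨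
        ι (n ℤ.* n ℤ.^ l ℤ.+ D ℤ.* (a ℤ.* D ℤ.^ l ℤ.+ n ℤ.* z)) ∎)
      where
      E = evalMonic as y
      l = length as
      z′ = a ℤ.* D ℤ.^ l ℤ.+ n ℤ.* z

    prime∣^ : ∀ {ℓ} → Prime ℓ → ∀ n k → ℓ ∣ℕ ℤ.∣ n ℤ.^ k ∣ → ℓ ∣ℕ ℤ.∣ n ∣
    prime∣^ {ℓ} ℓ-prime n zero    ℓ∣1 = contradiction (≡.subst Prime (ℕ∣.∣1⇒≡1 ℓ∣1) ℓ-prime) ¬prime[1]
    prime∣^ ℓ-prime n (suc k) ℓ∣ =
      [ id , prime∣^ ℓ-prime n k ]′ (euclidsLemma _ _ ℓ-prime (≡.subst (_ ∣ℕ_) (ℤₚ.abs-* n (n ℤ.^ k)) ℓ∣))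

    -- The cleared equation reads n^l + ℓ D z = 0, so ℓ divides a power of n and therefore n.
    prime∣numerator : ∀ {ℓ} → Prime ℓ → ∀ {y} D n → IsAlgebraicInteger y → ι (+ ℓ ℤ.* D) * y ≈ ι n → + ℓ ℤ∣.∣ n
    prime∣numerator {ℓ} ℓ-prime {y} D n (as , root) Dy≈n with z , eq ← clear as (+ ℓ ℤ.* D) n Dy≈n =
      ℤ∣.∣ᵤ⇒∣ (prime∣^ ℓ-prime n (length as) (ℤ∣.∣⇒∣ᵤ (ℤ∣.divides (ℤ.- (D ℤ.* z))
        (≡.trans (inverseˡ-unique (n ℤ.^ length as) (+ ℓ ℤ.* D ℤ.* z) sum≡0) (rearrange (+ ℓ) D z)))))
      where
      sum≡0 : n ℤ.^ length as ℤ.+ + ℓ ℤ.* D ℤ.* z ≡ + 0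
      rearrange : ∀ ℓ D z → ℤ.- (ℓ ℤ.* D ℤ.* z) ≡ ℤ.- (D ℤ.* z) ℤ.* ℓ
      rearrange = ℤSolver.solve-∀
      sum≡0 = ι≈0⇒≡0 (trans (sym eq) (trans (*-congˡ root) (zeroʳ _)))

    divideByPrimes : ∀ {y} → IsAlgebraicInteger y → ∀ ps → All Prime ps → ∀ n →
                     ι (+ product ps) * y ≈ ι n → ∃[ z ] y ≈ ι z
    divideByPrimes {y} y-int []       []              n eq = n , trans (sym (trans (*-congʳ ι-1) (*-identityˡ y))) eq
    divideByPrimes {y} y-int (ℓ ∷ ps) (ℓ-prime ∷ prs) n eq =
      let ℤ∣.divides k n≡kℓ = prime∣numerator ℓ-prime (+ product ps) n y-int
            (trans (*-congʳ (reflexive (≡.cong ι (≡.sym (ℤₚ.pos-* ℓ (product ps)))))) eq)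
      in divideByPrimes y-int ps prs k (≉0⇒cancelˡ (λ ιℓ≈0 → ℓ≢0 (ι≈0⇒≡0 ιℓ≈0)) (begin
        ι (+ ℓ) * (ι (+ product ps) * y)     ≈⟨ *-assoc _ _ _ ⟨
        ι (+ ℓ) * ι (+ product ps) * y       ≈⟨ *-congʳ (ι-* (+ ℓ) (+ product ps)) ⟨
        ι (+ ℓ ℤ.* + product ps) * y         ≡⟨ ≡.cong (λ i → ι i * y) (ℤₚ.pos-* ℓ (product ps)) ⟨
        ι (+ (ℓ ℕ.* product ps)) * y         ≈⟨ eq ⟩
        ι n  ≡⟨ ≡.cong ι (≡.trans n≡kℓ (ℤₚ.*-comm k (+ ℓ))) ⟩
        ι (+ ℓ ℤ.* k)  ≈⟨ ι-* (+ ℓ) k ⟩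
        ι (+ ℓ) * ι k  ∎))
      where
      ℓ≢0 : + ℓ ≢ + 0
      ℓ≢0 ≡.refl = contradiction ℓ-prime ¬prime[0]

  -- Integral closedness of ℤ without passing to lowest terms: the prime factors of D are cancelled
  -- against n one at a time.
  rationalIntegral⇒integer : ∀ {y} D → .{{ℕ.NonZero D}} → ∀ n → IsAlgebraicInteger y →
                             ι (+ D) * y ≈ ι n → ∃[ z ] y ≈ ι z
  rationalIntegral⇒integer {y} D n y-int Dy≈n with D! ← factorise D =
    divideByPrimes y-int (PrimeFactorisation.factors D!) (PrimeFactorisation.factorsPrime D!) n
      (≡.subst (λ m → ι (+ m) * y ≈ ι n) (PrimeFactorisation.isFactorisation D!) Dy≈n)

-- Binomial coefficients modulo p and the Frobenius endomorphism

prime∤! : ∀ {p} → Prime p → ∀ k → k ℕ.< p → ¬ (p ∣ℕ k !)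
prime∤! p-prime zero    _   p∣1 = contradiction (≡.subst Prime (ℕ∣.∣1⇒≡1 p∣1) p-prime) ¬prime[1]
prime∤! p-prime (suc k) k<p p∣ = [ (λ p∣k → ℕₚ.<⇒≱ k<p (ℕ∣.∣⇒≤ p∣k)) , prime∤! p-prime k (ℕₚ.<-trans (ℕₚ.n<1+n k) k<p) ]′
  (euclidsLemma (suc k) (k !) p-prime p∣)

-- The prime p divides p!, which is the binomial coefficient times k! (p - k)!, but divides neither
-- of these two factorials.
prime∣C : ∀ {p} → Prime p → ∀ k → 0 ℕ.< k → k ℕ.< p → p ∣ℕ (p choose k)
prime∣C {p@(suc p-1)} p-prime k 0<k k<p = [ id , (λ p∣d → contradiction p∣d p∤d) ]′ (euclidsLemma (p choose k) d p-prime p∣Cd)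
  where
  d = k ! ℕ.* (p ℕ.∸ k) !
  instance
    d≢0 : NonZero d
    d≢0 = k !* (p ℕ.∸ k) !≢0
  Cd≡p! : (p choose k) ℕ.* d ≡ p !
  Cd≡p! = ≡.trans (≡.cong (ℕ._* d) (nCk≡n!/k![n-k]! (ℕₚ.<⇒≤ k<p)))
    (m/n*n≡m (≡.subst (_∣ℕ p !) (ℕₚ.*-comm ((p ℕ.∸ k) !) (k !)) ([n∸k]!k!∣n! (ℕₚ.<⇒≤ k<p))))
  p∣Cd : p ∣ℕ (p choose k) ℕ.* d
  p∣Cd = ≡.subst (p ∣ℕ_) (≡.sym Cd≡p!) (ℕ∣.m∣m*n (p-1 !))
  p∤d : ¬ (p ∣ℕ d)
  p∤d p∣d = [ prime∤! p-prime k k<p , prime∤! p-prime (p ℕ.∸ k) (ℕₚ.∸-monoʳ-< 0<k (ℕₚ.<⇒≤ k<p)) ]′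
    (euclidsLemma (k !) _ p-prime p∣d)

module FrobeniusEndomorphism
  {c ℓ} (R : CommutativeRing c ℓ) {p : ℕ} (p-prime : Prime p)
  (characteristic : CommutativeRing._≈_ R (IntegerScalars.ι R (+ p)) (CommutativeRing.0# R)) where
  open CommutativeRing R hiding (zero)
  open IntegerScalars R
  open RangeSum R
  open ExpProperties commutativeSemiring
  private module PowerProperties = MonoidMultProperties *-monoid
  open MultProperties semiring using (×-assocˡ; ×-assoc-*; ×-congʳ) renaming (_×_ to _·_)
  open SetoidReasoning setoid

  p∣n⇒n·x≈0 : ∀ {n} x → p ∣ℕ n → n · x ≈ 0#
  p∣n⇒n·x≈0 {n} x (ℕ∣.divides k n≡kp) = begin
    n · x  ≡⟨ ≡.cong (_· x) (≡.trans n≡kp (ℕₚ.*-comm k p)) ⟩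
    (p ℕ.* k) · x            ≈⟨ ×-assocˡ x p k ⟨
    p · (k · x)              ≈⟨ ×-congʳ p (*-identityˡ _) ⟨
    p · (1# * (k · x))       ≈⟨ ×-assoc-* p 1# (k · x) ⟨
    p · 1# * (k · x)         ≈⟨ *-congʳ characteristic ⟩
    0# * (k · x)             ≈⟨ zeroˡ _ ⟩
    0#  ∎

  frobenius-+ : ∀ x y → (x + y) ^ p ≈ x ^ p + y ^ p
  frobenius-+ x y = begin
    (x + y) ^ p               ≈⟨ Binomial.theorem commutativeSemiring p x y ⟩
    _                         ≈⟨ ∑≈sum (suc p) term ⟨
    ∑ (suc p) term            ≈⟨ ∑-last p term ⟩
    ∑ p term + term p         ≈⟨ +-cong (∑-single p 0 0<p λ i i<p i≢0 → p∣n⇒n·x≈0 _ (prime∣C p-prime i (ℕₚ.n≢0⇒n>0 i≢0) i<p)) term-p ⟩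
    term 0 + x ^ p            ≈⟨ +-congʳ (trans (+-identityʳ _) (*-identityˡ _)) ⟩
    y ^ p + x ^ p             ≈⟨ +-comm _ _ ⟩
    x ^ p + y ^ p             ∎
    where
    0<p = ℕ.>-nonZero⁻¹ p {{prime⇒nonZero p-prime}}
    term : ℕ → Carrier
    term k = (p choose k) · (x ^ k * y ^ (p ℕ.∸ k))
    term-p : term p ≈ x ^ p
    term-p = begin
      (p choose p) · (x ^ p * y ^ (p ℕ.∸ p))    ≡⟨ ≡.cong₂ (λ m k → m · (x ^ p * y ^ k)) (nCn≡1 p) (ℕₚ.n∸n≡0 p) ⟩
      1 · (x ^ p * 1#)  ≈⟨ trans (+-identityʳ _) (*-identityʳ _) ⟩
      x ^ p  ∎

  0^p≈0 : 0# ^ p ≈ 0#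
  0^p≈0 = PowerProperties.×-idem (zeroˡ 0#) p {{prime⇒nonZero p-prime}}

  1^p≈1 : 1# ^ p ≈ 1#
  1^p≈1 = PowerProperties.×-idem (*-identityˡ 1#) p {{prime⇒nonZero p-prime}}

  frobenius-∑ : ∀ n g → ∑ n g ^ p ≈ ∑ n (λ i → g i ^ p)
  frobenius-∑ zero    g = 0^p≈0
  frobenius-∑ (suc n) g = trans (frobenius-+ _ _) (+-congˡ (frobenius-∑ n (g ∘ suc)))

  frobenius-· : ∀ n → (n · 1#) ^ p ≈ n · 1#
  frobenius-· zero    = 0^p≈0
  frobenius-· (suc n) = trans (frobenius-+ _ _) (+-cong 1^p≈1 (frobenius-· n))

  frobenius^-+ : ∀ i x y → (x + y) ^ (p ℕ.^ i) ≈ x ^ (p ℕ.^ i) + y ^ (p ℕ.^ i)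
  frobenius^-+ zero    x y = trans (*-identityʳ _) (sym (+-cong (*-identityʳ x) (*-identityʳ y)))
  frobenius^-+ (suc i) x y = begin
    (x + y) ^ (p ℕ.* p ℕ.^ i)  ≈⟨ ^-assocʳ _ p _ ⟨
    ((x + y) ^ p) ^ (p ℕ.^ i)  ≈⟨ ^-congˡ (p ℕ.^ i) (frobenius-+ x y) ⟩
    (x ^ p + y ^ p) ^ (p ℕ.^ i)  ≈⟨ frobenius^-+ i _ _ ⟩
    (x ^ p) ^ (p ℕ.^ i) + (y ^ p) ^ (p ℕ.^ i)   ≈⟨ +-cong (^-assocʳ x p _) (^-assocʳ y p _) ⟩
    x ^ (p ℕ.* p ℕ.^ i) + y ^ (p ℕ.* p ℕ.^ i)   ∎

%-congruent : ∀ {n} → .{{_ : NonZero n}} → ∀ {i j} → i ℕ.≤ j → n ∣ℕ j ℕ.∸ i → i % n ≡ j % n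
%-congruent {n} {i} {j} i≤j (ℕ∣.divides k eq) = ≡.sym (≡.trans
  (≡.cong (_% n) (≡.trans (≡.sym (ℕₚ.m+[n∸m]≡n i≤j)) (≡.cong (i ℕ.+_) eq))) ([m+kn]%n≡m%n i k n))

-- Sums over a finite field

module FiniteFieldSums {c ℓ₁ ℓ₂} {n₀ : ℕ} (F : FiniteField c ℓ₁ ℓ₂ (suc n₀)) {r ℓ} (R : CommutativeRing r ℓ) where
  private module F = FiniteField F
  open Inverse F.enumeration using (to-cong; strictlyInverseˡ)
  open RingProperties (CommutativeRing.ring F.commutativeRing) using (//-rightDividesˡ; //-rightDividesʳ)
  open CommutativeRing R hiding (zero)
  open SumProperties semiring
  open RangeSum R

  ∑ꟳ : (F.Carrier → Carrier) → Carrier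
  ∑ꟳ h = sum {suc n₀} (λ i → h (F.element i))

  ∑ꟳ-cong : ∀ {g h : F.Carrier → Carrier} → (∀ x → g x ≈ h x) → ∑ꟳ g ≈ ∑ꟳ h
  ∑ꟳ-cong g≈h = sum-cong-≋ (λ i → g≈h (F.element i))

  ∑ꟳ-translate : ∀ {h : F.Carrier → Carrier} → (∀ {x y} → x F.≈ y → h x ≈ h y) →
                 ∀ a → ∑ꟳ (λ x → h (x F.+ a)) ≈ ∑ꟳ h
  ∑ꟳ-translate {h} h-cong a = trans (sum-cong-≋ {suc n₀} {λ i → h (F.element i F.+ a)} {λ i → h (F.element (to i))}
    (λ i → h-cong (F.sym (F.element-index _))))
    (sym (∑-permute (λ i → h (F.element i)) (permutation to from to-from from-to)))
    where
    to from : Fin (suc n₀) → Fin (suc n₀)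
    to   i = F.index (F.element i F.+ a)
    from i = F.index (F.element i F.- a)
    to-from : ∀ i → to (from i) ≡ i
    to-from i = ≡.trans (to-cong (F.trans (F.+-congʳ (F.element-index _)) (//-rightDividesˡ a _))) (strictlyInverseˡ i)
    from-to : ∀ i → from (to i) ≡ i
    from-to i = ≡.trans (to-cong (F.trans (F.+-congʳ (F.element-index _)) (//-rightDividesʳ a _))) (strictlyInverseˡ i)

-- The cyclic group generated by γ, of order n₀ = q - 1

module PrimitiveElement
  {c ℓ₁ ℓ₂} {n₀ : ℕ} {{_ : NonZero n₀}} (F : FiniteField c ℓ₁ ℓ₂ (suc n₀))
  {γ : FiniteField.Carrier F} (γ-primitive : FiniteField.IsPrimitiveElement F γ) where
  open FiniteField F hiding (_^_; zero; sum; _·_)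
  open CommutativeRing commutativeRing using (commutativeSemiring)
  open IntegerScalars commutativeRing
  open ExpProperties commutativeSemiring
  open HeytingFieldProperties heytingField
  open Inverse enumeration using (to-cong; strictlyInverseˡ)
  open SetoidReasoning setoid

  γ^≉0 : ∀ k → γ ^ k ≉ 0#
  γ^≉0 k = ^-≉0 k (proj₁ γ-primitive)

  log : ∀ x → x ≉ 0# → ∃[ k ] x ≈ γ ^ k
  log = proj₂ γ-primitive

  γ^-cancel : ∀ {i j} → i ℕ.≤ j → γ ^ i ≈ γ ^ j → γ ^ (j ℕ.∸ i) ≈ 1#
  γ^-cancel {i} {j} i≤j eq = ≉0⇒cancelˡ (γ^≉0 i) (begin
    γ ^ i * γ ^ (j ℕ.∸ i)      ≈⟨ ^-homo-* γ i _ ⟨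
    γ ^ (i ℕ.+ (j ℕ.∸ i))      ≡⟨ ≡.cong (γ ^_) (ℕₚ.m+[n∸m]≡n i≤j) ⟩
    γ ^ j  ≈⟨ eq ⟨
    γ ^ i  ≈⟨ *-identityʳ _ ⟨
    γ ^ i * 1#  ∎)

  -- If γ^D = 1, then zero and D powers of γ exhaust the field; `code` is the resulting injection of
  -- the q = n₀ + 1 elements into D + 1 places.
  period-lowerBound : ∀ D → {{_ : NonZero D}} → γ ^ D ≈ 1# → n₀ ℕ.≤ D
  period-lowerBound D γᴰ≈1 = ℕₚ.≮⇒≥ λ D<n₀ →
    let i , j , i<j , eq = Finₚ.pigeonhole (s≤s D<n₀) code
    in Finₚ.<⇒≢ i<j (≡.trans (≡.sym (strictlyInverseˡ i)) (≡.trans (to-cong (decode i j eq)) (strictlyInverseˡ j)))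
    where
    codeOf : ∀ {x} → Dec (x ≈ 0#) → Fin (suc D)
    codeOf (yes _)   = Fin.zero
    codeOf (no  x≉0) = Fin.suc (fromℕ< (m%n<n (proj₁ (log _ x≉0)) D))

    decodeOf : ∀ {x y} (dx : Dec (x ≈ 0#)) (dy : Dec (y ≈ 0#)) → codeOf dx ≡ codeOf dy → x ≈ y
    decodeOf (yes x≈0) (yes y≈0) _ = trans x≈0 (sym y≈0)
    decodeOf {x} {y} (no x≉0)  (no y≉0) eq with k , x≈ ← log x x≉0 | l , y≈ ← log y y≉0 = begin
      x              ≈⟨ trans x≈ (^-mod D γᴰ≈1 k) ⟩
      γ ^ (k % D)    ≡⟨ ≡.cong (γ ^_) (Finₚ.fromℕ<-injective _ _ (m%n<n k D) (m%n<n l D) (Finₚ.suc-injective eq)) ⟩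
      γ ^ (l % D)    ≈⟨ trans y≈ (^-mod D γᴰ≈1 l) ⟨
      y              ∎

    code : Fin (suc n₀) → Fin (suc D)
    code i = codeOf (element i ≟ 0#)

    decode : ∀ i j → code i ≡ code j → element i ≈ element j
    decode i j = decodeOf (element i ≟ 0#) (element j ≟ 0#)

  -- Among γ^0, ..., γ^n₀ two must agree, since `punchOut` of the index of 0 leaves n₀ places. The
  -- difference of their exponents is positive and at most n₀, and `period-lowerBound` makes it
  -- equal to n₀.
  γ^n₀≈1 : γ ^ n₀ ≈ 1#
  γ^n₀≈1 =
    let i , j , i<j , eq = Finₚ.pigeonhole (ℕₚ.n<1+n n₀) (λ i → punchOut (index0≢ (toℕ i)))
        γ^≈1 = γ^-cancel (ℕₚ.<⇒≤ i<j)
          (index-injective (Finₚ.punchOut-injective (index0≢ (toℕ i)) (index0≢ (toℕ j)) eq))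
    in ≡.subst (λ e → γ ^ e ≈ 1#)
      (ℕₚ.≤-antisym (ℕₚ.≤-trans (ℕₚ.m∸n≤m (toℕ j) (toℕ i)) (ℕ.s≤s⁻¹ (Finₚ.toℕ<n j)))
                    (period-lowerBound (toℕ j ℕ.∸ toℕ i) {{ℕ.>-nonZero (ℕₚ.m<n⇒0<n∸m i<j)}} γ^≈1))
      γ^≈1
    where
    index0≢ : ∀ k → index 0# ≢ index (γ ^ k)
    index0≢ k eq = γ^≉0 k (sym (index-injective eq))

  γ^-% : ∀ k → γ ^ k ≈ γ ^ (k % n₀)
  γ^-% = ^-mod n₀ γ^n₀≈1

  γ^≈1⇒n₀∣ : ∀ k → γ ^ k ≈ 1# → n₀ ∣ℕ k
  γ^≈1⇒n₀∣ k γᵏ≈1 = ℕ∣.m%n≡0⇒n∣m k n₀ (ℕₚ.n≤0⇒n≡0 (ℕₚ.≮⇒≥ λ 0<r → ℕₚ.<⇒≱ (m%n<n k n₀)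
    (period-lowerBound (k % n₀) {{ℕ.>-nonZero 0<r}} (trans (sym (γ^-% k)) γᵏ≈1))))

  γ^-injective-% : ∀ i j → γ ^ i ≈ γ ^ j → i % n₀ ≡ j % n₀
  γ^-injective-% i j eq with ℕₚ.≤-total i j
  ... | inj₁ i≤j = %-congruent i≤j (γ^≈1⇒n₀∣ _ (γ^-cancel i≤j eq))
  ... | inj₂ j≤i = ≡.sym (%-congruent j≤i (γ^≈1⇒n₀∣ _ (γ^-cancel j≤i (sym eq))))

  ^1+n₀ : ∀ x → x ^ suc n₀ ≈ x
  ^1+n₀ x with x ≟ 0#
  ... | yes x≈0 = trans (trans (*-congʳ x≈0) (zeroˡ _)) (sym x≈0)
  ... | no  x≉0 with k , x≈ ← log x x≉0 = trans (*-congˡ (begin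
    x ^ n₀              ≈⟨ ^-congˡ n₀ x≈ ⟩
    (γ ^ k) ^ n₀        ≈⟨ ^-assocʳ γ k n₀ ⟩
    γ ^ (k ℕ.* n₀)      ≡⟨ ≡.cong (γ ^_) (ℕₚ.*-comm k n₀) ⟩
    γ ^ (n₀ ℕ.* k)      ≈⟨ ^-multiple n₀ γ^n₀≈1 k ⟩
    1#  ∎)) (*-identityʳ x)

  module _ {r ℓ} (R : CommutativeRing r ℓ) where
    private module R = CommutativeRing R
    open FiniteFieldSums F R
    open RangeSum R
    open SumProperties R.semiring using (∑-permute)

    -- The discrete logarithm reorders the enumeration of the field as 0, γ^0, ..., γ^(n₀ - 1), and
    -- a finite sum is invariant under permutations.
    ∑ꟳ-log : ∀ {h : Carrier → R.Carrier} → (∀ {x y} → x ≈ y → h x R.≈ h y) →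
             ∑ꟳ h R.≈ h 0# R.+ ∑ n₀ (λ n → h (γ ^ n))
    ∑ꟳ-log {h} h-cong = R.trans (∑-permute (λ i → h (element i)) (permutation to from to-from from-to))
      (R.+-cong (h-cong (element-index 0#))
        (R.trans (R.sym (∑≈sum n₀ (λ n → h (element (index (γ ^ n)))))) (∑-cong n₀ (λ n _ → h-cong (element-index (γ ^ n))))))
      where
      to : Fin (suc n₀) → Fin (suc n₀)
      to Fin.zero    = index 0#
      to (Fin.suc i) = index (γ ^ toℕ i)

      fromOf : ∀ {x} → Dec (x ≈ 0#) → Fin (suc n₀)
      fromOf (yes _)   = Fin.zero
      fromOf (no  x≉0) = Fin.suc (fromℕ< (m%n<n (proj₁ (log _ x≉0)) n₀))

      from : Fin (suc n₀) → Fin (suc n₀)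
      from i = fromOf (element i ≟ 0#)

      to-fromOf : ∀ {x} (d : Dec (x ≈ 0#)) → to (fromOf d) ≡ index x
      to-fromOf (yes x≈0)    = to-cong (sym x≈0)
      to-fromOf {x} (no x≉0) with k , x≈ ← log x x≉0 = to-cong (begin
        γ ^ toℕ (fromℕ< (m%n<n k n₀))    ≡⟨ ≡.cong (γ ^_) (Finₚ.toℕ-fromℕ< (m%n<n k n₀)) ⟩
        γ ^ (k % n₀)  ≈⟨ γ^-% k ⟨
        γ ^ k  ≈⟨ x≈ ⟨
        x                                ∎)

      to-from : ∀ i → to (from i) ≡ i
      to-from i = ≡.trans (to-fromOf (element i ≟ 0#)) (strictlyInverseˡ i)

      fromOf-0 : ∀ {x} → x ≈ 0# → (d : Dec (x ≈ 0#)) → fromOf d ≡ Fin.zero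
      fromOf-0 x≈0 (yes _)   = ≡.refl
      fromOf-0 x≈0 (no  x≉0) = contradiction x≈0 x≉0

      fromOf-γ^ : ∀ {x} i → x ≈ γ ^ toℕ i → (d : Dec (x ≈ 0#)) → fromOf d ≡ Fin.suc i
      fromOf-γ^ i x≈γ^i (yes x≈0) = contradiction (trans (sym x≈γ^i) x≈0) (γ^≉0 (toℕ i))
      fromOf-γ^ {x} i x≈γ^i (no x≉0) with k , x≈ ← log x x≉0 = ≡.cong Fin.suc (Finₚ.toℕ-injective
        (≡.trans (Finₚ.toℕ-fromℕ< (m%n<n k n₀)) (≡.trans (γ^-injective-% k (toℕ i) (trans (sym x≈) x≈γ^i))
          (m<n⇒m%n≡m (Finₚ.toℕ<n i)))))

      from-to : ∀ i → from (to i) ≡ i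
      from-to Fin.zero    = fromOf-0 (element-index 0#) _
      from-to (Fin.suc i) = fromOf-γ^ i (element-index (γ ^ toℕ i)) _

-- The prime field and the trace onto it

module Trace
  {c ℓ₁ ℓ₂} {n₀ : ℕ} {{_ : NonZero n₀}} (F : FiniteField c ℓ₁ ℓ₂ (suc n₀))
  {γ : FiniteField.Carrier F} (γ-primitive : FiniteField.IsPrimitiveElement F γ)
  {p : ℕ} (f : ℕ) (p-prime : Prime p) (order : suc n₀ ≡ p ℕ.^ suc f) where
  open FiniteField F hiding (_^_; zero; sum; _·_)
  open CommutativeRing commutativeRing using (commutativeSemiring; ring)
  open IntegerScalars commutativeRing
  open RangeSum commutativeRing
  open FiniteFieldSums F commutativeRing
  open MultProperties semiring using (×-homo-+; ×1-homo-*) renaming (_×_ to _·_)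
  open SumProperties semiring using (∑-distrib-+; sum-replicate)
  open RingProperties ring using (+-cancelˡ)
  open ExpProperties commutativeSemiring
  open HeytingFieldProperties heytingField
  open PrimitiveElement F γ-primitive
  open SetoidReasoning setoid

  -- Translation by 1 permutes the field, so the sum of all elements equals itself plus q · 1.
  q·1≈0 : suc n₀ · 1# ≈ 0#
  q·1≈0 = +-cancelˡ (∑ꟳ id) _ _ (begin
    ∑ꟳ id + suc n₀ · 1#         ≈⟨ +-congˡ (sum-replicate (suc n₀)) ⟨
    ∑ꟳ id + ∑ꟳ (λ _ → 1#)       ≈⟨ ∑-distrib-+ {suc n₀} element (λ _ → 1#) ⟨
    ∑ꟳ (λ x → x + 1#)           ≈⟨ ∑ꟳ-translate id 1# ⟩
    ∑ꟳ id  ≈⟨ +-identityʳ _ ⟨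
    ∑ꟳ id + 0#  ∎)

  characteristic : p · 1# ≈ 0#
  characteristic with p · 1# ≟ 0#
  ... | yes p≈0 = p≈0
  ... | no  p≉0 = contradiction (trans (sym (^-homo-· (suc f))) (trans (reflexive (≡.cong (_· 1#) (≡.sym order))) q·1≈0))
                    (^-≉0 (suc f) p≉0)
    where
    ^-homo-· : ∀ k → (p ℕ.^ k) · 1# ≈ (p · 1#) ^ k
    ^-homo-· zero    = +-identityʳ 1#
    ^-homo-· (suc k) = trans (×1-homo-* p (p ℕ.^ k)) (*-congˡ (^-homo-· k))

  open FrobeniusEndomorphism commutativeRing p-prime characteristic

  -- Otherwise n is prime to p, and a Bézout relation expresses 1 through p · 1 = 0 and n · 1 = 0.
  ·1≈0⇒p∣ : ∀ n → n · 1# ≈ 0# → p ∣ℕ n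
  ·1≈0⇒p∣ n n≈0 with p ℕ∣.∣? n
  ... | yes p∣n = p∣n
  ... | no  p∤n = contradiction 1≈0 1≉0
    where
    coprime : Coprime p n
    coprime (d∣p , d∣n) = [ id , (λ { ≡.refl → contradiction d∣n p∤n }) ]′ (prime⇒irreducible p-prime d∣p)
    multiple≈0 : ∀ k {m} → m · 1# ≈ 0# → (k ℕ.* m) · 1# ≈ 0#
    multiple≈0 k {m} m≈0 = trans (×1-homo-* k m) (trans (*-congˡ m≈0) (zeroʳ _))
    vanish : ∀ x y {m l} → m · 1# ≈ 0# → l · 1# ≈ 0# → 1 ℕ.+ y ℕ.* l ≡ x ℕ.* m → 1# ≈ 0#
    vanish x y {m} {l} m≈0 l≈0 eq = begin
      1#  ≈⟨ +-identityʳ 1# ⟨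
      1# + 0#  ≈⟨ +-congˡ (multiple≈0 y l≈0) ⟨
      (1 ℕ.+ y ℕ.* l) · 1#        ≡⟨ ≡.cong (_· 1#) eq ⟩
      (x ℕ.* m) · 1#              ≈⟨ multiple≈0 x m≈0 ⟩
      0#  ∎
    1≈0 : 1# ≈ 0#
    1≈0 with coprime-Bézout coprime
    ... | Bézout.+- x y eq = vanish x y characteristic n≈0 eq
    ... | Bézout.-+ x y eq = vanish y x n≈0 characteristic eq

  ·1-injective : ∀ {i j} → i ℕ.≤ j → i · 1# ≈ j · 1# → p ∣ℕ j ℕ.∸ i
  ·1-injective {i} {j} i≤j eq = ·1≈0⇒p∣ (j ℕ.∸ i) (+-cancelˡ (i · 1#) _ _ (begin
    i · 1# + (j ℕ.∸ i) · 1#    ≈⟨ ×-homo-+ 1# i (j ℕ.∸ i) ⟨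
    (i ℕ.+ (j ℕ.∸ i)) · 1#     ≡⟨ ≡.cong (_· 1#) (ℕₚ.m+[n∸m]≡n i≤j) ⟩
    j · 1#  ≈⟨ eq ⟨
    i · 1#  ≈⟨ +-identityʳ _ ⟨
    i · 1# + 0#  ∎))

  ·1-small : ∀ {i} → 0 ℕ.< i → i ℕ.< p → i · 1# ≉ 0#
  ·1-small {suc i} _ i<p eq = ℕₚ.<⇒≱ i<p (ℕ∣.∣⇒≤ (·1≈0⇒p∣ (suc i) eq))

  fixed⇒n₀∣ : ∀ {k} → (γ ^ k) ^ p ≈ γ ^ k → n₀ ∣ℕ k ℕ.* (p ℕ.∸ 1)
  fixed⇒n₀∣ {k} eq = γ^≈1⇒n₀∣ _ (≉0⇒cancelˡ (γ^≉0 k) (begin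
    γ ^ k * γ ^ (k ℕ.* (p ℕ.∸ 1))      ≈⟨ ^-homo-* γ k _ ⟨
    γ ^ (k ℕ.+ k ℕ.* (p ℕ.∸ 1))        ≡⟨ ≡.cong (γ ^_) (≡.trans (≡.sym (ℕₚ.*-suc k (p ℕ.∸ 1))) (≡.cong (k ℕ.*_) (ℕₚ.suc-pred p {{prime⇒nonZero p-prime}}))) ⟩
    γ ^ (k ℕ.* p)  ≈⟨ ^-assocʳ γ k p ⟨
    (γ ^ k) ^ p  ≈⟨ eq ⟩
    γ ^ k  ≈⟨ *-identityʳ _ ⟨
    γ ^ k * 1#  ∎))

  -- The roots γ^k of x^(p-1) = 1 are separated by k (p-1) / n₀ < p-1, so with 1, …, p-1 there is no room for another.
  fixed⇒primeField : ∀ {y} → y ^ p ≈ y → ∃[ i ] i ℕ.< p × i · 1# ≈ y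
  fixed⇒primeField {y} yᵖ≈y with y ≟ 0#
  ... | yes y≈0 = 0 , 0<p , sym y≈0
    where 0<p = ℕ.>-nonZero⁻¹ p {{prime⇒nonZero p-prime}}
  ... | no  y≉0 = found
    where
    instance
      p≢0 = prime⇒nonZero p-prime
      p∸1≢0 : NonZero (p ℕ.∸ 1)
      p∸1≢0 = ℕ.>-nonZero (ℕₚ.m<n⇒0<n∸m (ℕ.nonTrivial⇒n>1 p {{prime⇒nonTrivial p-prime}}))
    1+[p∸1]≡p : suc (p ℕ.∸ 1) ≡ p
    1+[p∸1]≡p = ℕₚ.suc-pred p
    below-p : ∀ (i : Fin (suc (p ℕ.∸ 1))) → toℕ i ℕ.< p
    below-p i = ≡.subst (toℕ i ℕ.<_) 1+[p∸1]≡p (Finₚ.toℕ<n i)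
    -- Slot 0 carries y and slot i > 0 carries i · 1: p nonzero fixed points of Frobenius compete
    -- for p - 1 codes.
    candidate : Fin (suc (p ℕ.∸ 1)) → Carrier
    candidate Fin.zero      = y
    candidate i@(Fin.suc _) = toℕ i · 1#
    candidate≉0 : ∀ i → candidate i ≉ 0#
    candidate≉0 Fin.zero      = y≉0
    candidate≉0 i@(Fin.suc _) = ·1-small (s≤s z≤n) (below-p i)
    candidate-fixed : ∀ i → candidate i ^ p ≈ candidate i
    candidate-fixed Fin.zero      = yᵖ≈y
    candidate-fixed i@(Fin.suc _) = frobenius-· (toℕ i)
    exponent : Fin (suc (p ℕ.∸ 1)) → ℕ
    exponent i = proj₁ (log _ (candidate≉0 i)) % n₀
    candidate≈ : ∀ i → candidate i ≈ γ ^ exponent i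
    candidate≈ i = trans (proj₂ (log _ (candidate≉0 i))) (γ^-% _)
    divides : ∀ i → n₀ ∣ℕ exponent i ℕ.* (p ℕ.∸ 1)
    divides i = fixed⇒n₀∣ {exponent i} (trans (^-congˡ p (sym (candidate≈ i))) (trans (candidate-fixed i) (candidate≈ i)))
    root# : Fin (suc (p ℕ.∸ 1)) → ℕ
    root# i = ℕ∣.quotient (divides i)
    root#≡ : ∀ i → exponent i ℕ.* (p ℕ.∸ 1) ≡ root# i ℕ.* n₀
    root#≡ i = ℕ∣._∣_.equality (divides i)
    quotient< : ∀ i → root# i ℕ.< p ℕ.∸ 1
    quotient< i = ℕₚ.*-cancelʳ-< n₀ (root# i) (p ℕ.∸ 1) (ℕₚ.≤-<-trans (ℕₚ.≤-reflexive (≡.sym (root#≡ i)))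
      (≡.subst (exponent i ℕ.* (p ℕ.∸ 1) ℕ.<_) (ℕₚ.*-comm n₀ (p ℕ.∸ 1)) (ℕₚ.*-monoˡ-< (p ℕ.∸ 1) (m%n<n _ n₀))))
    code : Fin (suc (p ℕ.∸ 1)) → Fin (p ℕ.∸ 1)
    code i = fromℕ< (quotient< i)
    decode : ∀ i j → code i ≡ code j → candidate i ≈ candidate j
    decode i j eq = trans (candidate≈ i) (trans (reflexive (≡.cong (γ ^_) exponent≡)) (sym (candidate≈ j)))
      where
      exponent≡ : exponent i ≡ exponent j
      exponent≡ = ℕₚ.*-cancelʳ-≡ (exponent i) (exponent j) (p ℕ.∸ 1) (≡.trans (root#≡ i)
        (≡.trans (≡.cong (ℕ._* n₀) (Finₚ.fromℕ<-injective (root# i) (root# j) (quotient< i) (quotient< j) eq)) (≡.sym (root#≡ j))))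
    collision : ∀ i j → i Fin.< j → candidate i ≈ candidate j → ∃[ i ] i ℕ.< p × i · 1# ≈ y
    collision Fin.zero      j@(Fin.suc _) _   eq = toℕ j , below-p j , sym eq
    collision i@(Fin.suc _) j@(Fin.suc _) i<j eq = contradiction
      (ℕ∣.∣⇒≤ {{ℕ.>-nonZero (ℕₚ.m<n⇒0<n∸m i<j)}} (·1-injective (ℕₚ.<⇒≤ i<j) eq))
      (ℕₚ.<⇒≱ (ℕₚ.≤-<-trans (ℕₚ.m∸n≤m (toℕ j) (toℕ i)) (below-p j)))
    found : ∃[ i ] i ℕ.< p × i · 1# ≈ y
    found = let i , j , i<j , eq = Finₚ.pigeonhole (ℕₚ.n<1+n (p ℕ.∸ 1)) code in collision i j i<j (decode i j eq)

  tr : Carrier → Carrier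
  tr x = ∑ (suc f) (λ i → x ^ (p ℕ.^ i))

  tr-cong : ∀ {x y} → x ≈ y → tr x ≈ tr y
  tr-cong x≈y = ∑-cong (suc f) (λ i _ → ^-congˡ (p ℕ.^ i) x≈y)

  tr-+ : ∀ x y → tr (x + y) ≈ tr x + tr y
  tr-+ x y = trans (∑-cong (suc f) (λ i _ → frobenius^-+ i x y)) (∑-+ (suc f) (λ i → x ^ (p ℕ.^ i)) (λ i → y ^ (p ℕ.^ i)))

  -- Raising to the p-th power shifts the summands by one, and x^(p^(f+1)) = x^q = x closes the
  -- cycle.
  tr-^p : ∀ x → tr (x ^ p) ≈ tr x
  tr-^p x = +-cancelˡ (x ^ 1) _ _ (begin
    x ^ 1 + tr (x ^ p)  ≈⟨ +-congˡ (∑-cong (suc f) (λ i _ → ^-assocʳ x p (p ℕ.^ i))) ⟩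
    ∑ (suc (suc f)) (λ i → x ^ (p ℕ.^ i))            ≈⟨ ∑-last (suc f) (λ i → x ^ (p ℕ.^ i)) ⟩
    tr x + x ^ (p ℕ.^ suc f)  ≡⟨ ≡.cong (λ e → tr x + x ^ e) order ⟨
    tr x + x ^ suc n₀  ≈⟨ +-congˡ (trans (^1+n₀ x) (sym (*-identityʳ x))) ⟩
    tr x + x ^ 1  ≈⟨ +-comm _ _ ⟩
    x ^ 1 + tr x  ∎)

  tr-fixed : ∀ x → tr x ^ p ≈ tr x
  tr-fixed x = trans (frobenius-∑ (suc f) (λ i → x ^ (p ℕ.^ i))) (trans (∑-cong (suc f) (λ i _ → begin
    (x ^ (p ℕ.^ i)) ^ p      ≈⟨ ^-assocʳ x (p ℕ.^ i) p ⟩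
    x ^ (p ℕ.^ i ℕ.* p)      ≡⟨ ≡.cong (x ^_) (ℕₚ.*-comm (p ℕ.^ i) p) ⟩
    x ^ (p ℕ.* p ℕ.^ i)      ≈⟨ ^-assocʳ x p (p ℕ.^ i) ⟨
    (x ^ p) ^ (p ℕ.^ i)      ∎)) (tr-^p x))

  private
    E = n₀ ℕ.∸ p ℕ.^ f

    p^f≤n₀ : p ℕ.^ f ℕ.≤ n₀
    p^f≤n₀ = ℕ.s≤s⁻¹ (≡.subst (p ℕ.^ f ℕ.<_) (≡.sym order)
      (ℕₚ.^-monoʳ-< p (ℕ.nonTrivial⇒n>1 p {{prime⇒nonTrivial p-prime}}) (ℕₚ.n<1+n f)))

    powerSum : ∀ e → 0 ℕ.< e → e ℕ.< n₀ → ∑ n₀ ((γ ^ e) ^_) ≈ 0#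
    powerSum e 0<e e<n₀ = geometricSum n₀ (begin
      (γ ^ e) ^ n₀        ≈⟨ ^-assocʳ γ e n₀ ⟩
      γ ^ (e ℕ.* n₀)      ≡⟨ ≡.cong (γ ^_) (ℕₚ.*-comm e n₀) ⟩
      γ ^ (n₀ ℕ.* e)      ≈⟨ ^-multiple n₀ γ^n₀≈1 e ⟩
      1#  ∎)
      (λ γᵉ≈1 → ℕₚ.<⇒≱ e<n₀ (period-lowerBound e {{ℕ.>-nonZero 0<e}} γᵉ≈1))

    -- Only the top term of the trace survives in Σ x^(n₀ - p^f) tr x.
    moment : ∑ n₀ (λ n → (γ ^ E) ^ n * tr (γ ^ n)) ≈ n₀ · 1#
    moment = begin
      ∑ n₀ (λ n → (γ ^ E) ^ n * tr (γ ^ n))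
        ≈⟨ ∑-cong n₀ (λ n _ → trans (sym (∑-*ˡ (suc f) ((γ ^ E) ^ n) (λ i → (γ ^ n) ^ (p ℕ.^ i)))) (∑-cong (suc f) (λ i _ → term n i))) ⟩
      ∑ n₀ (λ n → ∑ (suc f) (λ i → (γ ^ (E ℕ.+ p ℕ.^ i)) ^ n))
        ≈⟨ ∑-swap n₀ (suc f) (λ n i → (γ ^ (E ℕ.+ p ℕ.^ i)) ^ n) ⟩
      ∑ (suc f) (λ i → ∑ n₀ ((γ ^ (E ℕ.+ p ℕ.^ i)) ^_))
        ≈⟨ ∑-last f (λ i → ∑ n₀ ((γ ^ (E ℕ.+ p ℕ.^ i)) ^_)) ⟩
      ∑ f (λ i → ∑ n₀ ((γ ^ (E ℕ.+ p ℕ.^ i)) ^_)) + ∑ n₀ ((γ ^ (E ℕ.+ p ℕ.^ f)) ^_)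
        ≈⟨ +-cong (∑-0 f (λ i i<f → powerSum (E ℕ.+ p ℕ.^ i) (positive i) (small i i<f))) top ⟩
      0# + n₀ · 1#
        ≈⟨ +-identityˡ _ ⟩
      n₀ · 1#  ∎
      where
      term : ∀ n i → (γ ^ E) ^ n * (γ ^ n) ^ (p ℕ.^ i) ≈ (γ ^ (E ℕ.+ p ℕ.^ i)) ^ n
      term n i = begin
        (γ ^ E) ^ n * (γ ^ n) ^ (p ℕ.^ i)          ≈⟨ *-congˡ (trans (^-assocʳ γ n (p ℕ.^ i)) (trans (reflexive (≡.cong (γ ^_) (ℕₚ.*-comm n (p ℕ.^ i)))) (sym (^-assocʳ γ (p ℕ.^ i) n)))) ⟩
        (γ ^ E) ^ n * (γ ^ (p ℕ.^ i)) ^ n          ≈⟨ ^-distrib-* _ _ n ⟨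
        (γ ^ E * γ ^ (p ℕ.^ i)) ^ n  ≈⟨ ^-congˡ n (^-homo-* γ E _) ⟨
        (γ ^ (E ℕ.+ p ℕ.^ i)) ^ n  ∎
      instance p≢0 = prime⇒nonZero p-prime
      positive : ∀ i → 0 ℕ.< E ℕ.+ p ℕ.^ i
      positive i = ℕₚ.<-≤-trans (ℕₚ.m^n>0 p i) (ℕₚ.m≤n+m _ E)
      small : ∀ i → i ℕ.< f → E ℕ.+ p ℕ.^ i ℕ.< n₀
      small i i<f = ≡.subst (E ℕ.+ p ℕ.^ i ℕ.<_) (ℕₚ.m∸n+n≡m p^f≤n₀)
        (ℕₚ.+-monoʳ-< E (ℕₚ.^-monoʳ-< p (ℕ.nonTrivial⇒n>1 p {{prime⇒nonTrivial p-prime}}) i<f))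
      top : ∑ n₀ ((γ ^ (E ℕ.+ p ℕ.^ f)) ^_) ≈ n₀ · 1#
      top = begin
        ∑ n₀ ((γ ^ (E ℕ.+ p ℕ.^ f)) ^_)   ≈⟨ ∑-cong n₀ (λ n _ → trans (^-congˡ n (trans (reflexive (≡.cong (γ ^_) (ℕₚ.m∸n+n≡m p^f≤n₀))) γ^n₀≈1)) (1^n≈1 n)) ⟩
        ∑ n₀ (λ _ → 1#)  ≈⟨ ∑-const n₀ 1# ⟩
        n₀ · 1# * 1#  ≈⟨ *-identityʳ _ ⟩
        n₀ · 1#  ∎

  -- If the trace vanished identically, `moment` would give n₀ · 1 = 0 and hence 1 = 1 + n₀ · 1 = q
  -- · 1 = 0.
  tr-nonzero : ∃[ x ] tr x ≉ 0#
  tr-nonzero with search (λ x≈y tr-x≉0 tr-y≈0 → tr-x≉0 (trans (tr-cong x≈y) tr-y≈0)) (λ x → ¬? (tr x ≟ 0#))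
  ... | yes witness = witness
  ... | no  none    = contradiction 1≈0 1≉0
    where
    tr≈0 : ∀ x → tr x ≈ 0#
    tr≈0 x with tr x ≟ 0#
    ... | yes tr≈0 = tr≈0
    ... | no  tr≉0 = contradiction (x , tr≉0) none
    1≈0 : 1# ≈ 0#
    1≈0 = begin
      1#  ≈⟨ +-identityʳ 1# ⟨
      1# + 0#            ≈⟨ +-congˡ (trans (sym moment) (∑-0 n₀ (λ n _ → trans (*-congˡ (tr≈0 _)) (zeroʳ _)))) ⟨
      suc n₀ · 1#        ≈⟨ q·1≈0 ⟩
      0#  ∎

-- The canonical additive character along the powers of γ

module ResidueTrace
  {c ℓ₁ ℓ₂ c′ ℓ₁′ ℓ₂′} (K : CharZeroFieldWithRootsOfUnity c ℓ₁ ℓ₂)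
  {n₀ : ℕ} {{_ : NonZero n₀}} (F : FiniteField c′ ℓ₁′ ℓ₂′ (suc n₀))
  {γ : FiniteField.Carrier F} (γ-primitive : FiniteField.IsPrimitiveElement F γ)
  {p : ℕ} (f : ℕ) (p-prime : Prime p) (order : suc n₀ ≡ p ℕ.^ suc f) where
  private module F = FiniteField F
  open Trace F γ-primitive f p-prime order
  open CharacterSums K p (suc f) F using (trace; residue)

  trace≈tr : ∀ x → trace x F.≈ tr x
  trace≈tr x = F.sym (RangeSum.∑≈sum F.commutativeRing (suc f) (λ i → x F.^ (p ℕ.^ i)))

  residue-primeField : ∀ {y} → ∃[ i ] i ℕ.< p × i F.· F.1# F.≈ y → residue y ℕ.< p × residue y F.· F.1# F.≈ y
  residue-primeField {y} (i , i<p , i≈y) with any? (λ (i : Fin p) → (toℕ i F.· F.1#) F.≟ y)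
  ... | yes (j , j≈y) = Finₚ.toℕ<n j , j≈y
  ... | no  none      = contradiction
    (fromℕ< i<p , F.trans (F.reflexive (≡.cong (F._· F.1#) (Finₚ.toℕ-fromℕ< i<p))) i≈y) none

  residueTrace : F.Carrier → ℕ
  residueTrace x = residue (trace x)

  residueTrace-spec : ∀ x → residueTrace x ℕ.< p × residueTrace x F.· F.1# F.≈ tr x
  residueTrace-spec x with i , i<p , i≈ ← fixed⇒primeField (tr-fixed x)
    with r<p , r≈ ← residue-primeField (i , i<p , F.trans i≈ (F.sym (trace≈tr x))) = r<p , F.trans r≈ (trace≈tr x)

module AdditiveCharacter
  {c ℓ₁ ℓ₂ c′ ℓ₁′ ℓ₂′} (K : CharZeroFieldWithRootsOfUnity c ℓ₁ ℓ₂)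
  {n₀ : ℕ} {{_ : NonZero n₀}} (F : FiniteField c′ ℓ₁′ ℓ₂′ (suc n₀))
  {γ : FiniteField.Carrier F} (γ-primitive : FiniteField.IsPrimitiveElement F γ)
  {p : ℕ} (f : ℕ) (p-prime : Prime p) (order : suc n₀ ≡ p ℕ.^ suc f)
  -- A variable residue function, so that ψ does not unfold.
  (residue : FiniteField.Carrier F → ℕ)
  (residue-spec : ∀ x → residue x ℕ.< p ×
    FiniteField._≈_ F (FiniteField._·_ F (residue x) (FiniteField.1# F)) (Trace.tr F γ-primitive f p-prime order x)) where
  private
    module F = FiniteField F
    module Fᴱ = ExpProperties (CommutativeRing.commutativeSemiring F.commutativeRing)
  open CharZeroFieldWithRootsOfUnity K hiding (zero; sum; _^_; _·_)
  open CommutativeRing commutativeRing using (commutativeSemiring; ring)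
  open IntegerScalars commutativeRing
  open RangeSum commutativeRing
  open FiniteFieldSums F commutativeRing
  open SumProperties semiring using (*-distribˡ-sum)
  open RingProperties ring using (x∙y⁻¹≈ε⇒x≈y)
  open ExpProperties commutativeSemiring
  open HeytingFieldProperties heytingField
  open PrimitiveElement F γ-primitive
  open Trace F γ-primitive f p-prime order
  open SetoidReasoning setoid

  instance
    p≢0 : NonZero p
    p≢0 = prime⇒nonZero p-prime

  ψ : F.Carrier → Carrier
  ψ x = ζ p ^ residue x

  ζ^p≈1 : ζ p ^ p ≈ 1#
  ζ^p≈1 = ζ-root p

  ζ^-cong : ∀ i j → i F.· F.1# F.≈ j F.· F.1# → ζ p ^ i ≈ ζ p ^ j
  ζ^-cong i j eq with ℕₚ.≤-total i j
  ... | inj₁ i≤j = ^-cong-% p ζ^p≈1 (%-congruent i≤j (·1-injective i≤j eq))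
  ... | inj₂ j≤i = ^-cong-% p ζ^p≈1 (≡.sym (%-congruent j≤i (·1-injective j≤i (F.sym eq))))

  ψ-tr : ∀ {x} i → i F.· F.1# F.≈ tr x → ψ x ≈ ζ p ^ i
  ψ-tr {x} i eq = ζ^-cong (residue x) i (F.trans (proj₂ (residue-spec x)) (F.sym eq))

  ψ-cong : ∀ {x y} → x F.≈ y → ψ x ≈ ψ y
  ψ-cong {x} {y} x≈y = ψ-tr {x} (residue y) (F.trans (proj₂ (residue-spec y)) (F.sym (tr-cong x≈y)))

  ψ-+ : ∀ x y → ψ (x F.+ y) ≈ ψ x * ψ y
  ψ-+ x y = trans (ψ-tr {x F.+ y} (rx ℕ.+ ry) (F.trans (×-homo-+ F.1# rx ry)
    (F.trans (F.+-cong (proj₂ (residue-spec x)) (proj₂ (residue-spec y))) (F.sym (tr-+ x y))))) (^-homo-* (ζ p) rx ry)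
    where
    open MultProperties F.semiring using (×-homo-+)
    rx = residue x
    ry = residue y

  ψ-^p : ∀ x → ψ (x F.^ p) ≈ ψ x
  ψ-^p x = ψ-tr {x F.^ p} (residue x) (F.trans (proj₂ (residue-spec x)) (F.sym (tr-^p x)))

  ψ-0 : ψ F.0# ≈ 1#
  ψ-0 = ψ-tr {F.0#} 0 (F.sym (x+x≈x⇒x≈0 (tr F.0#) (F.trans (F.sym (tr-+ F.0# F.0#)) (tr-cong (F.+-identityˡ F.0#)))))
    where open RingProperties (CommutativeRing.ring F.commutativeRing) using (x+x≈x⇒x≈0)

  ψ-· : ∀ n x → ψ (n F.· x) ≈ ψ x ^ n
  ψ-· zero    x = ψ-0
  ψ-· (suc n) x = trans (ψ-+ x (n F.· x)) (*-congˡ (ψ-· n x))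

  -- An element of nonzero trace has a residue strictly between 0 and p, and ζ p is a primitive p-th
  -- root of unity.
  ψ-nontrivial : ∃[ x ] ¬ (ψ x ≈ 1#)
  ψ-nontrivial with x , tr≉0 ← tr-nonzero = x , nontrivial (residue x) (residue-spec x)
    where
    nontrivial : ∀ r → r ℕ.< p × r F.· F.1# F.≈ tr x → ¬ (ζ p ^ r ≈ 1#)
    nontrivial zero    (_   , 0≈) _     = tr≉0 (F.sym 0≈)
    nontrivial (suc r) (r<p , _ ) ζʳ≈1 = #-irrefl ζʳ≈1 (ζ-prim p (suc r) (s≤s z≤n) r<p)

  -- Translation by an element a with ψ a ≉ 1 multiplies the sum by ψ a without changing it.
  ∑ψ≈0 : ∑ꟳ ψ ≈ 0#
  ∑ψ≈0 with a , ψa≉1 ← ψ-nontrivial = ≉0⇒cancel (λ eq → ψa≉1 (x∙y⁻¹≈ε⇒x≈y (ψ a) 1# eq)) (begin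
    (ψ a - 1#) * ∑ꟳ ψ             ≈⟨ solve 3 (λ a one s → (a :- one) :* s := a :* s :- one :* s) refl (ψ a) 1# (∑ꟳ ψ) ⟩
    ψ a * ∑ꟳ ψ - 1# * ∑ꟳ ψ        ≈⟨ +-cong (*-distribˡ-sum (ψ a) (λ i → ψ (F.element i))) (-‿cong (*-identityˡ _)) ⟩
    ∑ꟳ (λ x → ψ a * ψ x) - ∑ꟳ ψ   ≈⟨ +-congʳ (∑ꟳ-cong (λ x → trans (*-comm _ _) (sym (ψ-+ x a)))) ⟩
    ∑ꟳ (λ x → ψ (x F.+ a)) - ∑ꟳ ψ ≈⟨ +-congʳ (∑ꟳ-translate ψ-cong a) ⟩
    ∑ꟳ ψ - ∑ꟳ ψ  ≈⟨ -‿inverseʳ _ ⟩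
    0#  ∎)

  g : ℕ → Carrier
  g n = ψ (γ F.^ n)

  g-cong : ∀ i j → γ F.^ i F.≈ γ F.^ j → g i ≈ g j
  g-cong i j = ψ-cong

  g-periodic : ∀ i → g (n₀ ℕ.+ i) ≈ g i
  g-periodic i = g-cong (n₀ ℕ.+ i) i (F.trans (Fᴱ.^-homo-* γ n₀ i) (F.trans (F.*-congʳ γ^n₀≈1) (F.*-identityˡ _)))

  ∑g≈-1 : ∑ n₀ g ≈ - 1#
  ∑g≈-1 = begin
    ∑ n₀ g  ≈⟨ solve 2 (λ one s → s := (one :+ s) :- one) refl 1# _ ⟩
    (1# + ∑ n₀ g) - 1#      ≈⟨ +-congʳ (+-congʳ (sym ψ-0)) ⟩
    (ψ F.0# + ∑ n₀ g) - 1#  ≈⟨ +-congʳ (trans (sym (∑ꟳ-log commutativeRing ψ-cong)) ∑ψ≈0) ⟩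
    0# - 1#  ≈⟨ +-identityˡ _ ⟩
    - 1#  ∎

  g-frobenius : ∀ n → g (p ℕ.* n) ≈ g n
  g-frobenius n = trans (g-cong (p ℕ.* n) (n ℕ.* p) (F.reflexive (≡.cong (γ F.^_) (ℕₚ.*-comm p n))))
    (trans (ψ-cong (F.sym (Fᴱ.^-assocʳ γ n p))) (ψ-^p (γ F.^ n)))

  g^p≈1 : ∀ n → g n ^ p ≈ 1#
  g^p≈1 n = trans (^-assocʳ (ζ p) r p) (trans (reflexive (≡.cong (ζ p ^_) (ℕₚ.*-comm r p))) (^-multiple p ζ^p≈1 r))
    where r = residue ((γ F.^ n))

  -- The sum is p if the residue is 0, and otherwise a geometric sum with value 0. Added up over a
  -- class, these integers show that (p - 1) η is rational.
  g-powerSum : ∀ n → ∃[ z ] ∑ p (g n ^_) ≈ ι z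
  g-powerSum n = go (residue ((γ F.^ n))) (proj₁ (residue-spec (γ F.^ n)))
    where
    go : ∀ r → r ℕ.< p → ∃[ z ] ∑ p ((ζ p ^ r) ^_) ≈ ι z
    go zero    _   = + p , trans (∑-cong p (λ i _ → 1^n≈1 i)) (trans (∑-const p 1#) (*-identityʳ _))
    go (suc r) r<p = + 0 , geometricSum p
      (trans (^-assocʳ (ζ p) (suc r) p) (trans (reflexive (≡.cong (ζ p ^_) (ℕₚ.*-comm (suc r) p))) (^-multiple p ζ^p≈1 (suc r))))
      (λ ζʳ≈1 → #-irrefl ζʳ≈1 (ζ-prim p (suc r) (s≤s z≤n) r<p))

  -- The divisibility records that n · 1 is a (p - 1)-st root of unity. Coprimality of N and p - 1
  -- will turn it into N ∣ l, that is, n · 1 ∈ C₀.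
  log-primeField : ∀ n → 0 ℕ.< n → n ℕ.< p → ∃[ l ] n F.· F.1# F.≈ γ F.^ l × n₀ ∣ℕ l ℕ.* (p ℕ.∸ 1)
  log-primeField n 0<n n<p with l , n≈ ← log _ (·1-small 0<n n<p) =
    l , n≈ , fixed⇒n₀∣ {l} (F.trans (Fᴱ.^-congˡ p (F.sym n≈)) (F.trans (frobenius-· n) n≈))
    where
    open FrobeniusEndomorphism F.commutativeRing p-prime characteristic

  g-scale : ∀ n l → n F.· F.1# F.≈ γ F.^ l → ∀ i → g (l ℕ.+ i) ≈ g i ^ n
  g-scale n l n≈ i = trans (ψ-cong (F.trans (Fᴱ.^-homo-* γ l i) (F.trans (F.*-congʳ (F.sym n≈))
      (F.trans (×-assoc-* n F.1# (γ F.^ i)) (×-congʳ n (F.*-identityˡ _)))))) (ψ-· n (γ F.^ i))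
    where
    open MultProperties F.semiring using (×-assoc-*; ×-congʳ)

  -- -1 is the prime-field element (p - 1) · 1, so its logarithm has the same divisibility, with no
  -- separation of the case p = 2.
  log[-1] : ∃[ l ] F.1# F.+ γ F.^ l F.≈ F.0# × n₀ ∣ℕ l ℕ.* (p ℕ.∸ 1)
  log[-1] =
    let l , -1≈ , n₀∣ = log-primeField (p ℕ.∸ 1)
          (ℕₚ.m<n⇒0<n∸m (ℕ.nonTrivial⇒n>1 p {{prime⇒nonTrivial p-prime}})) (ℕₚ.≤-reflexive 1+[p∸1]≡p)
    in l , F.trans (F.+-congˡ (F.sym -1≈)) (F.trans (F.reflexive (≡.cong (F._· F.1#) 1+[p∸1]≡p)) characteristic) , n₀∣
    where
    1+[p∸1]≡p : suc (p ℕ.∸ 1) ≡ p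
    1+[p∸1]≡p = ℕₚ.suc-pred p

  -- By additivity the summand is ψ (γ^n (1 + γ^l)). So the value is n₀ if γ^l = -1, and otherwise
  -- the full sum of `g`, which is -1.
  autocorrelation : ℕ → Carrier
  autocorrelation l = ∑ n₀ (λ n → g n * g (n ℕ.+ l))

  private
    g*g : ∀ n l → g n * g (n ℕ.+ l) ≈ ψ (γ F.^ n F.* (F.1# F.+ γ F.^ l))
    g*g n l = trans (sym (ψ-+ _ _)) (ψ-cong (F.trans (F.+-cong (F.sym (F.*-identityʳ _)) (Fᴱ.^-homo-* γ n l)) (F.sym (F.distribˡ _ _ _))))
  
  autocorrelation-0 : ∀ l → F.1# F.+ γ F.^ l F.≈ F.0# → autocorrelation l ≈ ι (+ n₀)
  autocorrelation-0 l eq = begin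
    autocorrelation l      ≈⟨ ∑-cong n₀ (λ n _ → trans (g*g n l) (trans (ψ-cong (F.trans (F.*-congˡ eq) (F.zeroʳ _))) ψ-0)) ⟩
    ∑ n₀ (λ _ → 1#)        ≈⟨ trans (∑-const n₀ 1#) (*-identityʳ _) ⟩
    ι (+ n₀)               ∎

  autocorrelation-≉0 : ∀ l → ¬ (F.1# F.+ γ F.^ l F.≈ F.0#) → autocorrelation l ≈ - 1#
  autocorrelation-≉0 l neq with m , eq ← log _ neq = begin
    autocorrelation l             ≈⟨ ∑-cong n₀ (λ n _ → trans (g*g n l) (ψ-cong (F.trans (F.*-congˡ eq) (F.trans (F.*-comm _ _) (F.sym (Fᴱ.^-homo-* γ m n)))))) ⟩
    ∑ n₀ (λ n → g (m ℕ.+ n))      ≈⟨ ∑-shift n₀ g-periodic m ⟩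
    ∑ n₀ g  ≈⟨ ∑g≈-1 ⟩
    - 1#  ∎

-- Gauss periods: symmetries, rationality and correlations

module GaussPeriods
  {c ℓ₁ ℓ₂ c′ ℓ₁′ ℓ₂′} (K : CharZeroFieldWithRootsOfUnity c ℓ₁ ℓ₂)
  {n₀ : ℕ} {{n₀≢0 : NonZero n₀}} (F : FiniteField c′ ℓ₁′ ℓ₂′ (suc n₀))
  {γ : FiniteField.Carrier F} (γ-primitive : FiniteField.IsPrimitiveElement F γ)
  {p : ℕ} (f : ℕ) (p-prime : Prime p) (order : suc n₀ ≡ p ℕ.^ suc f)
  (residue : FiniteField.Carrier F → ℕ)
  (residue-spec : ∀ x → residue x ℕ.< p ×
    FiniteField._≈_ F (FiniteField._·_ F (residue x) (FiniteField.1# F)) (Trace.tr F γ-primitive f p-prime order x))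
  {N k : ℕ} {{N≢0 : NonZero N}} {{k≢0 : NonZero k}} (n₀≡kN : n₀ ≡ k ℕ.* N) (coprime : Coprime N (p ℕ.∸ 1)) where
  private
    module F = FiniteField F
    module Fᴱ = ExpProperties (CommutativeRing.commutativeSemiring F.commutativeRing)
  open CharZeroFieldWithRootsOfUnity K hiding (zero; sum; _^_; _·_)
  open CommutativeRing commutativeRing using (commutativeSemiring)
  open IntegerScalars commutativeRing
  open RangeSum commutativeRing
  open ExpProperties commutativeSemiring
  open HeytingFieldProperties heytingField
  open AlgebraicIntegers K
  open PrimitiveElement F γ-primitive
  open AdditiveCharacter K F γ-primitive f p-prime order residue residue-spec
  open SetoidReasoning setoid

  N∣n₀ : N ∣ℕ n₀
  N∣n₀ = ℕ∣.divides k n₀≡kN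

  γ^-injective-%N : ∀ i j → γ F.^ i F.≈ γ F.^ j → i % N ≡ j % N
  γ^-injective-%N i j eq = ≡.trans (≡.sym (m∣n⇒o%n%m≡o%m N n₀ i N∣n₀))
    (≡.trans (≡.cong (_% N) (γ^-injective-% i j eq)) (m∣n⇒o%n%m≡o%m N n₀ j N∣n₀))

  N∣log : ∀ {l} → n₀ ∣ℕ l ℕ.* (p ℕ.∸ 1) → N ∣ℕ l
  N∣log {l} n₀∣ = coprime-divisor coprime (≡.subst (N ∣ℕ_) (ℕₚ.*-comm l (p ℕ.∸ 1)) (ℕ∣.∣-trans N∣n₀ n₀∣))

  -- Indexed by all natural numbers, so that shifts and multiplication by p need no reduction modulo
  -- N; `η≈` links it to the periods of the statement.
  η : ℕ → Carrier
  η a = ∑ k (λ j → g (a ℕ.+ j ℕ.* N))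

  g-classPeriodic : ∀ a i → g (a ℕ.+ (k ℕ.+ i) ℕ.* N) ≈ g (a ℕ.+ i ℕ.* N)
  g-classPeriodic a i = trans (reflexive (≡.cong g (E.begin
      a ℕ.+ (k ℕ.+ i) ℕ.* N          E.≡⟨ ≡.cong (a ℕ.+_) (ℕₚ.*-distribʳ-+ N k i) ⟩
      a ℕ.+ (k ℕ.* N ℕ.+ i ℕ.* N)    E.≡⟨ ≡.cong (λ n → a ℕ.+ (n ℕ.+ i ℕ.* N)) (≡.sym n₀≡kN) ⟩
      a ℕ.+ (n₀ ℕ.+ i ℕ.* N)         E.≡⟨ x∙yz≈y∙xz a n₀ (i ℕ.* N) ⟩
      n₀ ℕ.+ (a ℕ.+ i ℕ.* N)         E.∎))) (g-periodic _)
    where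
    module E = ≡.≡-Reasoning
    open CommutativeSemigroupProperties ℕₚ.+-commutativeSemigroup using (x∙yz≈y∙xz)

  η-shift : ∀ j a → ∑ k (λ i → g ((a ℕ.+ j ℕ.* N) ℕ.+ i ℕ.* N)) ≈ η a
  η-shift j a = trans
    (∑-cong k (λ i _ → reflexive (≡.cong g (≡.trans (ℕₚ.+-assoc a _ _) (≡.cong (a ℕ.+_) (≡.sym (ℕₚ.*-distribʳ-+ N j i)))))))
    (∑-shift k {λ i → g (a ℕ.+ i ℕ.* N)} (g-classPeriodic a) j)

  η-periodic : ∀ a → η (N ℕ.+ a) ≈ η a
  η-periodic a = trans
    (∑-cong k (λ i _ → reflexive (≡.cong (λ n → g (n ℕ.+ i ℕ.* N)) (≡.trans (ℕₚ.+-comm N a) (≡.cong (a ℕ.+_) (≡.sym (ℕₚ.*-identityˡ N)))))))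
    (η-shift 1 a)

  ∑-classes : ∀ h → ∑ n₀ h ≈ ∑ N (λ a → ∑ k (λ j → h (a ℕ.+ j ℕ.* N)))
  ∑-classes h = trans (reflexive (≡.cong (λ n → ∑ n h) n₀≡kN)) (∑-residues k N h)

  ∑η≈-1 : ∑ N η ≈ - 1#
  ∑η≈-1 = trans (sym (∑-classes g)) ∑g≈-1

  -- Since p p^f = q ≡ 1 modulo k, multiplication by p permutes the indices j. The exponents p a + j
  -- N may thus be replaced by p (a + j N), where `g-frobenius` applies.
  η-frobenius : ∀ a → η (p ℕ.* a) ≈ η a
  η-frobenius a = begin
    ∑ k (λ j → g (p ℕ.* a ℕ.+ j ℕ.* N))            ≈⟨ ∑-scale k p (p ℕ.^ f) inverse (g-classPeriodic (p ℕ.* a)) ⟨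
    ∑ k (λ j → g (p ℕ.* a ℕ.+ (p ℕ.* j) ℕ.* N))    ≈⟨ ∑-cong k (λ j _ → reflexive (≡.cong g (≡.sym (≡.trans (ℕₚ.*-distribˡ-+ p a _)
                                                        (≡.cong (p ℕ.* a ℕ.+_) (≡.sym (ℕₚ.*-assoc p j N))))))) ⟩
    ∑ k (λ j → g (p ℕ.* (a ℕ.+ j ℕ.* N)))          ≈⟨ ∑-cong k (λ j _ → g-frobenius (a ℕ.+ j ℕ.* N)) ⟩
    ∑ k (λ j → g (a ℕ.+ j ℕ.* N))  ∎
    where
    inverse : (p ℕ.* p ℕ.^ f) % k ≡ 1 % k
    inverse = ≡.trans (≡.cong (_% k) (≡.trans (≡.sym order) (≡.cong suc (≡.trans n₀≡kN (ℕₚ.*-comm k N))))) ([m+kn]%n≡m%n 1 N k)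

  -- Raising ψ to the power c multiplies its argument by c · 1 = γ^l with N ∣ l, which only permutes
  -- the class of a.
  η-scale : ∀ c → 0 ℕ.< c → c ℕ.< p → ∀ a → ∑ k (λ j → g (a ℕ.+ j ℕ.* N) ^ c) ≈ η a
  η-scale c 0<c c<p a =
    let l , c≈ , n₀∣ = log-primeField c 0<c c<p
        ℕ∣.divides m l≡mN = N∣log {l} n₀∣
    in begin
    ∑ k (λ j → g (a ℕ.+ j ℕ.* N) ^ c)  ≈⟨ ∑-cong k (λ j _ → g-scale c l c≈ (a ℕ.+ j ℕ.* N)) ⟨
    ∑ k (λ j → g (l ℕ.+ (a ℕ.+ j ℕ.* N)))              ≈⟨ ∑-cong k (λ j _ → reflexive (≡.cong g (≡.trans (≡.sym (ℕₚ.+-assoc l a _))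
                                                            (≡.cong (ℕ._+ j ℕ.* N) (≡.trans (ℕₚ.+-comm l a) (≡.cong (a ℕ.+_) l≡mN)))))) ⟩
    ∑ k (λ j → g ((a ℕ.+ m ℕ.* N) ℕ.+ j ℕ.* N))        ≈⟨ η-shift m a ⟩
    η a  ∎

  ∑-integer : ∀ n {h : ℕ → Carrier} → (∀ i → ∃[ z ] h i ≈ ι z) → ∃[ z ] ∑ n h ≈ ι z
  ∑-integer zero    h-int = + 0 , refl
  ∑-integer (suc n) h-int =
    let z₀ , eq₀ = h-int 0
        z₁ , eq₁ = ∑-integer n (λ i → h-int (suc i))
    in z₀ ℤ.+ z₁ , trans (+-cong eq₀ eq₁) (sym (ι-+ z₀ z₁))

  -- Averages over multiplication by the prime field, whose units are N-th powers.
  [p-1]η-integer : ∀ a → ∃[ z ] ι (+ (p ℕ.∸ 1)) * η a ≈ ι z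
  [p-1]η-integer a =
    let z , eq = ∑-integer k (λ j → g-powerSum (a ℕ.+ j ℕ.* N))
    in z ℤ.- + k , (begin
    ι (+ (p ℕ.∸ 1)) * η a  ≈⟨ ∑-const (p ℕ.∸ 1) (η a) ⟨
    ∑ (p ℕ.∸ 1) (λ _ → η a)  ≈⟨ ∑-cong (p ℕ.∸ 1) (λ i i<p-1 → η-scale (suc i) (s≤s z≤n) (≡.subst (suc i ℕ.<_) 1+[p∸1]≡p (s≤s i<p-1)) a) ⟨
    -- The power c = 0 contributes k. Adding it completes the sum to all exponents c < p, where
    -- `g-powerSum` applies.
    rest  ≈⟨ solve 2 (λ k r → r := (k :+ r) :- k) refl (ι (+ k)) rest ⟩
    (ι (+ k) + rest) - ι (+ k)  ≈⟨ +-congʳ (+-congʳ (trans (∑-const k 1#) (*-identityʳ _))) ⟨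
    ∑ (suc (p ℕ.∸ 1)) (λ c → ∑ k (λ j → g (a ℕ.+ j ℕ.* N) ^ c)) - ι (+ k)
      ≈⟨ +-congʳ (reflexive (≡.cong (λ n → ∑ n (λ c → ∑ k (λ j → g (a ℕ.+ j ℕ.* N) ^ c))) 1+[p∸1]≡p)) ⟩
    ∑ p (λ c → ∑ k (λ j → g (a ℕ.+ j ℕ.* N) ^ c)) - ι (+ k)    ≈⟨ +-congʳ (∑-swap p k (λ c j → g (a ℕ.+ j ℕ.* N) ^ c)) ⟩
    ∑ k (λ j → ∑ p (g (a ℕ.+ j ℕ.* N) ^_)) - ι (+ k)           ≈⟨ +-cong eq (sym (ι-neg (+ k))) ⟩
    ι z + ι (ℤ.- + k)  ≈⟨ ι-+ z (ℤ.- + k) ⟨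
    ι (z ℤ.- + k)  ∎)
    where
    rest = ∑ (p ℕ.∸ 1) (λ c → ∑ k (λ j → g (a ℕ.+ j ℕ.* N) ^ suc c))
    1+[p∸1]≡p : suc (p ℕ.∸ 1) ≡ p
    1+[p∸1]≡p = ℕₚ.suc-pred p

  η-integral : ∀ a → IsAlgebraicInteger (η a)
  η-integral a = integral-∑ k (λ j _ → integral-root p (ℕ.>-nonZero⁻¹ p) (g^p≈1 (a ℕ.+ j ℕ.* N)))

  -- `η-shift` starts the inner sum at the index of the outer one, so that the product becomes a sum
  -- over pairs of exponents with fixed differences b + i N.
  correlation : ∀ b → ∑ N (λ a → η a * η (a ℕ.+ b)) ≈ ∑ k (λ i → autocorrelation (b ℕ.+ i ℕ.* N))
  correlation b = begin
    ∑ N (λ a → η a * η (a ℕ.+ b))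
      ≈⟨ ∑-cong N (λ a _ → trans (sym (∑-*ʳ k (η (a ℕ.+ b)) (λ j → g (a ℕ.+ j ℕ.* N)))) (∑-cong k (λ j _ → row a j))) ⟩
    ∑ N (λ a → ∑ k (λ j → h (a ℕ.+ j ℕ.* N)))      ≈⟨ ∑-classes h ⟨
    ∑ n₀ h  ≈⟨ ∑-swap n₀ k (λ n i → g n * g (n ℕ.+ (b ℕ.+ i ℕ.* N))) ⟩
    ∑ k (λ i → autocorrelation (b ℕ.+ i ℕ.* N))    ∎
    where
    h : ℕ → Carrier
    h n = ∑ k (λ i → g n * g (n ℕ.+ (b ℕ.+ i ℕ.* N)))
    row : ∀ a j → g (a ℕ.+ j ℕ.* N) * η (a ℕ.+ b) ≈ h (a ℕ.+ j ℕ.* N)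
    row a j = begin
      g n * η (a ℕ.+ b)  ≈⟨ *-congˡ (η-shift j (a ℕ.+ b)) ⟨
      g n * ∑ k (λ i → g ((a ℕ.+ b ℕ.+ j ℕ.* N) ℕ.+ i ℕ.* N))    ≈⟨ ∑-*ˡ k (g n) (λ i → g ((a ℕ.+ b ℕ.+ j ℕ.* N) ℕ.+ i ℕ.* N)) ⟨
      ∑ k (λ i → g n * g ((a ℕ.+ b ℕ.+ j ℕ.* N) ℕ.+ i ℕ.* N))    ≈⟨ ∑-cong k (λ i _ → *-congˡ (reflexive (≡.cong g (rearrange (i ℕ.* N))))) ⟩
      h n  ∎
      where
      n = a ℕ.+ j ℕ.* N
      rearrange : ∀ x → (a ℕ.+ b ℕ.+ j ℕ.* N) ℕ.+ x ≡ n ℕ.+ (b ℕ.+ x)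
      rearrange x = ≡.trans (≡.cong (ℕ._+ x) (xy∙z≈xz∙y a b (j ℕ.* N))) (ℕₚ.+-assoc n b x)
        where open CommutativeSemigroupProperties ℕₚ.+-commutativeSemigroup using (xy∙z≈xz∙y)

  private
    1+γ^≈0⇒ : ∀ l → F.1# F.+ γ F.^ l F.≈ F.0# → γ F.^ l F.≈ γ F.^ proj₁ log[-1]
    1+γ^≈0⇒ l eq = +ᶠ-cancelˡ F.1# _ _ (F.trans eq (F.sym (proj₁ (proj₂ log[-1]))))
      where open RingProperties (CommutativeRing.ring F.commutativeRing) renaming (+-cancelˡ to +ᶠ-cancelˡ)

  -- As -1 lies in C₀, no exponent b + i N with 0 < b < N is a logarithm of -1, and each of the k
  -- autocorrelations is -1.
  correlation-≢0 : ∀ b → 0 ℕ.< b → b ℕ.< N → ∑ N (λ a → η a * η (a ℕ.+ b)) ≈ - ι (+ k)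
  correlation-≢0 b 0<b b<N = begin
    ∑ N (λ a → η a * η (a ℕ.+ b))  ≈⟨ correlation b ⟩
    ∑ k (λ i → autocorrelation (b ℕ.+ i ℕ.* N))    ≈⟨ ∑-cong k (λ i _ → autocorrelation-≉0 (b ℕ.+ i ℕ.* N) (b≢0 i)) ⟩
    ∑ k (λ _ → - 1#)  ≈⟨ ∑-const k (- 1#) ⟩
    ι (+ k) * - 1#  ≈⟨ solve 2 (λ k one → k :* :- one := :- (k :* one)) refl (ι (+ k)) 1# ⟩
    - (ι (+ k) * 1#)  ≈⟨ -‿cong (*-identityʳ _) ⟩
    - ι (+ k)  ∎
    where
    b≢0 : ∀ i → ¬ (F.1# F.+ γ F.^ (b ℕ.+ i ℕ.* N) F.≈ F.0#)
    b≢0 i eq = ℕₚ.<⇒≢ 0<b (≡.sym (E.begin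
      b                       E.≡⟨ m<n⇒m%n≡m b<N ⟨
      b % N  E.≡⟨ [m+kn]%n≡m%n b i N ⟨
      (b ℕ.+ i ℕ.* N) % N     E.≡⟨ γ^-injective-%N (b ℕ.+ i ℕ.* N) (proj₁ log[-1]) (1+γ^≈0⇒ (b ℕ.+ i ℕ.* N) eq) ⟩
      proj₁ log[-1] % N       E.≡⟨ ℕ∣.n∣m⇒m%n≡0 _ N (N∣log (proj₂ (proj₂ log[-1]))) ⟩
      0                       E.∎))
      where module E = ≡.≡-Reasoning

  -- Exactly one i₀ < k satisfies γ^(i₀ N) = -1. After 1 is added to each of the k summands only
  -- that one survives, with value n₀ + 1 = q.
  correlation-0 : ∑ N (λ a → η a * η a) ≈ ι (+ suc n₀) - ι (+ k)
  correlation-0 = begin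
    ∑ N (λ a → η a * η a)  ≈⟨ ∑-cong N (λ a _ → *-congˡ (reflexive (≡.cong η (ℕₚ.+-identityʳ a)))) ⟨
    ∑ N (λ a → η a * η (a ℕ.+ 0))  ≈⟨ correlation 0 ⟩
    S                                               ≈⟨ solve 2 (λ s k → s := (s :+ k) :- k) refl S (ι (+ k)) ⟩
    (S + ι (+ k)) - ι (+ k)  ≈⟨ +-congʳ (+-congˡ (trans (∑-const k 1#) (*-identityʳ _))) ⟨
    (S + ∑ k (λ _ → 1#)) - ι (+ k)  ≈⟨ +-congʳ (∑-+ k (λ i → autocorrelation (i ℕ.* N)) (λ _ → 1#)) ⟨
    ∑ k (λ i → autocorrelation (i ℕ.* N) + 1#) - ι (+ k)
      ≈⟨ +-congʳ (∑-single k i₀ i₀<k (λ i i<k i≢i₀ → trans (+-congʳ (autocorrelation-≉0 (i ℕ.* N) (other i i<k i≢i₀))) (-‿inverseˡ 1#))) ⟩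
    (autocorrelation (i₀ ℕ.* N) + 1#) - ι (+ k)     ≈⟨ +-congʳ (trans (+-congʳ (autocorrelation-0 (i₀ ℕ.* N) at-i₀)) (+-comm _ _)) ⟩
    ι (+ suc n₀) - ι (+ k)  ∎
    where
    S = ∑ k (λ i → autocorrelation (i ℕ.* N))
    l₁ = proj₁ log[-1] % n₀
    N∣l₁ : N ∣ℕ l₁
    N∣l₁ = ℕ∣.%-presˡ-∣ (N∣log (proj₂ (proj₂ log[-1]))) N∣n₀
    i₀ = ℕ∣.quotient N∣l₁
    l₁≡i₀N : l₁ ≡ i₀ ℕ.* N
    l₁≡i₀N = ℕ∣._∣_.equality N∣l₁
    i₀<k : i₀ ℕ.< k
    i₀<k = ℕₚ.*-cancelʳ-< N i₀ k (≡.subst₂ ℕ._<_ l₁≡i₀N n₀≡kN (m%n<n _ n₀))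
    at-i₀ : F.1# F.+ γ F.^ (i₀ ℕ.* N) F.≈ F.0#
    at-i₀ = F.trans (F.+-congˡ (F.trans (F.reflexive (≡.cong (γ F.^_) (≡.sym l₁≡i₀N))) (F.sym (γ^-% _)))) (proj₁ (proj₂ log[-1]))
    other : ∀ i → i ℕ.< k → i ≢ i₀ → ¬ (F.1# F.+ γ F.^ (i ℕ.* N) F.≈ F.0#)
    other i i<k i≢i₀ eq = i≢i₀ (ℕₚ.*-cancelʳ-≡ i i₀ N (E.begin
      i ℕ.* N  E.≡⟨ m<n⇒m%n≡m (≡.subst (i ℕ.* N ℕ.<_) (≡.sym n₀≡kN) (ℕₚ.*-monoˡ-< N i<k)) ⟨
      (i ℕ.* N) % n₀          E.≡⟨ γ^-injective-% (i ℕ.* N) (proj₁ log[-1]) (1+γ^≈0⇒ (i ℕ.* N) eq) ⟩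
      l₁  E.≡⟨ l₁≡i₀N ⟩
      i₀ ℕ.* N  E.∎))
      where module E = ≡.≡-Reasoning

-- Gauss sums as the Fourier transform of the periods

module GaussSums
  {c ℓ₁ ℓ₂ c′ ℓ₁′ ℓ₂′} (K : CharZeroFieldWithRootsOfUnity c ℓ₁ ℓ₂)
  {n₀ : ℕ} {{n₀≢0 : NonZero n₀}} (F : FiniteField c′ ℓ₁′ ℓ₂′ (suc n₀))
  {γ : FiniteField.Carrier F} (γ-primitive : FiniteField.IsPrimitiveElement F γ)
  {p : ℕ} (f : ℕ) (p-prime : Prime p) (order : suc n₀ ≡ p ℕ.^ suc f)
  {N k : ℕ} {{N≢0 : NonZero N}} {{k≢0 : NonZero k}} (n₀≡kN : n₀ ≡ k ℕ.* N) (coprime : Coprime N (p ℕ.∸ 1)) where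
  private
    module F = FiniteField F
    module Fᴱ = ExpProperties (CommutativeRing.commutativeSemiring F.commutativeRing)
    module CS = CharacterSums K p (suc f) F
  open CharZeroFieldWithRootsOfUnity K hiding (zero; sum; _^_; _·_)
  open CommutativeRing commutativeRing using (commutativeSemiring; *-commutativeSemigroup)
  open IntegerScalars commutativeRing
  open RangeSum commutativeRing
  open ExpProperties commutativeSemiring
  open HeytingFieldProperties heytingField
  open AlgebraicIntegers K
  open PrimitiveElement F γ-primitive
  open ResidueTrace K F γ-primitive f p-prime order
  open AdditiveCharacter K F γ-primitive f p-prime order residueTrace residueTrace-spec
  open GaussPeriods K F γ-primitive f p-prime order residueTrace residueTrace-spec n₀≡kN coprime public
  open SetoidReasoning setoid

  module _ {ℓ} {P : Pred F.Carrier ℓ} (P? : Decidable₁ P) (h : F.Carrier → Carrier) where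

    restrict : F.Carrier → Carrier
    restrict x = if does (P? x) then h x else 0#

    restrict-∈ : ∀ {x} → P x → restrict x ≈ h x
    restrict-∈ {x} x∈P with P? x
    ... | yes _   = refl
    ... | no  x∉P = contradiction x∈P x∉P

    restrict-∉ : ∀ {x} → ¬ P x → restrict x ≈ 0#
    restrict-∉ {x} x∉P with P? x
    ... | yes x∈P = contradiction x∈P x∉P
    ... | no  _   = refl

    restrict-cong : (∀ {x y} → x F.≈ y → P x → P y) → (∀ {x y} → x F.≈ y → h x ≈ h y) →
                    ∀ {x y} → x F.≈ y → restrict x ≈ restrict y
    restrict-cong P-resp h-cong {x} {y} x≈y = go (P? x)
      where
      go : Dec (P x) → restrict x ≈ restrict y
      go (yes x∈P) = trans (restrict-∈ x∈P) (trans (h-cong x≈y) (sym (restrict-∈ (P-resp x≈y x∈P))))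
      go (no  x∉P) = trans (restrict-∉ x∉P) (sym (restrict-∉ (x∉P ∘ P-resp (F.sym x≈y))))

    sumOver-log : (∀ {x y} → x F.≈ y → P x → P y) → (∀ {x y} → x F.≈ y → h x ≈ h y) → ¬ P F.0# →
                  CS.sumOver P? h ≈ ∑ n₀ (λ n → restrict (γ F.^ n))
    sumOver-log P-resp h-cong 0∉P = trans (∑ꟳ-log commutativeRing {restrict} (restrict-cong P-resp h-cong))
      (trans (+-congʳ (restrict-∉ 0∉P)) (+-identityˡ _))

  coset-γ^ : ∀ a j → F.coset γ N a (γ F.^ (a ℕ.+ j ℕ.* N))
  coset-γ^ a j = (γ F.^ N) F.^ j , (j , F.refl) , F.trans (Fᴱ.^-homo-* γ a (j ℕ.* N))
    (F.*-congˡ (F.trans (F.reflexive (≡.cong (γ F.^_) (ℕₚ.*-comm j N))) (F.sym (Fᴱ.^-assocʳ γ N j))))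

  coset-log : ∀ a {x} → F.coset γ N a x → ∃[ j ] x F.≈ γ F.^ (a ℕ.+ j ℕ.* N)
  coset-log a (h , (j , h≈) , x≈) = j , F.trans x≈ (F.trans (F.*-congˡ (F.trans h≈ (F.trans (Fᴱ.^-assocʳ γ N j)
    (F.reflexive (≡.cong (γ F.^_) (ℕₚ.*-comm N j)))))) (F.sym (Fᴱ.^-homo-* γ a (j ℕ.* N))))

  coset-resp : ∀ a {x y} → x F.≈ y → F.coset γ N a x → F.coset γ N a y
  coset-resp a x≈y (h , h∈ , x≈) = h , h∈ , F.trans (F.sym x≈y) x≈

  0∉coset : ∀ a → ¬ F.coset γ N a F.0#
  0∉coset a 0∈ = let j , 0≈ = coset-log a 0∈ in γ^≉0 (a ℕ.+ j ℕ.* N) (F.sym 0≈)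

  coset-γ^⁻ : ∀ {a b} → a ℕ.< N → b ℕ.< N → ∀ i → F.coset γ N a (γ F.^ (b ℕ.+ i ℕ.* N)) → b ≡ a
  coset-γ^⁻ {a} {b} a<N b<N i b∈ =
    let j , eq = coset-log a b∈ in E.begin
    b                      E.≡⟨ m<n⇒m%n≡m b<N ⟨
    b % N  E.≡⟨ [m+kn]%n≡m%n b i N ⟨
    (b ℕ.+ i ℕ.* N) % N    E.≡⟨ γ^-injective-%N (b ℕ.+ i ℕ.* N) (a ℕ.+ j ℕ.* N) eq ⟩
    (a ℕ.+ j ℕ.* N) % N    E.≡⟨ [m+kn]%n≡m%n a j N ⟩
    a % N  E.≡⟨ m<n⇒m%n≡m a<N ⟩
    a                      E.∎
    where module E = ≡.≡-Reasoning

  η≈ : ∀ (i : Fin N) → CS.η γ N i ≈ η (toℕ i)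
  η≈ i = begin
    CS.η γ N i  ≈⟨ sumOver-log (F.coset? γ N a) ψ (coset-resp a) ψ-cong (0∉coset a) ⟩
    ∑ n₀ (λ n → h (γ F.^ n))  ≈⟨ ∑-classes (λ n → h (γ F.^ n)) ⟩
    ∑ N (λ b → ∑ k (λ j → h (γ F.^ (b ℕ.+ j ℕ.* N))))
      ≈⟨ ∑-single N a a<N (λ b b<N b≢a → ∑-0 k (λ j _ → restrict-∉ (F.coset? γ N a) ψ (b≢a ∘ coset-γ^⁻ a<N b<N j))) ⟩
    ∑ k (λ j → h (γ F.^ (a ℕ.+ j ℕ.* N)))  ≈⟨ ∑-cong k (λ j _ → restrict-∈ (F.coset? γ N a) ψ (coset-γ^ a j)) ⟩
    η a  ∎
    where
    a = toℕ i
    a<N = Finₚ.toℕ<n i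
    h = restrict (F.coset? γ N a) ψ

  module Character (X : CS.MultiplicativeCharacter) where
    open CS.MultiplicativeCharacter X

    χ-γ^ : ∀ n → χ (γ F.^ n) ≈ χ γ ^ n
    χ-γ^ zero    = χ-1
    χ-γ^ (suc n) = trans (χ-* γ (γ F.^ n) (proj₁ γ-primitive) (γ^≉0 n)) (*-congˡ (χ-γ^ n))

    χγ^N≈1 : CS.IsTrivialOn (F.C₀ γ N) X → χ γ ^ N ≈ 1#
    χγ^N≈1 trivial = trans (sym (χ-γ^ N)) (trivial (γ F.^ N) (1 , F.sym (F.*-identityʳ _)))

    χγ≈1⇒trivial : χ γ ≈ 1# → CS.IsTrivial X
    χγ≈1⇒trivial χγ≈1 x x≉0 = let n , x≈ = log x x≉0 in
      trans (χ-cong x≈) (trans (χ-γ^ n) (trans (^-congˡ n χγ≈1) (1^n≈1 n)))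

    G≈ : CS.IsTrivialOn (F.C₀ γ N) X → CS.G X ≈ ∑ N (λ a → χ γ ^ a * η a)
    G≈ trivial = begin
      CS.G X  ≈⟨ sumOver-log nonzero? h (λ x≈y x≉0 y≈0 → x≉0 (F.trans x≈y y≈0)) (λ x≈y → *-cong (χ-cong x≈y) (ψ-cong x≈y)) (λ 0≉0 → 0≉0 F.refl) ⟩
      ∑ n₀ (λ n → restrict nonzero? h (γ F.^ n))  ≈⟨ ∑-cong n₀ (λ n _ → trans (restrict-∈ nonzero? h (γ^≉0 n)) (*-congʳ (χ-γ^ n))) ⟩
      ∑ n₀ (λ n → ω ^ n * g n)  ≈⟨ ∑-classes (λ n → ω ^ n * g n) ⟩
      ∑ N (λ a → ∑ k (λ j → ω ^ (a ℕ.+ j ℕ.* N) * g (a ℕ.+ j ℕ.* N)))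
        ≈⟨ ∑-cong N (λ a _ → trans (∑-cong k (λ j _ → *-congʳ (^-cong-% N (χγ^N≈1 trivial) ([m+kn]%n≡m%n a j N)))) (∑-*ˡ k (ω ^ a) (λ j → g (a ℕ.+ j ℕ.* N)))) ⟩
      ∑ N (λ a → ω ^ a * η a)  ∎
      where
      ω = χ γ
      nonzero? : Decidable₁ (λ x → ¬ (x F.≈ F.0#))
      nonzero? x = ¬? (x F.≟ F.0#)
      h : F.Carrier → Carrier
      h x = χ x * ψ x

  module _ {ω : Carrier} (ω^N≈1 : ω ^ N ≈ 1#) where
    private
      value : ∀ {x} → Dec (x F.≈ F.0#) → Carrier
      value (yes _)   = 1#
      value (no  x≉0) = ω ^ proj₁ (log _ x≉0)

      value-γ^ : ∀ {x} (dec : Dec (x F.≈ F.0#)) n → x F.≈ γ F.^ n → value dec ≈ ω ^ n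
      value-γ^ (yes x≈0) n x≈ = contradiction (F.trans (F.sym x≈) x≈0) (γ^≉0 n)
      value-γ^ (no  x≉0) n x≈ = ^-cong-% N ω^N≈1
        (γ^-injective-%N (proj₁ (log _ x≉0)) n (F.trans (F.sym (proj₂ (log _ x≉0))) x≈))

      value-cong : ∀ {x y} (dx : Dec (x F.≈ F.0#)) (dy : Dec (y F.≈ F.0#)) → x F.≈ y → value dx ≈ value dy
      value-cong (yes x≈0) (yes y≈0) x≈y = refl
      value-cong (yes x≈0) (no  y≉0) x≈y = contradiction (F.trans (F.sym x≈y) x≈0) y≉0
      value-cong (no  x≉0) dy        x≈y = sym (value-γ^ dy (proj₁ (log _ x≉0)) (F.trans (F.sym x≈y) (proj₂ (log _ x≉0))))

    -- Divisibility is assumed for Gauss sums of characters, while Fourier inversion ranges over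
    -- N-th roots of unity ω. The rule γ^n ↦ ω^n is well defined because N divides n₀.
    characterOf : CS.MultiplicativeCharacter
    characterOf = record
      { χ      = λ x → value (x F.≟ F.0#)
      ; χ-cong = λ {x} {y} → value-cong (x F.≟ F.0#) (y F.≟ F.0#)
      ; χ-1    = value-γ^ (F.1# F.≟ F.0#) 0 F.refl
      ; χ-*    = λ x y x≉0 y≉0 →
          let i , x≈ = log x x≉0
              j , y≈ = log y y≉0
          in trans (value-γ^ (x F.* y F.≟ F.0#) (i ℕ.+ j) (F.trans (F.*-cong x≈ y≈) (F.sym (Fᴱ.^-homo-* γ i j))))
               (trans (^-homo-* ω i j) (sym (*-cong (value-γ^ (x F.≟ F.0#) i x≈) (value-γ^ (y F.≟ F.0#) j y≈))))
      }

    characterOf-γ^ : ∀ n {x} → x F.≈ γ F.^ n → CS.MultiplicativeCharacter.χ characterOf x ≈ ω ^ n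
    characterOf-γ^ n {x} = value-γ^ (x F.≟ F.0#) n

    characterOf-C₀ : CS.IsTrivialOn (F.C₀ γ N) characterOf
    characterOf-C₀ x (j , x≈) = trans (characterOf-γ^ (N ℕ.* j) (F.trans x≈ (Fᴱ.^-assocʳ γ N j))) (^-multiple N ω^N≈1 j)

    G-characterOf : CS.G characterOf ≈ ∑ N (λ a → ω ^ a * η a)
    G-characterOf = trans (Character.G≈ characterOf characterOf-C₀)
      (∑-cong N (λ a _ → *-congʳ (^-congˡ a (trans (characterOf-γ^ 1 (F.sym (F.*-identityʳ γ))) (*-identityʳ ω)))))

    G-divisible : ∀ {t} → ¬ (ω ≈ 1#) → CS.DividesGaussSums γ N t →
                  ∃[ w ] IsAlgebraicInteger w × ∑ N (λ a → ω ^ a * η a) ≈ ι (+ t) * w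
    G-divisible ω≉1 divides =
      let w , w-int , eq = divides characterOf
            (λ trivial → ω≉1 (trans (sym (trans (characterOf-γ^ 1 (F.sym (F.*-identityʳ γ))) (*-identityʳ ω))) (trivial γ (proj₁ γ-primitive))))
            characterOf-C₀
      in w , w-int , trans (sym G-characterOf) eq

  private
    -- For 0 < j < N this is the Gauss sum of the character with γ ↦ (ζ N)^j; for j = 0 it is the
    -- sum of all periods, which is -1.
    Ĝ : ℕ → Carrier
    Ĝ j = ∑ N (λ b → (ζ N ^ j) ^ b * η b)

    ζ^j^N≈1 : ∀ j → (ζ N ^ j) ^ N ≈ 1#
    ζ^j^N≈1 j = trans (^-assocʳ (ζ N) j N) (trans (reflexive (≡.cong (ζ N ^_) (ℕₚ.*-comm j N))) (^-multiple N (ζ-root N) j))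

    orthogonality : ∀ {a b} → a ℕ.< N → b ℕ.< N → b ≢ a → ∑ N ((ζ N ^ (N ℕ.∸ a ℕ.+ b)) ^_) ≈ 0#
    orthogonality {a} {b} a<N b<N b≢a = geometricSum N (ζ^j^N≈1 e) λ ζᵉ≈1 →
      #-irrefl (trans (sym (^-mod N (ζ-root N) e)) ζᵉ≈1) (ζ-prim N (e % N) (ℕₚ.n≢0⇒n>0 e%N≢0) (m%n<n e N))
      where
      module E = ≡.≡-Reasoning
      e = N ℕ.∸ a ℕ.+ b
      e%N≢0 : e % N ≢ 0
      e%N≢0 e%N≡0 = let ℕ∣.divides c e≡cN = ℕ∣.m%n≡0⇒n∣m e N e%N≡0 in b≢a (E.begin
        b                        E.≡⟨ m<n⇒m%n≡m b<N ⟨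
        b % N  E.≡⟨ [m+kn]%n≡m%n b 1 N ⟨
        (b ℕ.+ 1 ℕ.* N) % N      E.≡⟨ ≡.cong (λ n → (b ℕ.+ n) % N) (ℕₚ.*-identityˡ N) ⟩
        (b ℕ.+ N) % N            E.≡⟨ ≡.cong (λ n → (b ℕ.+ n) % N) (ℕₚ.m+[n∸m]≡n (ℕₚ.<⇒≤ a<N)) ⟨
        (b ℕ.+ (a ℕ.+ (N ℕ.∸ a))) % N    E.≡⟨ ≡.cong (_% N) (x∙yz≈y∙zx b a (N ℕ.∸ a)) ⟩
        (a ℕ.+ e) % N            E.≡⟨ ≡.cong (λ n → (a ℕ.+ n) % N) e≡cN ⟩
        (a ℕ.+ c ℕ.* N) % N      E.≡⟨ [m+kn]%n≡m%n a c N ⟩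
        a % N  E.≡⟨ m<n⇒m%n≡m a<N ⟩
        a                        E.∎)
        where open CommutativeSemigroupProperties ℕₚ.+-commutativeSemigroup using (x∙yz≈y∙zx)

    -- In the exponent `N ∸ a` stands for -a, since (ζ N)^N = 1.
    inversion : ∀ {a} → a ℕ.< N → ∑ N (λ j → (ζ N ^ j) ^ (N ℕ.∸ a) * Ĝ j) ≈ ι (+ N) * η a
    inversion {a} a<N = begin
      ∑ N (λ j → (ζ N ^ j) ^ (N ℕ.∸ a) * Ĝ j)
        ≈⟨ ∑-cong N (λ j _ → trans (sym (∑-*ˡ N ((ζ N ^ j) ^ (N ℕ.∸ a)) (λ b → (ζ N ^ j) ^ b * η b))) (∑-cong N (λ b _ → term j b))) ⟩
      ∑ N (λ j → ∑ N (λ b → (ζ N ^ (N ℕ.∸ a ℕ.+ b)) ^ j * η b))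
        ≈⟨ ∑-swap N N (λ j b → (ζ N ^ (N ℕ.∸ a ℕ.+ b)) ^ j * η b) ⟩
      ∑ N (λ b → ∑ N (λ j → (ζ N ^ (N ℕ.∸ a ℕ.+ b)) ^ j * η b))
        ≈⟨ ∑-cong N (λ b _ → ∑-*ʳ N (η b) ((ζ N ^ (N ℕ.∸ a ℕ.+ b)) ^_)) ⟩
      ∑ N (λ b → ∑ N ((ζ N ^ (N ℕ.∸ a ℕ.+ b)) ^_) * η b)
        ≈⟨ ∑-single N a a<N (λ b b<N b≢a → trans (*-congʳ (orthogonality a<N b<N b≢a)) (zeroˡ _)) ⟩
      ∑ N ((ζ N ^ (N ℕ.∸ a ℕ.+ a)) ^_) * η a
        ≈⟨ *-congʳ (trans (∑-cong N (λ j _ → trans (^-congˡ j (trans (reflexive (≡.cong (ζ N ^_) (ℕₚ.m∸n+n≡m (ℕₚ.<⇒≤ a<N)))) (ζ-root N))) (1^n≈1 j)))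
                          (trans (∑-const N 1#) (*-identityʳ _))) ⟩
      ι (+ N) * η a  ∎
      where
      term : ∀ j b → (ζ N ^ j) ^ (N ℕ.∸ a) * ((ζ N ^ j) ^ b * η b) ≈ (ζ N ^ (N ℕ.∸ a ℕ.+ b)) ^ j * η b
      term j b = begin
        (ζ N ^ j) ^ (N ℕ.∸ a) * ((ζ N ^ j) ^ b * η b)    ≈⟨ *-assoc _ _ _ ⟨
        (ζ N ^ j) ^ (N ℕ.∸ a) * (ζ N ^ j) ^ b * η b      ≈⟨ *-congʳ (^-homo-* (ζ N ^ j) (N ℕ.∸ a) b) ⟨
        (ζ N ^ j) ^ e * η b  ≈⟨ *-congʳ (trans (^-assocʳ (ζ N) j e) (trans (reflexive (≡.cong (ζ N ^_) (ℕₚ.*-comm j e))) (sym (^-assocʳ (ζ N) e j)))) ⟩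
        (ζ N ^ e) ^ j * η b  ∎
        where e = N ℕ.∸ a ℕ.+ b

  -- In the inversion formula the trivial character contributes -1, which the added 1 cancels; all
  -- remaining terms are roots of unity times nontrivial Gauss sums.
  Nη+1-divisible : ∀ {t} → CS.DividesGaussSums γ N t → ∀ {a} → a ℕ.< N →
                   ∃[ w ] IsAlgebraicInteger w × ι (+ N) * η a + 1# ≈ ι (+ t) * w
  Nη+1-divisible {t} divides {a} a<N =
      ∑ (N ℕ.∸ 1) (λ j → (ζ N ^ suc j) ^ (N ℕ.∸ a) * w j)
    , integral-∑ (N ℕ.∸ 1) (λ j j<N-1 → integral-* (integral-^ (N ℕ.∸ a) (integral-root N (ℕ.>-nonZero⁻¹ N) (ζ^j^N≈1 (suc j)))) (w-integral j (j<N j<N-1)))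
    , (begin
      ι (+ N) * η a + 1#  ≈⟨ +-congʳ (inversion a<N) ⟨
      ∑ N (λ j → (ζ N ^ j) ^ (N ℕ.∸ a) * Ĝ j) + 1#  ≈⟨ +-congʳ (reflexive (≡.cong (λ n → ∑ n (λ j → (ζ N ^ j) ^ (N ℕ.∸ a) * Ĝ j)) 1+[N∸1]≡N)) ⟨
      (1# ^ (N ℕ.∸ a) * Ĝ 0 + rest) + 1#  ≈⟨ +-congʳ (+-congʳ (trans (*-congʳ (1^n≈1 (N ℕ.∸ a))) (*-identityˡ _))) ⟩
      (Ĝ 0 + rest) + 1#  ≈⟨ +-congʳ (+-congʳ (trans (∑-cong N (λ b _ → trans (*-congʳ (1^n≈1 b)) (*-identityˡ _))) ∑η≈-1)) ⟩
      (- 1# + rest) + 1#  ≈⟨ solve 2 (λ one r → (:- one :+ r) :+ one := r) refl 1# rest ⟩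
      rest  ≈⟨ ∑-cong (N ℕ.∸ 1) (λ j j<N-1 → trans (*-congˡ (w-divides j (j<N j<N-1))) (x∙yz≈y∙xz _ _ _)) ⟩
      ∑ (N ℕ.∸ 1) (λ j → ι (+ t) * ((ζ N ^ suc j) ^ (N ℕ.∸ a) * w j))  ≈⟨ ∑-*ˡ (N ℕ.∸ 1) (ι (+ t)) (λ j → (ζ N ^ suc j) ^ (N ℕ.∸ a) * w j) ⟩
      ι (+ t) * ∑ (N ℕ.∸ 1) (λ j → (ζ N ^ suc j) ^ (N ℕ.∸ a) * w j)    ∎)
    where
    open CommutativeSemigroupProperties *-commutativeSemigroup using (x∙yz≈y∙xz)
    rest = ∑ (N ℕ.∸ 1) (λ j → (ζ N ^ suc j) ^ (N ℕ.∸ a) * Ĝ (suc j))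
    1+[N∸1]≡N : suc (N ℕ.∸ 1) ≡ N
    1+[N∸1]≡N = ℕₚ.suc-pred N
    j<N : ∀ {j} → j ℕ.< N ℕ.∸ 1 → suc j ℕ.< N
    j<N {j} j<N-1 = ≡.subst (suc j ℕ.<_) 1+[N∸1]≡N (s≤s j<N-1)
    quotient : ∀ j → suc j ℕ.< N → ∃[ w ] IsAlgebraicInteger w × Ĝ (suc j) ≈ ι (+ t) * w
    quotient j j<N = G-divisible (ζ^j^N≈1 (suc j)) {t} (λ ζʲ≈1 → #-irrefl ζʲ≈1 (ζ-prim N (suc j) (s≤s z≤n) j<N)) divides
    -- A quotient is known only for suc j < N; the default 0 makes `w` a function on ℕ, as `∑`
    -- requires.
    w : ℕ → Carrier
    w j with suc j ℕₚ.<? N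
    ... | yes j<N = proj₁ (quotient j j<N)
    ... | no  _   = 0#
    w-integral : ∀ j → suc j ℕ.< N → IsAlgebraicInteger (w j)
    w-integral j j<N with suc j ℕₚ.<? N
    ... | yes j<N′ = proj₁ (proj₂ (quotient j j<N′))
    ... | no  j≮N  = contradiction j<N j≮N
    w-divides : ∀ j → suc j ℕ.< N → Ĝ (suc j) ≈ ι (+ t) * w j
    w-divides j j<N with suc j ℕₚ.<? N
    ... | yes j<N′ = proj₂ (proj₂ (quotient j j<N′))
    ... | no  j≮N  = contradiction j<N j≮N

-- Moments of integer sequences of the form t y - e

open RingProperties ℤₚ.+-*-ring using () renaming (+-cancelʳ to ℤ+-cancelʳ)
private module ℤ∑ = RangeSum ℤₚ.+-*-commutativeRing

ιℤ≡ : ∀ n → IntegerScalars.ι ℤₚ.+-*-commutativeRing (+ n) ≡ + n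
ιℤ≡ zero    = ≡.refl
ιℤ≡ (suc n) = ≡.cong (ℤ._+_ (+ 1)) (ιℤ≡ n)

∑ᶻ : ℕ → (ℕ → ℤ) → ℤ
∑ᶻ = ℤ∑.∑

∑ᶻ-const : ∀ n x → ∑ᶻ n (λ _ → x) ≡ + n ℤ.* x
∑ᶻ-const n x = ≡.trans (ℤ∑.∑-const n x) (≡.cong (ℤ._* x) (ιℤ≡ n))

∑ᶻ-affine : ∀ n t e (y : ℕ → ℤ) → ∑ᶻ n (λ a → t ℤ.* y a ℤ.- e) ≡ t ℤ.* ∑ᶻ n y ℤ.- + n ℤ.* e
∑ᶻ-affine n t e y = ≡.trans (ℤ∑.∑-+ n (λ a → t ℤ.* y a) (λ _ → ℤ.- e)) (≡.cong₂ ℤ._+_ (ℤ∑.∑-*ˡ n t y)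
  (≡.trans (∑ᶻ-const n (ℤ.- e)) (≡.sym (ℤₚ.neg-distribʳ-* (+ n) e))))

∑ᶻ-affine² : ∀ n t e (y y′ : ℕ → ℤ) → ∑ᶻ n (λ a → (t ℤ.* y a ℤ.- e) ℤ.* (t ℤ.* y′ a ℤ.- e))
  ≡ t ℤ.* t ℤ.* ∑ᶻ n (λ a → y a ℤ.* y′ a) ℤ.- t ℤ.* e ℤ.* (∑ᶻ n y ℤ.+ ∑ᶻ n y′) ℤ.+ + n ℤ.* (e ℤ.* e)
∑ᶻ-affine² n t e y y′ = begin
  ∑ᶻ n (λ a → (t ℤ.* y a ℤ.- e) ℤ.* (t ℤ.* y′ a ℤ.- e))
    ≡⟨ ℤ∑.∑-cong n (λ a _ → expand t e (y a) (y′ a)) ⟩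
  ∑ᶻ n (λ a → (t ℤ.* t ℤ.* (y a ℤ.* y′ a) ℤ.+ (ℤ.- (t ℤ.* e)) ℤ.* (y a ℤ.+ y′ a)) ℤ.+ e ℤ.* e)
    ≡⟨ ℤ∑.∑-+ n (λ a → t ℤ.* t ℤ.* (y a ℤ.* y′ a) ℤ.+ (ℤ.- (t ℤ.* e)) ℤ.* (y a ℤ.+ y′ a)) (λ _ → e ℤ.* e) ⟩
  ∑ᶻ n (λ a → t ℤ.* t ℤ.* (y a ℤ.* y′ a) ℤ.+ (ℤ.- (t ℤ.* e)) ℤ.* (y a ℤ.+ y′ a)) ℤ.+ ∑ᶻ n (λ _ → e ℤ.* e)
    ≡⟨ ≡.cong₂ ℤ._+_ (≡.trans (ℤ∑.∑-+ n (λ a → t ℤ.* t ℤ.* (y a ℤ.* y′ a)) (λ a → (ℤ.- (t ℤ.* e)) ℤ.* (y a ℤ.+ y′ a)))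
         (≡.cong₂ ℤ._+_ (ℤ∑.∑-*ˡ n (t ℤ.* t) (λ a → y a ℤ.* y′ a))
           (≡.trans (ℤ∑.∑-*ˡ n (ℤ.- (t ℤ.* e)) (λ a → y a ℤ.+ y′ a))
             (≡.trans (≡.cong ((ℤ.- (t ℤ.* e)) ℤ.*_) (ℤ∑.∑-+ n y y′)) (≡.sym (ℤₚ.neg-distribˡ-* (t ℤ.* e) _))))))
         (∑ᶻ-const n (e ℤ.* e)) ⟩
  t ℤ.* t ℤ.* ∑ᶻ n (λ a → y a ℤ.* y′ a) ℤ.- t ℤ.* e ℤ.* (∑ᶻ n y ℤ.+ ∑ᶻ n y′) ℤ.+ + n ℤ.* (e ℤ.* e) ∎
  where
  open ≡.≡-Reasoning
  expand : ∀ t e y y′ → (t ℤ.* y ℤ.- e) ℤ.* (t ℤ.* y′ ℤ.- e)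
    ≡ (t ℤ.* t ℤ.* (y ℤ.* y′) ℤ.+ (ℤ.- (t ℤ.* e)) ℤ.* (y ℤ.+ y′)) ℤ.+ e ℤ.* e
  expand = ℤSolver.solve-∀

private
  -- The second hypothesis is the expansion of a correlation of t y - e with value z. Multiplied by
  -- n it contains e only through n e, which is t d + 1, so e drops out.
  momentIdentity : ∀ t n C d e z → n ℤ.* e ≡ t ℤ.* d ℤ.+ + 1 →
    t ℤ.* t ℤ.* C ℤ.- t ℤ.* e ℤ.* (d ℤ.+ d) ℤ.+ n ℤ.* (e ℤ.* e) ≡ z →
    t ℤ.* t ℤ.* (n ℤ.* C ℤ.- d ℤ.* d) ≡ n ℤ.* z ℤ.- + 1
  momentIdentity t n C d e z ne≡td+1 eq = ≡.sym (begin
    n ℤ.* z ℤ.- + 1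
      ≡⟨ ≡.cong (λ S → n ℤ.* S ℤ.- + 1) eq ⟨
    n ℤ.* (t ℤ.* t ℤ.* C ℤ.- t ℤ.* e ℤ.* (d ℤ.+ d) ℤ.+ n ℤ.* (e ℤ.* e)) ℤ.- + 1
      ≡⟨ ≡.cong (ℤ._- + 1) (distribute n (t ℤ.* t ℤ.* C) (t ℤ.* e ℤ.* (d ℤ.+ d)) (n ℤ.* (e ℤ.* e))) ⟩
    n ℤ.* (t ℤ.* t ℤ.* C) ℤ.- n ℤ.* (t ℤ.* e ℤ.* (d ℤ.+ d)) ℤ.+ n ℤ.* (n ℤ.* (e ℤ.* e)) ℤ.- + 1
      ≡⟨ ≡.cong₂ (λ Y Z → n ℤ.* (t ℤ.* t ℤ.* C) ℤ.- Y ℤ.+ Z ℤ.- + 1) (cross n t e d) (square n e) ⟩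
    n ℤ.* (t ℤ.* t ℤ.* C) ℤ.- (n ℤ.* e) ℤ.* (t ℤ.* d ℤ.+ t ℤ.* d) ℤ.+ (n ℤ.* e) ℤ.* (n ℤ.* e) ℤ.- + 1
      ≡⟨ ≡.cong (λ E → n ℤ.* (t ℤ.* t ℤ.* C) ℤ.- E ℤ.* (t ℤ.* d ℤ.+ t ℤ.* d) ℤ.+ E ℤ.* E ℤ.- + 1) ne≡td+1 ⟩
    n ℤ.* (t ℤ.* t ℤ.* C) ℤ.- (t ℤ.* d ℤ.+ + 1) ℤ.* (t ℤ.* d ℤ.+ t ℤ.* d) ℤ.+ (t ℤ.* d ℤ.+ + 1) ℤ.* (t ℤ.* d ℤ.+ + 1) ℤ.- + 1
      ≡⟨ collect (n ℤ.* (t ℤ.* t ℤ.* C)) (t ℤ.* d) ⟩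
    n ℤ.* (t ℤ.* t ℤ.* C) ℤ.- (t ℤ.* d) ℤ.* (t ℤ.* d)
      ≡⟨ factor t n C d ⟩
    t ℤ.* t ℤ.* (n ℤ.* C ℤ.- d ℤ.* d)  ∎)
    where
    open ≡.≡-Reasoning
    distribute : ∀ n X Y Z → n ℤ.* (X ℤ.- Y ℤ.+ Z) ≡ n ℤ.* X ℤ.- n ℤ.* Y ℤ.+ n ℤ.* Z
    distribute = ℤSolver.solve-∀
    cross : ∀ n t e d → n ℤ.* (t ℤ.* e ℤ.* (d ℤ.+ d)) ≡ (n ℤ.* e) ℤ.* (t ℤ.* d ℤ.+ t ℤ.* d)
    cross = ℤSolver.solve-∀
    square : ∀ n e → n ℤ.* (n ℤ.* (e ℤ.* e)) ≡ (n ℤ.* e) ℤ.* (n ℤ.* e)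
    square = ℤSolver.solve-∀
    collect : ∀ X P → X ℤ.- (P ℤ.+ + 1) ℤ.* (P ℤ.+ P) ℤ.+ (P ℤ.+ + 1) ℤ.* (P ℤ.+ + 1) ℤ.- + 1 ≡ X ℤ.- P ℤ.* P
    collect = ℤSolver.solve-∀
    factor : ∀ t n C d → n ℤ.* (t ℤ.* t ℤ.* C) ℤ.- (t ℤ.* d) ℤ.* (t ℤ.* d) ≡ t ℤ.* t ℤ.* (n ℤ.* C ℤ.- d ℤ.* d)
    factor = ℤSolver.solve-∀

  secondMomentIdentity : ∀ n q k → q ≡ k ℤ.* n ℤ.+ + 1 → n ℤ.* (q ℤ.- k) ℤ.- + 1 ≡ (n ℤ.- + 1) ℤ.* q
  secondMomentIdentity n q k q≡ = ≡.trans (arrange₁ n q k) (≡.trans (≡.cong (ℤ._-_ (n ℤ.* q)) (≡.sym q≡)) (arrange₂ n q))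
    where
    arrange₁ : ∀ n q k → n ℤ.* (q ℤ.- k) ℤ.- + 1 ≡ n ℤ.* q ℤ.- (k ℤ.* n ℤ.+ + 1)
    arrange₁ = ℤSolver.solve-∀
    arrange₂ : ∀ n q → n ℤ.* q ℤ.- q ≡ (n ℤ.- + 1) ℤ.* q
    arrange₂ = ℤSolver.solve-∀

  lagMomentIdentity : ∀ n q k → q ≡ k ℤ.* n ℤ.+ + 1 → n ℤ.* (ℤ.- k) ℤ.- + 1 ≡ ℤ.- q
  lagMomentIdentity n q k q≡ = ≡.trans (arrange n k) (≡.cong ℤ.-_ (≡.sym q≡))
    where
    arrange : ∀ n k → n ℤ.* (ℤ.- k) ℤ.- + 1 ≡ ℤ.- (k ℤ.* n ℤ.+ + 1)
    arrange = ℤSolver.solve-∀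

-- The integers y with η = t y - e

module IntegerPeriods
  {c ℓ₁ ℓ₂ c′ ℓ₁′ ℓ₂′} (K : CharZeroFieldWithRootsOfUnity c ℓ₁ ℓ₂)
  {n₀ : ℕ} {{n₀≢0 : NonZero n₀}} (F : FiniteField c′ ℓ₁′ ℓ₂′ (suc n₀))
  {γ : FiniteField.Carrier F} (γ-primitive : FiniteField.IsPrimitiveElement F γ)
  {p : ℕ} (f : ℕ) (p-prime : Prime p) (order : suc n₀ ≡ p ℕ.^ suc f)
  {N k : ℕ} {{N≢0 : NonZero N}} {{k≢0 : NonZero k}} (n₀≡kN : n₀ ≡ k ℕ.* N) (coprime : Coprime N (p ℕ.∸ 1))
  (κ : ℕ) (divides : CharacterSums.DividesGaussSums K p (suc f) F γ N (p ℕ.^ κ))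
  (d e : ℤ) (Ne≡td+1 : + N ℤ.* e ≡ + (p ℕ.^ κ) ℤ.* d ℤ.+ + 1) where
  private
    module CS = CharacterSums K p (suc f) F
  open CharZeroFieldWithRootsOfUnity K hiding (zero; sum; _^_; _·_)
  open CommutativeRing commutativeRing using (commutativeSemiring)
  open IntegerScalars commutativeRing
  open RangeSum commutativeRing
  open ExpProperties commutativeSemiring
  open HeytingFieldProperties heytingField
  open AlgebraicIntegers K
  open GaussSums K F γ-primitive f p-prime order n₀≡kN coprime public
  open SetoidReasoning setoid

  t : ℕ
  t = p ℕ.^ κ

  instance
    p≢0 : NonZero p
    p≢0 = prime⇒nonZero p-prime
    t≢0 : NonZero t
    t≢0 = ℕₚ.m^n≢0 p κ
    p∸1≢0 : NonZero (p ℕ.∸ 1)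
    p∸1≢0 = ℕ.>-nonZero (ℕₚ.m<n⇒0<n∸m (ℕ.nonTrivial⇒n>1 p {{prime⇒nonTrivial p-prime}}))

  -- The relation t α - m N = 1 is what removes the factor N from N η + 1 = t w in `normalised`.
  t-inverse : ∃[ α ] ∃[ m ] t ℕ.* α ≡ 1 ℕ.+ m ℕ.* N
  t-inverse = go κ
    where
    rearrange₁ : ∀ p P a b → p ℕ.* P ℕ.* (a ℕ.* b) ≡ (p ℕ.* a) ℕ.* (P ℕ.* b)
    rearrange₁ = ℕSolver.solve-∀
    rearrange₂ : ∀ k m N → suc (k ℕ.* N) ℕ.* (1 ℕ.+ m ℕ.* N) ≡ 1 ℕ.+ (m ℕ.+ k ℕ.* (1 ℕ.+ m ℕ.* N)) ℕ.* N
    rearrange₂ = ℕSolver.solve-∀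
    -- p^f inverts p modulo N because p^(f+1) = q ≡ 1.
    go : ∀ i → ∃[ α ] ∃[ m ] p ℕ.^ i ℕ.* α ≡ 1 ℕ.+ m ℕ.* N
    go zero    = 1 , 0 , ≡.refl
    go (suc i) = let α , m , eq = go i in
      p ℕ.^ f ℕ.* α , m ℕ.+ k ℕ.* (1 ℕ.+ m ℕ.* N) , ≡.trans (rearrange₁ p (p ℕ.^ i) (p ℕ.^ f) α)
        (≡.trans (≡.cong₂ ℕ._*_ (≡.trans (≡.sym order) (≡.cong suc n₀≡kN)) eq) (rearrange₂ k m N))

  private
    -- N η + 1 = t w and N e = t d + 1 add up to N (η + e) = t (w + d). With t α = 1 + m N this
    -- becomes η + e = t Y for Y = α (η + e) - m (w + d). Y is integral, and (p - 1) t Y is an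
    -- integer because (p - 1) η is, so Y is an integer.
    normalised : ∀ a → a ℕ.< N → ∃[ z ] η a ≈ ι (+ t ℤ.* z ℤ.- e)
    normalised a a<N =
      let z , Y≈z = Y-integer
      in z , (begin
        η a  ≈⟨ solve 2 (λ h e → h := (h :+ e) :- e) refl (η a) (ι e) ⟩
        (η a + ι e) - ι e  ≈⟨ +-cong (trans (sym tY) (trans (*-congˡ Y≈z) (sym (ι-* (+ t) z)))) (sym (ι-neg e)) ⟩
        ι (+ t ℤ.* z) + ι (ℤ.- e)        ≈⟨ ι-+ (+ t ℤ.* z) (ℤ.- e) ⟨
        ι (+ t ℤ.* z ℤ.- e)              ∎)
      where
      α = proj₁ t-inverse
      m = proj₁ (proj₂ t-inverse)
      w = proj₁ (Nη+1-divisible {t} divides a<N)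
      T = ι (+ t) ; A = ι (+ α) ; M = ι (+ m) ; n = ι (+ N) ; E = ι e ; D = ι d
      Y = A * (η a + E) + (- M) * (w + D)
      Y-integral : IsAlgebraicInteger Y
      Y-integral = integral-+ (integral-* (integral-ι (+ α)) (integral-+ (η-integral a) (integral-ι e)))
        (integral-* (integral-resp (ι-neg (+ m)) (integral-ι (ℤ.- + m)))
                    (integral-+ (proj₁ (proj₂ (Nη+1-divisible {t} divides a<N))) (integral-ι d)))
      TA≈ : T * A ≈ ι (+ 1) + M * n
      TA≈ = begin
        T * A  ≈⟨ ι-* (+ t) (+ α) ⟨
        ι (+ t ℤ.* + α)  ≡⟨ ≡.cong ι (≡.trans (≡.sym (ℤₚ.pos-* t α)) (≡.cong +_ (proj₂ (proj₂ t-inverse)))) ⟩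
        ι (+ 1 ℤ.+ + (m ℕ.* N))              ≡⟨ ≡.cong (λ i → ι (+ 1 ℤ.+ i)) (ℤₚ.pos-* m N) ⟩
        ι (+ 1 ℤ.+ + m ℤ.* + N)              ≈⟨ trans (ι-+ (+ 1) (+ m ℤ.* + N)) (+-congˡ (ι-* (+ m) (+ N))) ⟩
        ι (+ 1) + M * n  ∎
      Tw≈ : T * w ≈ n * η a + ι (+ 1)
      Tw≈ = trans (sym (proj₂ (proj₂ (Nη+1-divisible {t} divides a<N)))) (+-congˡ (sym ι-1))
      nE≈ : n * E ≈ T * D + ι (+ 1)
      nE≈ = begin
        n * E  ≈⟨ ι-* (+ N) e ⟨
        ι (+ N ℤ.* e)              ≡⟨ ≡.cong ι Ne≡td+1 ⟩
        ι (+ t ℤ.* d ℤ.+ + 1)      ≈⟨ trans (ι-+ (+ t ℤ.* d) (+ 1)) (+-congʳ (ι-* (+ t) d)) ⟩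
        T * D + ι (+ 1)            ∎
      tY : T * Y ≈ η a + E
      tY = begin
        T * Y
          ≈⟨ solve 7 (λ T A M h E w D → T :* (A :* (h :+ E) :+ (:- M) :* (w :+ D)) := T :* A :* (h :+ E) :- M :* (T :* w :+ T :* D)) refl T A M (η a) E w D ⟩
        T * A * (η a + E) - M * (T * w + T * D)
          ≈⟨ +-cong (*-congʳ TA≈) (-‿cong (*-congˡ (+-congʳ Tw≈))) ⟩
        (ι (+ 1) + M * n) * (η a + E) - M * ((n * η a + ι (+ 1)) + T * D)
          ≈⟨ solve 6 (λ M n h E T D → (con (+ 1) :+ M :* n) :* (h :+ E) :- M :* ((n :* h :+ con (+ 1)) :+ T :* D)
                        := (h :+ E) :+ M :* (n :* E :- (T :* D :+ con (+ 1)))) refl M n (η a) E T D ⟩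
        (η a + E) + M * (n * E - (T * D + ι (+ 1)))
          ≈⟨ +-congˡ (trans (*-congˡ (trans (+-congʳ nE≈) (-‿inverseʳ _))) (zeroʳ M)) ⟩
        (η a + E) + 0#
          ≈⟨ +-identityʳ _ ⟩
        η a + E  ∎
      Y-integer : ∃[ z ] Y ≈ ι z
      Y-integer =
        let z , eq = [p-1]η-integer a
        in rationalIntegral⇒integer ((p ℕ.∸ 1) ℕ.* t) {{ℕₚ.m*n≢0 (p ℕ.∸ 1) t}} (z ℤ.+ + (p ℕ.∸ 1) ℤ.* e) Y-integral (begin
          ι (+ ((p ℕ.∸ 1) ℕ.* t)) * Y  ≈⟨ *-congʳ (trans (reflexive (≡.cong ι (ℤₚ.pos-* (p ℕ.∸ 1) t))) (ι-* (+ (p ℕ.∸ 1)) (+ t))) ⟩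
          ι (+ (p ℕ.∸ 1)) * T * Y  ≈⟨ trans (*-assoc _ _ _) (*-congˡ tY) ⟩
          ι (+ (p ℕ.∸ 1)) * (η a + E)  ≈⟨ distribˡ _ _ _ ⟩
          ι (+ (p ℕ.∸ 1)) * η a + ι (+ (p ℕ.∸ 1)) * E   ≈⟨ +-cong eq (sym (ι-* (+ (p ℕ.∸ 1)) e)) ⟩
          ι z + ι (+ (p ℕ.∸ 1) ℤ.* e)  ≈⟨ ι-+ z (+ (p ℕ.∸ 1) ℤ.* e) ⟨
          ι (z ℤ.+ + (p ℕ.∸ 1) ℤ.* e)  ∎)

  y : ℕ → ℤ
  y a = proj₁ (normalised (a % N) (m%n<n a N))

  η-y : ∀ a → η a ≈ ι (+ t ℤ.* y a ℤ.- e)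
  η-y a = trans (periodic-% N η-periodic a) (proj₂ (normalised (a % N) (m%n<n a N)))

  η≈⇒y≡ : ∀ a b → η a ≈ η b → y a ≡ y b
  η≈⇒y≡ a b eq = ℤₚ.*-cancelˡ-≡ (+ t) (y a) (y b) (ℤ+-cancelʳ (ℤ.- e) (+ t ℤ.* y a) (+ t ℤ.* y b)
    (ι-injective (trans (sym (η-y a)) (trans eq (η-y b)))))

  y-periodic : ∀ a → y (N ℕ.+ a) ≡ y a
  y-periodic a = η≈⇒y≡ (N ℕ.+ a) a (η-periodic a)

  y-frobenius : ∀ a → y (p ℕ.* a) ≡ y a
  y-frobenius a = η≈⇒y≡ (p ℕ.* a) a (η-frobenius a)

  private
    ι-∑ : ∀ n (h : ℕ → ℤ) → ι (∑ᶻ n h) ≈ ∑ n (λ a → ι (h a))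
    ι-∑ zero    h = refl
    ι-∑ (suc n) h = trans (ι-+ (h 0) (∑ᶻ n (h ∘ suc))) (+-congˡ (ι-∑ n (h ∘ suc)))

    T = + t

    restore : ∀ t S n e → t ℤ.* S ≡ (t ℤ.* S ℤ.- n ℤ.* e) ℤ.+ n ℤ.* e
    restore = ℤSolver.solve-∀

  ∑y≡d : ∑ᶻ N y ≡ d
  ∑y≡d = ℤₚ.*-cancelˡ-≡ T (∑ᶻ N y) d (E.begin
    T ℤ.* ∑ᶻ N y  E.≡⟨ restore T (∑ᶻ N y) (+ N) e ⟩
    (T ℤ.* ∑ᶻ N y ℤ.- + N ℤ.* e) ℤ.+ + N ℤ.* e            E.≡⟨ ≡.cong₂ ℤ._+_ (≡.trans (≡.sym (∑ᶻ-affine N T e y)) sum≡-1) Ne≡td+1 ⟩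
    (ℤ.- + 1) ℤ.+ (T ℤ.* d ℤ.+ + 1)  E.≡⟨ cancel (T ℤ.* d) ⟩
    T ℤ.* d  E.∎)
    where
    module E = ≡.≡-Reasoning
    cancel : ∀ x → (ℤ.- + 1) ℤ.+ (x ℤ.+ + 1) ≡ x
    cancel = ℤSolver.solve-∀
    sum≡-1 : ∑ᶻ N (λ a → T ℤ.* y a ℤ.- e) ≡ ℤ.- + 1
    sum≡-1 = ι-injective (begin
      ι (∑ᶻ N (λ a → T ℤ.* y a ℤ.- e))      ≈⟨ ι-∑ N (λ a → T ℤ.* y a ℤ.- e) ⟩
      ∑ N (λ a → ι (T ℤ.* y a ℤ.- e))       ≈⟨ ∑-cong N (λ a _ → η-y a) ⟨
      ∑ N η  ≈⟨ ∑η≈-1 ⟩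
      - 1#  ≈⟨ trans (ι-neg (+ 1)) (-‿cong ι-1) ⟨
      ι (ℤ.- + 1)  ∎)

  private
    ∑y-shift : ∀ b → ∑ᶻ N (λ a → y (a ℕ.+ b)) ≡ d
    ∑y-shift b = ≡.trans (ℤ∑.∑-cong N {λ a → y (a ℕ.+ b)} {λ a → y (b ℕ.+ a)} (λ a _ → ≡.cong y (ℕₚ.+-comm a b)))
      (≡.trans (ℤ∑.∑-shift N {y} y-periodic b) ∑y≡d)

    products : ∀ b z → ∑ N (λ a → η a * η (a ℕ.+ b)) ≈ ι z → ∑ᶻ N (λ a → (T ℤ.* y a ℤ.- e) ℤ.* (T ℤ.* y (a ℕ.+ b) ℤ.- e)) ≡ z
    products b z eq = ι-injective (trans (ι-∑ N (λ a → (T ℤ.* y a ℤ.- e) ℤ.* (T ℤ.* y (a ℕ.+ b) ℤ.- e)))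
      (trans (∑-cong N (λ a _ → trans (ι-* (T ℤ.* y a ℤ.- e) (T ℤ.* y (a ℕ.+ b) ℤ.- e)) (sym (*-cong (η-y a) (η-y (a ℕ.+ b)))))) eq))

    moment : ∀ b z → ∑ N (λ a → η a * η (a ℕ.+ b)) ≈ ι z →
             T ℤ.* T ℤ.* (+ N ℤ.* ∑ᶻ N (λ a → y a ℤ.* y (a ℕ.+ b)) ℤ.- d ℤ.* d) ≡ + N ℤ.* z ℤ.- + 1
    moment b z eq = momentIdentity T (+ N) C d e z Ne≡td+1
      (≡.trans (≡.cong₂ (λ S S′ → T ℤ.* T ℤ.* C ℤ.- T ℤ.* e ℤ.* (S ℤ.+ S′) ℤ.+ + N ℤ.* (e ℤ.* e)) (≡.sym ∑y≡d) (≡.sym (∑y-shift b)))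
        (≡.trans (≡.sym (∑ᶻ-affine² N T e y (λ a → y (a ℕ.+ b)))) (products b z eq)))
      where
      C = ∑ᶻ N (λ a → y a ℤ.* y (a ℕ.+ b))

  q = + suc n₀

  private
    q≡kN+1 : q ≡ + k ℤ.* + N ℤ.+ + 1
    q≡kN+1 = ≡.trans (≡.cong +_ (≡.trans (≡.cong suc n₀≡kN) (ℕₚ.+-comm 1 (k ℕ.* N)))) (≡.cong (ℤ._+ + 1) (ℤₚ.pos-* k N))

  -- From Σ η² = q - k and q = k N + 1. The right-hand side is the first term of hypothesis (ii),
  -- which therefore determines Σ y².
  secondMoment : T ℤ.* T ℤ.* (+ N ℤ.* ∑ᶻ N (λ a → y a ℤ.* y a) ℤ.- d ℤ.* d) ≡ (+ N ℤ.- + 1) ℤ.* q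
  secondMoment = ≡.trans
    (≡.cong (λ S → T ℤ.* T ℤ.* (+ N ℤ.* S ℤ.- d ℤ.* d)) (ℤ∑.∑-cong N {λ a → y a ℤ.* y a} {λ a → y a ℤ.* y (a ℕ.+ 0)}
      (λ a _ → ≡.cong (λ b → y a ℤ.* y b) (≡.sym (ℕₚ.+-identityʳ a)))))
    (≡.trans (moment 0 (q ℤ.- + k) ∑η²) (secondMomentIdentity (+ N) q (+ k) q≡kN+1))
    where
    ∑η² : ∑ N (λ a → η a * η (a ℕ.+ 0)) ≈ ι (q ℤ.- + k)
    ∑η² = trans (∑-cong N (λ a _ → *-congˡ (reflexive (≡.cong η (ℕₚ.+-identityʳ a)))))
      (trans correlation-0 (sym (trans (ι-+ q (ℤ.- + k)) (+-congˡ (ι-neg (+ k))))))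

  -- A nonzero lag leaves -q alone on the right. The left side is quadratic in y, since d = Σ y, so
  -- a common divisor of all y_a divides q.
  lagMoment : 1 ℕ.< N → T ℤ.* T ℤ.* (+ N ℤ.* ∑ᶻ N (λ a → y a ℤ.* y (a ℕ.+ 1)) ℤ.- d ℤ.* d) ≡ ℤ.- q
  lagMoment 1<N = ≡.trans (moment 1 (ℤ.- + k) (trans (correlation-≢0 1 (s≤s z≤n) 1<N) (sym (ι-neg (+ k)))))
    (lagMomentIdentity (+ N) q (+ k) q≡kN+1)

  -- The constant e sums to zero against a nontrivial character, so the Gauss sum is t Σ χ(γ)^a y_a,
  -- and a factor p of all y_a can be moved in front.
  p∣y⇒divides : (∀ a → + p ℤ∣.∣ y a) → CS.DividesGaussSums γ N (p ℕ.^ suc κ)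
  p∣y⇒divides p∣y X nontrivial trivial = w , w-integral , (begin
    CS.G X  ≈⟨ G≈ trivial ⟩
    ∑ N (λ a → ω ^ a * η a)  ≈⟨ ∑-cong N (λ a _ → trans (*-congˡ (η-z a)) (solve 4 (λ o P Z E → o :* (P :* Z :- E) := P :* (o :* Z) :+ (:- E) :* o) refl (ω ^ a) P (ι (z a)) (ι e))) ⟩
    ∑ N (λ a → P * (ω ^ a * ι (z a)) + (- ι e) * ω ^ a)          ≈⟨ ∑-+ N (λ a → P * (ω ^ a * ι (z a))) (λ a → (- ι e) * ω ^ a) ⟩
    ∑ N (λ a → P * (ω ^ a * ι (z a))) + ∑ N (λ a → (- ι e) * ω ^ a)
      ≈⟨ +-cong (∑-*ˡ N P (λ a → ω ^ a * ι (z a))) (trans (∑-*ˡ N (- ι e) (ω ^_)) (trans (*-congˡ (geometricSum N (χγ^N≈1 trivial) (nontrivial ∘ χγ≈1⇒trivial))) (zeroʳ _))) ⟩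
    P * w + 0#  ≈⟨ +-identityʳ _ ⟩
    P * w  ∎)
    where
    open Character X
    ω = CS.MultiplicativeCharacter.χ X γ
    P = ι (+ (p ℕ.^ suc κ))
    z : ℕ → ℤ
    z a = ℤ∣.quotient (p∣y a)
    w = ∑ N (λ a → ω ^ a * ι (z a))
    w-integral : IsAlgebraicInteger w
    w-integral = integral-∑ N (λ a _ → integral-* (integral-^ a (integral-root N (ℕ.>-nonZero⁻¹ N) (χγ^N≈1 trivial))) (integral-ι (z a)))
    η-z : ∀ a → η a ≈ P * ι (z a) - ι e
    η-z a = begin
      η a  ≈⟨ η-y a ⟩
      ι (T ℤ.* y a ℤ.- e)  ≡⟨ ≡.cong (λ i → ι (i ℤ.- e)) (≡.trans (≡.cong (T ℤ.*_) (ℤ∣._∣_.equality (p∣y a)))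
                                                  (≡.trans (arrange T (z a) (+ p)) (≡.cong (ℤ._* z a) (≡.sym (ℤₚ.pos-* p t))))) ⟩
      ι (+ (p ℕ.^ suc κ) ℤ.* z a ℤ.- e)      ≈⟨ trans (ι-+ (+ (p ℕ.^ suc κ) ℤ.* z a) (ℤ.- e)) (+-cong (ι-* (+ (p ℕ.^ suc κ)) (z a)) (ι-neg e)) ⟩
      P * ι (z a) - ι e  ∎
      where
      arrange : ∀ t z p → t ℤ.* (z ℤ.* p) ≡ p ℤ.* t ℤ.* z
      arrange = ℤSolver.solve-∀

-- Multiplicative orders and orbits of multiplication by p modulo N

leastWitness : ∀ {P : ℕ → Set} → Decidable₁ P → ∀ k → P k → ∃[ n ] P n × n ℕ.≤ k × (∀ j → P j → n ℕ.≤ j)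
leastWitness {P} P? = <-rec _ step
  where
  step : ∀ k → (∀ {j} → j ℕ.< k → P j → ∃[ n ] P n × n ℕ.≤ j × (∀ i → P i → n ℕ.≤ i)) →
         P k → ∃[ n ] P n × n ℕ.≤ k × (∀ i → P i → n ℕ.≤ i)
  step k rec Pk with ℕₚ.anyUpTo? P? k
  ... | yes (j , j<k , Pj) = let n , Pn , n≤j , least = rec j<k Pj in n , Pn , ℕₚ.≤-trans n≤j (ℕₚ.<⇒≤ j<k) , least
  ... | no  none           = k , Pk , ℕₚ.≤-refl , λ j Pj → ℕₚ.≮⇒≥ λ j<k → none (j , j<k , Pj)

-- For x = suc x′ both divisibilities unfold to n ∣ x′, so truncated subtraction can replace the
-- integer congruence.
∣∸⇒≡1 : ∀ {n x} → 1 ℕ.≤ x → n ∣ℕ x ℕ.∸ 1 → + x ≡ + 1 [mod n ]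
∣∸⇒≡1 {x = suc x} _ n∣ = n∣

≡1⇒∣∸ : ∀ {n x} → 1 ℕ.≤ x → + x ≡ + 1 [mod n ] → n ∣ℕ x ℕ.∸ 1
≡1⇒∣∸ {x = suc x} _ n∣ = n∣

%≡⇒∣∸ : ∀ n → .{{_ : NonZero n}} → ∀ i j → i % n ≡ j % n → n ∣ℕ j ℕ.∸ i
%≡⇒∣∸ n i j eq = ℕ∣.divides (j / n ℕ.∸ i / n) (begin
  j ℕ.∸ i  ≡⟨ ≡.cong₂ ℕ._∸_ (m≡m%n+[m/n]*n j n) (m≡m%n+[m/n]*n i n) ⟩
  (j % n ℕ.+ j / n ℕ.* n) ℕ.∸ (i % n ℕ.+ i / n ℕ.* n)      ≡⟨ ≡.cong (λ r → (r ℕ.+ j / n ℕ.* n) ℕ.∸ (i % n ℕ.+ i / n ℕ.* n)) (≡.sym eq) ⟩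
  (i % n ℕ.+ j / n ℕ.* n) ℕ.∸ (i % n ℕ.+ i / n ℕ.* n)      ≡⟨ ℕₚ.[m+n]∸[m+o]≡n∸o (i % n) _ _ ⟩
  j / n ℕ.* n ℕ.∸ i / n ℕ.* n  ≡⟨ ℕₚ.*-distribʳ-∸ n (j / n) (i / n) ⟨
  (j / n ℕ.∸ i / n) ℕ.* n  ∎)
  where open ≡.≡-Reasoning

module Orders {p N m : ℕ} {{_ : NonZero p}} {{_ : NonZero N}}
  (coprime : Coprime N p) (m-gcd : IsGCDOf (OrderModDivisor p N) m) (2≤m : 2 ℕ.≤ m) where

  private
    1≤p^ : ∀ k → 1 ℕ.≤ p ℕ.^ k
    1≤p^ k = ℕₚ.m^n>0 p k

  -- The least positive exponent k with n ∣ p^k - 1 is ord_n(p), which is a multiple of m and at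
  -- most δ.
  order≥m : ∀ {n} → 1 ℕ.< n → n ∣ℕ N → ∀ δ → 1 ℕ.≤ δ → n ∣ℕ p ℕ.^ δ ℕ.∸ 1 → m ℕ.≤ δ
  order≥m {n} 1<n n∣N δ 1≤δ n∣ =
    let k , (1≤k , n∣p^k∸1) , k≤δ , least = leastWitness (λ j → 1 ℕₚ.≤? j ×-dec n ℕ∣.∣? (p ℕ.^ j ℕ.∸ 1)) δ (1≤δ , n∣)
        m∣k = proj₁ m-gcd k (n , 1<n , n∣N , 1≤k , ∣∸⇒≡1 (1≤p^ k) n∣p^k∸1 , λ j 1≤j eq → least j (1≤j , ≡1⇒∣∸ (1≤p^ j) eq))
    in ℕₚ.≤-trans (ℕ∣.∣⇒≤ {{ℕ.>-nonZero 1≤k}} m∣k) k≤δ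

  -- A common divisor greater than 1 would be a modulus n with ord_n(p) = 1, which is less than m.
  coprime-p∸1 : Coprime N (p ℕ.∸ 1)
  coprime-p∸1 {d} (d∣N , d∣p∸1) with d ℕₚ.≟ 1
  ... | yes d≡1 = d≡1
  ... | no  d≢1 = contradiction (order≥m 1<d d∣N 1 ℕₚ.≤-refl (≡.subst (λ x → d ∣ℕ x ℕ.∸ 1) (≡.sym (ℕₚ.^-identityʳ p)) d∣p∸1)) (ℕₚ.<⇒≱ 2≤m)
    where
    1<d : 1 ℕ.< d
    1<d = ℕₚ.≤∧≢⇒< (ℕₚ.n≢0⇒n>0 λ { ≡.refl → ℕ.≢-nonZero⁻¹ N (ℕ∣.0∣⇒≡0 d∣N) }) (d≢1 ∘ ≡.sym)

  -- A collision gives N ∣ (p^(j-i) - 1) a. As 0 < a < N, the gcd of N and p^(j-i) - 1 exceeds 1,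
  -- and modulo this gcd the order of p is at most j - i < m.
  orbit-injective : ∀ {a} → 0 ℕ.< a → a ℕ.< N → ∀ {i j} → i ℕ.< j → j ℕ.< m → (p ℕ.^ i ℕ.* a) % N ≢ (p ℕ.^ j ℕ.* a) % N
  orbit-injective {a} 0<a a<N {i} {j} i<j j<m eq = ℕₚ.<⇒≱ (ℕₚ.≤-<-trans (ℕₚ.m∸n≤m j i) j<m)
    (order≥m 1<g (gcd[m,n]∣m N x) (j ℕ.∸ i) (ℕₚ.m<n⇒0<n∸m i<j) (gcd[m,n]∣n N x))
    where
    open ≡.≡-Reasoning
    x = p ℕ.^ (j ℕ.∸ i) ℕ.∸ 1
    difference : p ℕ.^ j ℕ.* a ℕ.∸ p ℕ.^ i ℕ.* a ≡ p ℕ.^ i ℕ.* (x ℕ.* a)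
    difference = begin
      p ℕ.^ j ℕ.* a ℕ.∸ p ℕ.^ i ℕ.* a  ≡⟨ ℕₚ.*-distribʳ-∸ a (p ℕ.^ j) (p ℕ.^ i) ⟨
      (p ℕ.^ j ℕ.∸ p ℕ.^ i) ℕ.* a  ≡⟨ ≡.cong (λ e → (p ℕ.^ e ℕ.∸ p ℕ.^ i) ℕ.* a) (ℕₚ.m+[n∸m]≡n (ℕₚ.<⇒≤ i<j)) ⟨
      (p ℕ.^ (i ℕ.+ (j ℕ.∸ i)) ℕ.∸ p ℕ.^ i) ℕ.* a  ≡⟨ ≡.cong₂ (λ b c → (b ℕ.∸ c) ℕ.* a) (ℕₚ.^-distribˡ-+-* p i (j ℕ.∸ i)) (≡.sym (ℕₚ.*-identityʳ (p ℕ.^ i))) ⟩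
      (p ℕ.^ i ℕ.* p ℕ.^ (j ℕ.∸ i) ℕ.∸ p ℕ.^ i ℕ.* 1) ℕ.* a      ≡⟨ ≡.cong (ℕ._* a) (ℕₚ.*-distribˡ-∸ (p ℕ.^ i) (p ℕ.^ (j ℕ.∸ i)) 1) ⟨
      p ℕ.^ i ℕ.* x ℕ.* a  ≡⟨ ℕₚ.*-assoc (p ℕ.^ i) x a ⟩
      p ℕ.^ i ℕ.* (x ℕ.* a)  ∎
    cancel : ∀ i {z} → N ∣ℕ p ℕ.^ i ℕ.* z → N ∣ℕ z
    cancel zero    {z} N∣ = ≡.subst (N ∣ℕ_) (ℕₚ.*-identityˡ z) N∣
    cancel (suc i) {z} N∣ = cancel i (coprime-divisor coprime (≡.subst (N ∣ℕ_) (ℕₚ.*-assoc p (p ℕ.^ i) z) N∣))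
    N∣xa : N ∣ℕ x ℕ.* a
    N∣xa = cancel i (≡.subst (N ∣ℕ_) difference (%≡⇒∣∸ N _ _ eq))
    1<g : 1 ℕ.< gcd N x
    1<g = ℕₚ.≤∧≢⇒< (ℕₚ.n≢0⇒n>0 λ g≡0 → ℕ.≢-nonZero⁻¹ N (ℕ∣.0∣⇒≡0 (≡.subst (_∣ℕ N) g≡0 (gcd[m,n]∣m N x))))
      λ 1≡g → ℕₚ.<⇒≱ a<N (ℕ∣.∣⇒≤ {{ℕ.>-nonZero 0<a}} (coprime-divisor (Coprimality.gcd≡1⇒coprime (≡.sym 1≡g)) N∣xa))

-- Integer sequences with small Σ y (y + 1)

∑ᶻ-nonneg : ∀ n {u} → (∀ i → i ℕ.< n → + 0 ℤ.≤ u i) → + 0 ℤ.≤ ∑ᶻ n u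
∑ᶻ-nonneg zero    u≥0 = ℤₚ.≤-refl
∑ᶻ-nonneg (suc n) u≥0 = ℤₚ.+-mono-≤ (u≥0 0 (s≤s z≤n)) (∑ᶻ-nonneg n (λ i i<n → u≥0 (suc i) (s≤s i<n)))

∑ᶻ-vanish : ∀ n {u} → (∀ i → i ℕ.< n → + 0 ℤ.≤ u i) → ∑ᶻ n u ℤ.≤ + 0 → ∀ i → i ℕ.< n → u i ≡ + 0
∑ᶻ-vanish (suc n) {u} u≥0 S≤0 zero    _ = ℤₚ.≤-antisym
  (ℤₚ.≤-trans (ℤₚ.≤-trans (ℤₚ.≤-reflexive (≡.sym (ℤₚ.+-identityʳ (u 0)))) (ℤₚ.+-monoʳ-≤ (u 0) (∑ᶻ-nonneg n (λ i i<n → u≥0 (suc i) (s≤s i<n))))) S≤0)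
  (u≥0 0 (s≤s z≤n))
∑ᶻ-vanish (suc n) {u} u≥0 S≤0 (suc i) (s≤s i<n) = ∑ᶻ-vanish n (λ i i<n → u≥0 (suc i) (s≤s i<n))
  (ℤₚ.≤-trans (ℤₚ.≤-trans (ℤₚ.≤-reflexive (≡.sym (ℤₚ.+-identityˡ _))) (ℤₚ.+-monoˡ-≤ _ (u≥0 0 (s≤s z≤n)))) S≤0) i i<n

∑ᶻ-∣ : ∀ n {c u} → (∀ i → c ℤ∣.∣ u i) → c ℤ∣.∣ ∑ᶻ n u
∑ᶻ-∣ zero    {c} c∣u = ℤ∣.divides (+ 0) ≡.refl
∑ᶻ-∣ (suc n) c∣u = ℤ∣.∣m∣n⇒∣m+n (c∣u 0) (∑ᶻ-∣ n (λ i → c∣u (suc i)))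

-- The n with z ∈ {n, -n-1}, so that z (z+1) = n (n+1).
level : ℤ → ℕ
level (+ n)    = n
level -[1+ n ] = n

pronic : ∀ z → z ℤ.* (z ℤ.+ + 1) ≡ + (level z ℕ.* suc (level z))
pronic (+ n)    = ≡.trans (≡.cong (λ l → + n ℤ.* + l) (ℕₚ.+-comm n 1)) (≡.sym (ℤₚ.pos-* n (suc n)))
pronic -[1+ n ] = ≡.trans (flip (+ n)) (≡.sym (ℤₚ.pos-* n (suc n)))
  where
  flip : ∀ n → (ℤ.- (+ 1 ℤ.+ n)) ℤ.* ((ℤ.- (+ 1 ℤ.+ n)) ℤ.+ + 1) ≡ n ℤ.* (+ 1 ℤ.+ n)
  flip = ℤSolver.solve-∀

level≡0 : ∀ z → level z ≡ 0 → z ≡ + 0 ⊎ z ≡ ℤ.- + 1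
level≡0 (+ zero)    _ = inj₁ ≡.refl
level≡0 -[1+ zero ] _ = inj₂ ≡.refl

pronic≡0 : ∀ z → z ℤ.* (z ℤ.+ + 1) ≡ + 0 → level z ≡ 0
pronic≡0 z eq with level z in l≡ | ≡.trans (≡.sym (pronic z)) eq
... | zero  | _ = ≡.refl
... | suc n | ()

ThreeValued : ℕ → (ℕ → ℤ) → Set
ThreeValued N y = ∃ λ (w : Fin 3 → ℤ) →
    (∀ i j → i ≢ j → w i ≢ w j)
  × (∀ i → ∃[ a ] a ℕ.< N × y a ≡ w i)
  × (∀ a → a ℕ.< N → ∃[ i ] y a ≡ w i)

ThreeValued-neg : ∀ {N y} → ThreeValued N (λ a → ℤ.- y a) → ThreeValued N y
ThreeValued-neg {y = y} (w , distinct , attained , exhaustive) =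
    (λ i → ℤ.- w i)
  , (λ i j i≢j eq → distinct i j i≢j (ℤₚ.neg-injective eq))
  , (λ i → let a , a<N , eq = attained i in a , a<N , ≡.trans (≡.sym (ℤₚ.neg-involutive (y a))) (≡.cong ℤ.-_ eq))
  , (λ a a<N → let i , eq = exhaustive a a<N in i , ≡.trans (≡.sym (ℤₚ.neg-involutive (y a))) (≡.cong ℤ.-_ eq))

indicator : ∀ {P : Set} → Dec P → ℤ
indicator P? = if does P? then + 1 else + 0

indicator-yes : ∀ {P : Set} (P? : Dec P) → P → indicator P? ≡ + 1
indicator-yes P? P-true = ≡.cong (if_then + 1 else + 0) (dec-true P? P-true)

indicator-no : ∀ {P : Set} (P? : Dec P) → ¬ P → indicator P? ≡ + 0
indicator-no P? P-false = ≡.cong (if_then + 1 else + 0) (dec-false P? P-false)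

module Multiplicity (m : ℕ) (orbit : ℕ → ℕ) (injective : ∀ {i j} → i ℕ.< m → j ℕ.< m → orbit i ≡ orbit j → i ≡ j) where

  -- The indicator function of the orbit, written as a sum over the orbit so that its total is found
  -- by exchanging sums; injectivity keeps its values in {0, 1}.
  multiplicity : ℕ → ℤ
  multiplicity b = ∑ᶻ m (λ i → indicator (orbit i ℕₚ.≟ b))

  multiplicity-cases : ∀ b → (multiplicity b ≡ + 1 × ∃[ i ] i ℕ.< m × orbit i ≡ b)
                           ⊎ (multiplicity b ≡ + 0 × (∀ i → i ℕ.< m → orbit i ≢ b))
  multiplicity-cases b with ℕₚ.anyUpTo? (λ i → orbit i ℕₚ.≟ b) m
  ... | yes (i , i<m , eq) = inj₁ (≡.trans (ℤ∑.∑-single m i i<m λ j j<m j≢i → indicator-no (orbit j ℕₚ.≟ b)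
          (λ eq′ → j≢i (injective j<m i<m (≡.trans eq′ (≡.sym eq))))) (indicator-yes (orbit i ℕₚ.≟ b) eq) , i , i<m , eq)
  ... | no  none           = inj₂ (ℤ∑.∑-0 m (λ i i<m → indicator-no (orbit i ℕₚ.≟ b) (λ eq → none (i , i<m , eq)))
          , λ i i<m eq → none (i , i<m , eq))

  ∑-multiplicity : ∀ N → (∀ i → i ℕ.< m → orbit i ℕ.< N) → ∑ᶻ N multiplicity ≡ + m
  ∑-multiplicity N orbit<N = begin
    ∑ᶻ N multiplicity  ≡⟨ ℤ∑.∑-swap N m (λ b i → indicator (orbit i ℕₚ.≟ b)) ⟩
    ∑ᶻ m (λ i → ∑ᶻ N (λ b → indicator (orbit i ℕₚ.≟ b)))       ≡⟨ ℤ∑.∑-cong m (λ i i<m → ≡.trans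
                                                                    (ℤ∑.∑-single N (orbit i) (orbit<N i i<m) (λ b _ b≢ → indicator-no (orbit i ℕₚ.≟ b) (b≢ ∘ ≡.sym)))
                                                                    (indicator-yes (orbit i ℕₚ.≟ orbit i) ≡.refl)) ⟩
    ∑ᶻ m (λ _ → + 1)  ≡⟨ ≡.trans (∑ᶻ-const m (+ 1)) (ℤₚ.*-identityʳ (+ m)) ⟩
    + m  ∎
    where open ≡.≡-Reasoning

-- The values outside {0, -1} all equal c, and are taken on a set of size μ with indicator function mult.
record Profile (N m : ℕ) (y : ℕ → ℤ) (A : ℤ) : Set where
  field
    c          : ℤ
    μ          : ℕ
    mult       : ℕ → ℤ
    μ-cases    : μ ≡ 1 ⊎ μ ≡ m
    weight     : + μ ℤ.* (c ℤ.* (c ℤ.+ + 1)) ≡ A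
    total      : ∑ᶻ N mult ≡ + μ
    cases      : ∀ a → a ℕ.< N → (mult a ≡ + 1 × y a ≡ c) ⊎ (mult a ≡ + 0 × (y a ≡ + 0 ⊎ y a ≡ ℤ.- + 1))
    attained   : ∃[ a ] a ℕ.< N × y a ≡ c

module ProfileOfPeriods {N m p : ℕ} {{N≢0 : NonZero N}} {y : ℕ → ℤ} {A : ℤ}
  (y-periodic : ∀ a → y (N ℕ.+ a) ≡ y a) (y-frobenius : ∀ a → y (p ℕ.* a) ≡ y a)
  (orbit-injective : ∀ {a} → 0 ℕ.< a → a ℕ.< N → ∀ {i j} → i ℕ.< j → j ℕ.< m → (p ℕ.^ i ℕ.* a) % N ≢ (p ℕ.^ j ℕ.* a) % N)
  (0<m : 0 ℕ.< m) (A≡ : ∑ᶻ N (λ a → y a ℤ.* (y a ℤ.+ + 1)) ≡ A) (A≤2m : A ℤ.≤ + 2 ℤ.* + m) where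

  private
    -- `excess` is y (y + 1) minus twice the indicator of the orbit of a. It is nonnegative because
    -- y (y + 1) ≥ 2 on the orbit, and it sums to A - 2m ≤ 0. Hence it vanishes: A = 2m, with y (y +
    -- 1) = 2 on the orbit and 0 elsewhere.
    orbitProfile : ∀ {a} → 0 ℕ.< a → a ℕ.< N → level (y a) ≢ 0 → Profile N m y A
    orbitProfile {a} 0<a a<N l≢0 = record
      { c = y a ; μ = m ; mult = multiplicity ; μ-cases = inj₂ ≡.refl
      ; weight   = ≡.trans (≡.cong (ℤ._*_ (+ m)) c≡2) (≡.trans (ℤₚ.*-comm (+ m) (+ 2)) (≡.sym A≡2m))
      ; total    = ∑-multiplicity N (λ i _ → orbit<N i)
      ; cases    = λ b b<N → cases b b<N (multiplicity-cases b)
      ; attained = a , a<N , ≡.refl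
      }
      where
      orbit : ℕ → ℕ
      orbit i = (p ℕ.^ i ℕ.* a) % N
      orbit<N : ∀ i → orbit i ℕ.< N
      orbit<N i = m%n<n (p ℕ.^ i ℕ.* a) N
      injective : ∀ {i j} → i ℕ.< m → j ℕ.< m → orbit i ≡ orbit j → i ≡ j
      injective {i} {j} i<m j<m eq with ℕₚ.<-cmp i j
      ... | tri< i<j _ _ = contradiction eq (orbit-injective 0<a a<N i<j j<m)
      ... | tri≈ _ i≡j _ = i≡j
      ... | tri> _ _ j<i = contradiction (≡.sym eq) (orbit-injective 0<a a<N j<i i<m)
      open Multiplicity m orbit injective

      y-orbit : ∀ i → y (orbit i) ≡ y a
      y-orbit i = ≡.trans (≡.sym (ℤ∑.periodic-% N y-periodic (p ℕ.^ i ℕ.* a))) (go i)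
        where
        go : ∀ i → y (p ℕ.^ i ℕ.* a) ≡ y a
        go zero    = ≡.cong y (ℕₚ.*-identityˡ a)
        go (suc i) = ≡.trans (≡.cong y (ℕₚ.*-assoc p (p ℕ.^ i) a)) (≡.trans (y-frobenius _) (go i))

      excess : ℕ → ℤ
      excess b = y b ℤ.* (y b ℤ.+ + 1) ℤ.+ (ℤ.- + 2) ℤ.* multiplicity b

      excess≥0 : ∀ b → b ℕ.< N → + 0 ℤ.≤ excess b
      excess≥0 b b<N with multiplicity-cases b
      ... | inj₁ (mult≡1 , i , i<m , eq) = ≡.subst (+ 0 ℤ.≤_) (≡.sym (≡.cong₂ (λ s t → s ℤ.+ (ℤ.- + 2) ℤ.* t) (pronic (y b)) mult≡1))
              (ℤₚ.i≤j⇒0≤j-i {+ 2} (ℤ.+≤+ (2≤ (level (y b)) (λ l≡0 → l≢0 (≡.trans (≡.cong level (≡.trans (≡.sym (y-orbit i)) (≡.cong y eq))) l≡0)))))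
        where
        2≤ : ∀ l → l ≢ 0 → 2 ℕ.≤ l ℕ.* suc l
        2≤ zero    l≢0 = contradiction ≡.refl l≢0
        2≤ (suc l) _   = s≤s (s≤s z≤n)
      ... | inj₂ (mult≡0 , _) = ≡.subst (+ 0 ℤ.≤_) (≡.sym (≡.cong₂ (λ s t → s ℤ.+ (ℤ.- + 2) ℤ.* t) (pronic (y b)) mult≡0))
              (ℤ.+≤+ z≤n)

      ∑excess : ∑ᶻ N excess ≡ A ℤ.- + 2 ℤ.* + m
      ∑excess = ≡.trans (ℤ∑.∑-+ N (λ b → y b ℤ.* (y b ℤ.+ + 1)) (λ b → (ℤ.- + 2) ℤ.* multiplicity b))
        (≡.cong₂ ℤ._+_ A≡ (≡.trans (ℤ∑.∑-*ˡ N (ℤ.- + 2) multiplicity)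
          (≡.trans (≡.cong ((ℤ.- + 2) ℤ.*_) (∑-multiplicity N (λ i _ → orbit<N i))) (≡.sym (ℤₚ.neg-distribˡ-* (+ 2) (+ m))))))

      excess≡0 : ∀ b → b ℕ.< N → excess b ≡ + 0
      excess≡0 = ∑ᶻ-vanish N excess≥0 (≡.subst (ℤ._≤ + 0) (≡.sym ∑excess) (ℤₚ.i≤j⇒i-j≤0 A≤2m))

      A≡2m : A ≡ + 2 ℤ.* + m
      A≡2m = ℤₚ.i-j≡0⇒i≡j A _ (≡.trans (≡.sym ∑excess) (ℤ∑.∑-0 N excess≡0))

      pronic-multiplicity : ∀ b → b ℕ.< N → y b ℤ.* (y b ℤ.+ + 1) ≡ + 2 ℤ.* multiplicity b
      pronic-multiplicity b b<N = ℤₚ.i-j≡0⇒i≡j _ _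
        (≡.trans (≡.cong (ℤ._+_ (y b ℤ.* (y b ℤ.+ + 1))) (ℤₚ.neg-distribˡ-* (+ 2) (multiplicity b))) (excess≡0 b b<N))

      c≡2 : y a ℤ.* (y a ℤ.+ + 1) ≡ + 2
      c≡2 with multiplicity-cases (orbit 0)
      ... | inj₁ (mult≡1 , _) = ≡.trans (≡.cong (λ z → z ℤ.* (z ℤ.+ + 1)) (≡.sym (y-orbit 0)))
              (≡.trans (pronic-multiplicity (orbit 0) (orbit<N 0)) (≡.cong (+ 2 ℤ.*_) mult≡1))
      ... | inj₂ (_ , none)   = contradiction ≡.refl (none 0 0<m)

      cases : ∀ b → b ℕ.< N → (multiplicity b ≡ + 1 × ∃[ i ] i ℕ.< m × orbit i ≡ b)
                            ⊎ (multiplicity b ≡ + 0 × (∀ i → i ℕ.< m → orbit i ≢ b)) →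
              (multiplicity b ≡ + 1 × y b ≡ y a) ⊎ (multiplicity b ≡ + 0 × (y b ≡ + 0 ⊎ y b ≡ ℤ.- + 1))
      cases b b<N (inj₁ (mult≡1 , i , i<m , eq)) = inj₁ (mult≡1 , ≡.trans (≡.cong y (≡.sym eq)) (y-orbit i))
      cases b b<N (inj₂ (mult≡0 , _))            = inj₂ (mult≡0 , level≡0 (y b) (pronic≡0 (y b)
        (≡.trans (pronic-multiplicity b b<N) (≡.cong (+ 2 ℤ.*_) mult≡0))))

    -- Only the class 0 can lie outside {0, -1}, so it carries the whole sum: c (c + 1) = A with c =
    -- y 0.
    pointProfile : (∀ a → 0 ℕ.< a → a ℕ.< N → level (y a) ≡ 0) → Profile N m y A
    pointProfile l≡0 = record
      { c = y 0 ; μ = 1 ; mult = λ a → indicator (a ℕₚ.≟ 0) ; μ-cases = inj₁ ≡.refl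
      ; weight   = ≡.trans (ℤₚ.*-identityˡ _) (≡.trans (≡.sym (ℤ∑.∑-single N 0 0<N λ a a<N a≢0 →
                     ≡.trans (pronic (y a)) (≡.cong (λ l → + (l ℕ.* suc l)) (l≡0 a (ℕₚ.n≢0⇒n>0 a≢0) a<N)))) A≡)
      ; total    = ≡.trans (ℤ∑.∑-single N 0 0<N λ a _ a≢0 → indicator-no (a ℕₚ.≟ 0) a≢0) ≡.refl
      ; cases    = cases
      ; attained = 0 , 0<N , ≡.refl
      }
      where
      0<N = ℕ.>-nonZero⁻¹ N
      cases : ∀ a → a ℕ.< N → (indicator (a ℕₚ.≟ 0) ≡ + 1 × y a ≡ y 0) ⊎ (indicator (a ℕₚ.≟ 0) ≡ + 0 × (y a ≡ + 0 ⊎ y a ≡ ℤ.- + 1))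
      cases zero    _   = inj₁ (≡.refl , ≡.refl)
      cases (suc a) a<N = inj₂ (≡.refl , level≡0 (y (suc a)) (l≡0 (suc a) (s≤s z≤n) a<N))

  profile : Profile N m y A
  profile with ℕₚ.anyUpTo? (λ a → 0 ℕₚ.<? a ×-dec ¬? (level (y a) ℕₚ.≟ 0)) N
  ... | yes (a , a<N , 0<a , l≢0) = orbitProfile 0<a a<N l≢0
  ... | no  none                  = pointProfile l≡0
    where
    l≡0 : ∀ a → 0 ℕ.< a → a ℕ.< N → level (y a) ≡ 0
    l≡0 a 0<a a<N with level (y a) ℕₚ.≟ 0
    ... | yes eq = eq
    ... | no neq = contradiction (a , a<N , 0<a , neq) none

-- From one exceptional value c to exactly three values

module _ {N m : ℕ} {{N≢0 : NonZero N}} {y : ℕ → ℤ} {A d : ℤ}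
  (y-periodic : ∀ a → y (N ℕ.+ a) ≡ y a)
  (contentOne : ∀ c → (∀ a → c ℤ∣.∣ y a) → ℤ.∣ c ∣ ≡ 1)
  (∑y≡d : ∑ᶻ N y ≡ d) (A≢0 : A ≢ + 0) (2d≢A : + 2 ℤ.* d ≢ A)
  (bound : ∀ μ n → μ ≡ 1 ⊎ μ ≡ m → + (μ ℕ.* (n ℕ.* suc n)) ≡ A → + (μ ℕ.* suc n) ℤ.< d ℤ.+ + N)
  (P : Profile N m y A) where
  open Profile P

  private
    c≢0 : c ≢ + 0
    c≢0 c≡0 = A≢0 (≡.trans (≡.sym weight) (≡.trans (≡.cong (λ z → + μ ℤ.* (z ℤ.* (z ℤ.+ + 1))) c≡0) (ℤₚ.*-zeroʳ (+ μ))))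

    c≢-1 : c ≢ ℤ.- + 1
    c≢-1 c≡-1 = A≢0 (≡.trans (≡.sym weight) (≡.trans (≡.cong (λ z → + μ ℤ.* (z ℤ.* (z ℤ.+ + 1))) c≡-1) (ℤₚ.*-zeroʳ (+ μ))))

    -- The weight determines c only up to c ↔ -c - 1, so `bound` speaks of the level n of c, and c +
    -- 1 ≤ n + 1 holds for either sign.
    [c+1]μ< : + μ ℤ.* (c ℤ.+ + 1) ℤ.< d ℤ.+ + N
    [c+1]μ< = ℤₚ.≤-<-trans (ℤₚ.≤-trans (ℤₚ.*-monoˡ-≤-nonNeg (+ μ) (c+1≤ c)) (ℤₚ.≤-reflexive (≡.sym (ℤₚ.pos-* μ (suc (level c))))))
      (bound μ (level c) μ-cases (≡.trans (ℤₚ.pos-* μ _) (≡.trans (≡.cong (ℤ._*_ (+ μ)) (≡.sym (pronic c))) weight)))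
      where
      c+1≤ : ∀ c → c ℤ.+ + 1 ℤ.≤ + suc (level c)
      c+1≤ (+ n)        = ℤₚ.≤-reflexive (≡.cong +_ (ℕₚ.+-comm n 1))
      c+1≤ -[1+ zero  ] = ℤ.+≤+ z≤n
      c+1≤ -[1+ suc n ] = ℤ.-≤+

    -- Without the value 0 one has y = (c + 1) mult - 1 everywhere, so d + N = (c + 1) μ, against
    -- the strict bound.
    ¬noZero : ¬ (∀ a → a ℕ.< N → y a ≢ + 0)
    ¬noZero noZero = ℤₚ.<-irrefl (≡.trans (rearrange (+ μ) c (+ N)) (≡.cong (ℤ._+ + N) (≡.sym d≡))) [c+1]μ<
      where
      open ≡.≡-Reasoning
      rearrange : ∀ μ c N → μ ℤ.* (c ℤ.+ + 1) ≡ ((c ℤ.+ + 1) ℤ.* μ ℤ.+ N ℤ.* (ℤ.- + 1)) ℤ.+ N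
      rearrange = ℤSolver.solve-∀
      value : ∀ a → a ℕ.< N → y a ≡ (c ℤ.+ + 1) ℤ.* mult a ℤ.+ (ℤ.- + 1)
      value a a<N with cases a a<N
      ... | inj₁ (mult≡1 , ya≡c)      = ≡.trans ya≡c (≡.trans (identity c) (≡.cong (λ z → (c ℤ.+ + 1) ℤ.* z ℤ.+ (ℤ.- + 1)) (≡.sym mult≡1)))
        where
        identity : ∀ c → c ≡ (c ℤ.+ + 1) ℤ.* + 1 ℤ.+ (ℤ.- + 1)
        identity = ℤSolver.solve-∀
      ... | inj₂ (mult≡0 , inj₁ ya≡0)  = contradiction ya≡0 (noZero a a<N)
      ... | inj₂ (mult≡0 , inj₂ ya≡-1) = ≡.trans ya≡-1 (≡.trans (≡.cong (ℤ._+ (ℤ.- + 1)) (≡.sym (ℤₚ.*-zeroʳ (c ℤ.+ + 1))))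
              (≡.cong (λ z → (c ℤ.+ + 1) ℤ.* z ℤ.+ (ℤ.- + 1)) (≡.sym mult≡0)))
      d≡ : d ≡ (c ℤ.+ + 1) ℤ.* + μ ℤ.+ + N ℤ.* (ℤ.- + 1)
      d≡ = begin
        d                                                              ≡⟨ ∑y≡d ⟨
        ∑ᶻ N y  ≡⟨ ℤ∑.∑-cong N value ⟩
        ∑ᶻ N (λ a → (c ℤ.+ + 1) ℤ.* mult a ℤ.+ (ℤ.- + 1))              ≡⟨ ℤ∑.∑-+ N (λ a → (c ℤ.+ + 1) ℤ.* mult a) (λ _ → ℤ.- + 1) ⟩
        ∑ᶻ N (λ a → (c ℤ.+ + 1) ℤ.* mult a) ℤ.+ ∑ᶻ N (λ _ → ℤ.- + 1)   ≡⟨ ≡.cong₂ ℤ._+_ (≡.trans (ℤ∑.∑-*ˡ N (c ℤ.+ + 1) mult) (≡.cong ((c ℤ.+ + 1) ℤ.*_) total)) (∑ᶻ-const N (ℤ.- + 1)) ⟩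
        (c ℤ.+ + 1) ℤ.* + μ ℤ.+ + N ℤ.* (ℤ.- + 1)  ∎

    -- Without the value -1 one has y = c mult, so c divides every y_a. Then c = 1, which gives d =
    -- μ and A = 2 μ = 2 d.
    ¬noMinusOne : ¬ (∀ a → a ℕ.< N → y a ≢ ℤ.- + 1)
    ¬noMinusOne noMinusOne = 2d≢A (begin
      + 2 ℤ.* d  ≡⟨ ≡.cong (+ 2 ℤ.*_) d≡ ⟩
      + 2 ℤ.* (c ℤ.* + μ)  ≡⟨ ≡.cong (λ z → + 2 ℤ.* (z ℤ.* + μ)) c≡1 ⟩
      + 2 ℤ.* (+ 1 ℤ.* + μ)  ≡⟨ rearrange (+ μ) ⟩
      + μ ℤ.* (+ 1 ℤ.* (+ 1 ℤ.+ + 1))          ≡⟨ ≡.cong (λ z → + μ ℤ.* (z ℤ.* (z ℤ.+ + 1))) c≡1 ⟨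
      + μ ℤ.* (c ℤ.* (c ℤ.+ + 1))              ≡⟨ weight ⟩
      A                                        ∎)
      where
      open ≡.≡-Reasoning
      rearrange : ∀ μ → + 2 ℤ.* (+ 1 ℤ.* μ) ≡ μ ℤ.* (+ 1 ℤ.* (+ 1 ℤ.+ + 1))
      rearrange = ℤSolver.solve-∀
      value : ∀ a → a ℕ.< N → y a ≡ c ℤ.* mult a
      value a a<N with cases a a<N
      ... | inj₁ (mult≡1 , ya≡c)      = ≡.trans ya≡c (≡.trans (≡.sym (ℤₚ.*-identityʳ c)) (≡.cong (c ℤ.*_) (≡.sym mult≡1)))
      ... | inj₂ (mult≡0 , inj₁ ya≡0)  = ≡.trans ya≡0 (≡.trans (≡.sym (ℤₚ.*-zeroʳ c)) (≡.cong (c ℤ.*_) (≡.sym mult≡0)))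
      ... | inj₂ (mult≡0 , inj₂ ya≡-1) = contradiction ya≡-1 (noMinusOne a a<N)
      c∣y : ∀ a → c ℤ∣.∣ y a
      c∣y a = ℤ∣.divides (mult (a % N)) (≡.trans (ℤ∑.periodic-% N y-periodic a)
        (≡.trans (value (a % N) (m%n<n a N)) (ℤₚ.*-comm c _)))
      c≡1 : c ≡ + 1
      c≡1 with c in c≡ | contentOne c c∣y
      ... | + 1        | _ = ≡.refl
      ... | -[1+ zero ] | _ = contradiction c≡ c≢-1
      d≡ : d ≡ c ℤ.* + μ
      d≡ = ≡.trans (≡.sym ∑y≡d) (≡.trans (ℤ∑.∑-cong N value) (≡.trans (ℤ∑.∑-*ˡ N c mult) (≡.cong (c ℤ.*_) total)))

    attains : ∀ z → ¬ (∀ a → a ℕ.< N → y a ≢ z) → ∃[ a ] a ℕ.< N × y a ≡ z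
    attains z ¬none with ℕₚ.anyUpTo? (λ a → y a ℤₚ.≟ z) N
    ... | yes found = found
    ... | no  none  = contradiction (λ a a<N eq → none (a , a<N , eq)) ¬none

  profile⇒threeValued : ThreeValued N y
  profile⇒threeValued = w , distinct , attained′ , exhaustive
    where
    w : Fin 3 → ℤ
    w Fin.zero                     = c
    w (Fin.suc Fin.zero)           = + 0
    w (Fin.suc (Fin.suc Fin.zero)) = ℤ.- + 1
    distinct : ∀ i j → i ≢ j → w i ≢ w j
    distinct Fin.zero                     Fin.zero                     i≢j = contradiction ≡.refl i≢j
    distinct Fin.zero                     (Fin.suc Fin.zero)           _   = c≢0
    distinct Fin.zero                     (Fin.suc (Fin.suc Fin.zero)) _   = c≢-1
    distinct (Fin.suc Fin.zero)           Fin.zero                     _   = c≢0 ∘ ≡.sym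
    distinct (Fin.suc Fin.zero)           (Fin.suc Fin.zero)           i≢j = contradiction ≡.refl i≢j
    distinct (Fin.suc Fin.zero)           (Fin.suc (Fin.suc Fin.zero)) _   = λ ()
    distinct (Fin.suc (Fin.suc Fin.zero)) Fin.zero                     _   = c≢-1 ∘ ≡.sym
    distinct (Fin.suc (Fin.suc Fin.zero)) (Fin.suc Fin.zero)           _   = λ ()
    distinct (Fin.suc (Fin.suc Fin.zero)) (Fin.suc (Fin.suc Fin.zero)) i≢j = contradiction ≡.refl i≢j
    attained′ : ∀ i → ∃[ a ] a ℕ.< N × y a ≡ w i
    attained′ Fin.zero                     = attained
    attained′ (Fin.suc Fin.zero)           = attains (+ 0) ¬noZero
    attained′ (Fin.suc (Fin.suc Fin.zero)) = attains (ℤ.- + 1) ¬noMinusOne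
    exhaustive : ∀ a → a ℕ.< N → ∃[ i ] y a ≡ w i
    exhaustive a a<N with cases a a<N
    ... | inj₁ (_ , eq)      = Fin.zero , eq
    ... | inj₂ (_ , inj₁ eq) = Fin.suc Fin.zero , eq
    ... | inj₂ (_ , inj₂ eq) = Fin.suc (Fin.suc Fin.zero) , eq

-- The six parameter cases

-- What the combinatorics uses of the periods besides their two moments, in a form stable under y ↦
-- -y; this symmetry halves the number of cases.
record PeriodicCoefficients (N m p : ℕ) {{_ : NonZero N}} (y : ℕ → ℤ) : Set where
  field
    periodic        : ∀ a → y (N ℕ.+ a) ≡ y a
    frobenius       : ∀ a → y (p ℕ.* a) ≡ y a
    orbit-injective : ∀ {a} → 0 ℕ.< a → a ℕ.< N → ∀ {i j} → i ℕ.< j → j ℕ.< m → (p ℕ.^ i ℕ.* a) % N ≢ (p ℕ.^ j ℕ.* a) % N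
    contentOne      : ∀ c → (∀ a → c ℤ∣.∣ y a) → ℤ.∣ c ∣ ≡ 1

PeriodicCoefficients-neg : ∀ {N m p} {{_ : NonZero N}} {y} → PeriodicCoefficients N m p y →
                           PeriodicCoefficients N m p (λ a → ℤ.- y a)
PeriodicCoefficients-neg {y = y} C = record
  { periodic = λ a → ≡.cong ℤ.-_ (periodic a) ; frobenius = λ a → ≡.cong ℤ.-_ (frobenius a)
  ; orbit-injective = orbit-injective
  ; contentOne = λ c c∣-y → contentOne c λ a → ≡.subst (c ℤ∣.∣_) (ℤₚ.neg-involutive (y a)) (ℤ∣.∣m⇒∣-m (c∣-y a))
  }
  where open PeriodicCoefficients C

∑ᶻ-neg : ∀ n y → ∑ᶻ n (λ a → ℤ.- y a) ≡ ℤ.- ∑ᶻ n y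
∑ᶻ-neg n y = ≡.trans (ℤ∑.∑-cong n (λ a _ → ≡.sym (ℤₚ.-1*i≡-i (y a)))) (≡.trans (ℤ∑.∑-*ˡ n (ℤ.- + 1) y) (ℤₚ.-1*i≡-i _))

module _ {N m p : ℕ} {{_ : NonZero N}} {y : ℕ → ℤ} (C : PeriodicCoefficients N m p y) (2≤m : 2 ℕ.≤ m) where
  open PeriodicCoefficients C

  private
    pronicSum : ∀ {d s A} → ∑ᶻ N y ≡ d → ∑ᶻ N (λ a → y a ℤ.* y a) ≡ s → s ℤ.+ d ≡ A →
                ∑ᶻ N (λ a → y a ℤ.* (y a ℤ.+ + 1)) ≡ A
    pronicSum {d} {s} {A} ∑y ∑y² s+d≡A = begin
      ∑ᶻ N (λ a → y a ℤ.* (y a ℤ.+ + 1))       ≡⟨ ℤ∑.∑-cong N (λ a _ → expand (y a)) ⟩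
      ∑ᶻ N (λ a → y a ℤ.* y a ℤ.+ y a)         ≡⟨ ℤ∑.∑-+ N (λ a → y a ℤ.* y a) y ⟩
      ∑ᶻ N (λ a → y a ℤ.* y a) ℤ.+ ∑ᶻ N y      ≡⟨ ≡.cong₂ ℤ._+_ ∑y² ∑y ⟩
      s ℤ.+ d  ≡⟨ s+d≡A ⟩
      A                                        ∎
      where
      open ≡.≡-Reasoning
      expand : ∀ z → z ℤ.* (z ℤ.+ + 1) ≡ z ℤ.* z ℤ.+ z
      expand = ℤSolver.solve-∀

    v²+v : ∀ v r → + (v ℕ.* v ℕ.+ r) ℤ.+ (+ v ℤ.- + r) ≡ + (v ℕ.* suc v)
    v²+v v r = ≡.trans (cancel (+ (v ℕ.* v)) (+ r) (+ v)) (≡.cong +_ (≡.sym (ℕₚ.*-suc v v)))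
      where
      cancel : ∀ s r v → s ℤ.+ r ℤ.+ (v ℤ.- r) ≡ v ℤ.+ s
      cancel = ℤSolver.solve-∀

    threeValued : ∀ {A d} → ∑ᶻ N (λ a → y a ℤ.* (y a ℤ.+ + 1)) ≡ + A → A ℕ.≤ 2 ℕ.* m → 0 ℕ.< A →
      ∑ᶻ N y ≡ d → + 2 ℤ.* d ≢ + A →
      (∀ μ n → μ ≡ 1 ⊎ μ ≡ m → μ ℕ.* (n ℕ.* suc n) ≡ A → + (μ ℕ.* suc n) ℤ.< d ℤ.+ + N) → ThreeValued N y
    threeValued {A} ∑pronic A≤2m 0<A ∑y 2d≢A bound = profile⇒threeValued periodic contentOne ∑y
      (λ +A≡0 → ℕₚ.<⇒≢ 0<A (≡.sym (ℤₚ.+-injective +A≡0))) 2d≢A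
      (λ μ n μ-cases eq → bound μ n μ-cases (ℤₚ.+-injective eq))
      profile
      where
      open ProfileOfPeriods {N} {m} {p} {y = y} {+ A} periodic frobenius orbit-injective
        (ℕₚ.<-≤-trans (s≤s z≤n) 2≤m) ∑pronic (≡.subst (+ A ℤ.≤_) (ℤₚ.pos-* 2 m) (ℤ.+≤+ A≤2m))

    -- For positive r one has 2 (v - r) < 2 v ≤ A.
    twice≢ : ∀ v r {A} → 1 ℕ.≤ r → v ℕ.+ v ℕ.≤ A → + 2 ℤ.* (+ v ℤ.- + r) ≢ + A
    twice≢ v r {A} 1≤r 2v≤A eq = ℕₚ.<⇒≢ (ℕₚ.≤-<-trans 2v≤A (ℕₚ.m<m+n A (ℕₚ.<-≤-trans (s≤s z≤n) (ℕₚ.+-mono-≤ 1≤r 1≤r))))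
      (ℤₚ.+-injective (begin
        + v ℤ.+ + v  ≡⟨ rearrange (+ v) (+ r) ⟩
        + 2 ℤ.* (+ v ℤ.- + r) ℤ.+ (+ r ℤ.+ + r)              ≡⟨ ≡.cong (ℤ._+ (+ r ℤ.+ + r)) eq ⟩
        + A ℤ.+ (+ r ℤ.+ + r)  ∎))
      where
      open ≡.≡-Reasoning
      rearrange : ∀ v r → v ℤ.+ v ≡ + 2 ℤ.* (v ℤ.- r) ℤ.+ (r ℤ.+ r)
      rearrange = ℤSolver.solve-∀

    difference< : ∀ {x v r} → x ℕ.+ r ℕ.< v ℕ.+ N → + x ℤ.< (+ v ℤ.- + r) ℤ.+ + N
    difference< {x} {v} {r} lt = ≡.subst₂ ℤ._<_ (cancel (+ x) (+ r)) (rearrange (+ v) (+ N) (+ r))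
      (ℤₚ.+-monoˡ-< (ℤ.- + r) (ℤ.+<+ lt))
      where
      cancel : ∀ x r → (x ℤ.+ r) ℤ.+ (ℤ.- r) ≡ x
      cancel = ℤSolver.solve-∀
      rearrange : ∀ v n r → (v ℤ.+ n) ℤ.+ (ℤ.- r) ≡ (v ℤ.- r) ℤ.+ n
      rearrange = ℤSolver.solve-∀

    μ[1+n]≤A : ∀ μ n {A} → 0 ℕ.< A → μ ℕ.* (n ℕ.* suc n) ≡ A → μ ℕ.* suc n ℕ.≤ A
    μ[1+n]≤A μ zero    0<A eq = contradiction (≡.trans (≡.sym (ℕₚ.*-zeroʳ μ)) eq) (ℕₚ.<⇒≢ 0<A)
    μ[1+n]≤A μ (suc n) 0<A eq = ℕₚ.≤-trans (ℕₚ.*-monoʳ-≤ μ (ℕₚ.m≤m+n (suc (suc n)) _)) (ℕₚ.≤-reflexive eq)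

    v+v≤v[1+v] : ∀ v → 1 ℕ.≤ v → v ℕ.+ v ℕ.≤ v ℕ.* suc v
    v+v≤v[1+v] v 1≤v = ≡.subst (ℕ._≤ v ℕ.* suc v) (≡.trans (ℕₚ.*-comm v 2) (≡.cong (v ℕ.+_) (ℕₚ.+-identityʳ v))) (ℕₚ.*-monoʳ-≤ v (s≤s 1≤v))

  -- A = (v² + r) + (v - r) = v (v + 1) is below 2m, which rules out μ = m since m n (n + 1) ≥ 2m
  -- for n ≥ 1. So μ = 1 and n ≤ v, and v + 1 + r < v + N is the size condition.
  threeValued-< : ∀ {v r} → 1 ℕ.≤ v → 1 ℕ.≤ r → v ℕ.* suc v ℕ.< 2 ℕ.* m → r ℕ.+ 1 ℕ.< N →
                  ∑ᶻ N y ≡ + v ℤ.- + r → ∑ᶻ N (λ a → y a ℤ.* y a) ≡ + (v ℕ.* v ℕ.+ r) → ThreeValued N y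
  threeValued-< {v} {r} 1≤v 1≤r v[1+v]<2m r+1<N ∑y ∑y² =
    threeValued (pronicSum ∑y ∑y² (v²+v v r)) (ℕₚ.<⇒≤ v[1+v]<2m) 0<A ∑y (twice≢ v r 1≤r (v+v≤v[1+v] v 1≤v)) bound
    where
    0<A : 0 ℕ.< v ℕ.* suc v
    0<A = ℕₚ.<-≤-trans (ℕₚ.<-≤-trans (s≤s z≤n) (ℕₚ.+-mono-≤ 1≤v 1≤v)) (v+v≤v[1+v] v 1≤v)
    bound : ∀ μ n → μ ≡ 1 ⊎ μ ≡ m → μ ℕ.* (n ℕ.* suc n) ≡ v ℕ.* suc v → + (μ ℕ.* suc n) ℤ.< (+ v ℤ.- + r) ℤ.+ + N
    bound μ n (inj₁ ≡.refl) eq = difference< {v = v} (ℕₚ.≤-<-trans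
        (ℕₚ.≤-trans (ℕₚ.+-monoˡ-≤ r (ℕₚ.≤-trans (ℕₚ.≤-reflexive (ℕₚ.*-identityˡ (suc n))) (s≤s n≤v))) (ℕₚ.≤-reflexive (rearrange v r)))
        (ℕₚ.+-monoʳ-< v r+1<N))
      where
      rearrange : ∀ v r → suc v ℕ.+ r ≡ v ℕ.+ (r ℕ.+ 1)
      rearrange = ℕSolver.solve-∀
      n≤v : n ℕ.≤ v
      n≤v = ℕₚ.≮⇒≥ λ v<n → ℕₚ.<⇒≢ (ℕₚ.*-mono-< v<n (s≤s v<n)) (≡.sym (≡.trans (≡.sym (ℕₚ.*-identityˡ (n ℕ.* suc n))) eq))
    bound μ zero    (inj₂ ≡.refl) eq = contradiction (≡.trans (≡.sym (ℕₚ.*-zeroʳ m)) eq) (ℕₚ.<⇒≢ 0<A)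
    bound μ (suc n) (inj₂ ≡.refl) eq = contradiction (ℕₚ.≤-<-trans (ℕₚ.≤-trans (ℕₚ.≤-reflexive (ℕₚ.*-comm 2 m))
      (ℕₚ.≤-trans (ℕₚ.*-monoʳ-≤ m (s≤s (s≤s z≤n))) (ℕₚ.≤-reflexive eq))) v[1+v]<2m) (ℕₚ.<-irrefl ≡.refl)

  -- Now μ may be 1 or m, so only μ (n + 1) ≤ A = v² + v is used, and v² + v + r < v + N is the size
  -- condition.
  threeValued-≡ : ∀ {v r} → 1 ℕ.≤ v → 1 ℕ.≤ r → v ℕ.* suc v ≡ 2 ℕ.* m → r ℕ.+ v ℕ.* v ℕ.< N →
                  ∑ᶻ N y ≡ + v ℤ.- + r → ∑ᶻ N (λ a → y a ℤ.* y a) ≡ + (v ℕ.* v ℕ.+ r) → ThreeValued N y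
  threeValued-≡ {v} {r} 1≤v 1≤r v[1+v]≡2m r+v²<N ∑y ∑y² =
    threeValued (pronicSum ∑y ∑y² (v²+v v r)) (ℕₚ.≤-reflexive v[1+v]≡2m) 0<A ∑y (twice≢ v r 1≤r (v+v≤v[1+v] v 1≤v)) λ μ n _ eq →
      difference< {v = v} (ℕₚ.≤-<-trans (ℕₚ.≤-trans (ℕₚ.+-monoˡ-≤ r (μ[1+n]≤A μ n 0<A eq)) (ℕₚ.≤-reflexive (rearrange v r))) (ℕₚ.+-monoʳ-< v r+v²<N))
    where
    0<A : 0 ℕ.< v ℕ.* suc v
    0<A = ℕₚ.<-≤-trans (ℕₚ.<-≤-trans (s≤s z≤n) (ℕₚ.+-mono-≤ 1≤v 1≤v)) (v+v≤v[1+v] v 1≤v)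
    rearrange : ∀ v r → v ℕ.* suc v ℕ.+ r ≡ v ℕ.+ (r ℕ.+ v ℕ.* v)
    rearrange = ℕSolver.solve-∀

  -- Here A = (m + r) + (m - r) = 2m, and the crude estimate asks for 2m + r < m + N.
  threeValued-m : ∀ {r} → 1 ℕ.≤ r → r ℕ.+ m ℕ.< N →
                  ∑ᶻ N y ≡ + m ℤ.- + r → ∑ᶻ N (λ a → y a ℤ.* y a) ≡ + (m ℕ.+ r) → ThreeValued N y
  threeValued-m {r} 1≤r r+m<N ∑y ∑y² =
    threeValued (pronicSum ∑y ∑y² 2m) ℕₚ.≤-refl 0<2m ∑y (twice≢ m r 1≤r (ℕₚ.≤-reflexive (≡.cong (m ℕ.+_) (≡.sym (ℕₚ.+-identityʳ m))))) λ μ n _ eq →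
      difference< {v = m} (ℕₚ.≤-<-trans (ℕₚ.≤-trans (ℕₚ.+-monoˡ-≤ r (μ[1+n]≤A μ n 0<2m eq)) (ℕₚ.≤-reflexive (rearrange m r))) (ℕₚ.+-monoʳ-< m r+m<N))
    where
    0<2m : 0 ℕ.< 2 ℕ.* m
    0<2m = ℕₚ.<-≤-trans (s≤s z≤n) (ℕₚ.≤-trans 2≤m (ℕₚ.m≤m+n m _))
    rearrange : ∀ m r → 2 ℕ.* m ℕ.+ r ≡ m ℕ.+ (r ℕ.+ m)
    rearrange = ℕSolver.solve-∀
    2m : (+ m ℤ.+ + r) ℤ.+ (+ m ℤ.- + r) ≡ + (2 ℕ.* m)
    2m = ≡.trans (cancel (+ m) (+ r)) (≡.cong (λ n → + (m ℕ.+ n)) (≡.sym (ℕₚ.+-identityʳ m)))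
      where
      cancel : ∀ m r → (m ℤ.+ r) ℤ.+ (m ℤ.- r) ≡ m ℤ.+ m
      cancel = ℤSolver.solve-∀

module _ {N m p : ℕ} {{_ : NonZero N}} {y : ℕ → ℤ} (C : PeriodicCoefficients N m p y) (2≤m : 2 ℕ.≤ m)
  {u v r s : ℕ} (1≤u : 1 ℕ.≤ u) (1≤v : 1 ℕ.≤ v) (1≤r : 1 ℕ.≤ r) (1≤s : 1 ℕ.≤ s)
  (∑y : ∑ᶻ N y ≡ ℤ.- (+ u ℤ.* + r) ℤ.+ + v ℤ.* + s)
  (∑y² : ∑ᶻ N (λ a → y a ℤ.* y a) ≡ (+ u) ℤ.^ 2 ℤ.* + r ℤ.+ (+ v) ℤ.^ 2 ℤ.* + s) where

  private
    C⁻ = PeriodicCoefficients-neg C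

    v[v+1] : ∀ v → v ℕ.* (v ℕ.+ 1) ≡ v ℕ.* suc v
    v[v+1] v = ≡.cong (v ℕ.*_) (ℕₚ.+-comm v 1)

    v^2 : ∀ v → v ℕ.^ 2 ≡ v ℕ.* v
    v^2 v = ≡.cong (v ℕ.*_) (ℕₚ.*-identityʳ v)

    sum⁺ : ∀ v r → ℤ.- (+ 1 ℤ.* r) ℤ.+ v ℤ.* + 1 ≡ v ℤ.- r
    sum⁺ = ℤSolver.solve-∀

    sum⁻ : ∀ u s → ℤ.- (ℤ.- (u ℤ.* + 1) ℤ.+ + 1 ℤ.* s) ≡ u ℤ.- s
    sum⁻ = ℤSolver.solve-∀

    squares : ∀ v r → + 1 ℤ.* r ℤ.+ v ℤ.^ 2 ℤ.* + 1 ≡ v ℤ.* v ℤ.+ r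
    squares v r = lemma v r
      where
      lemma : ∀ v r → + 1 ℤ.* r ℤ.+ v ℤ.* (v ℤ.* + 1) ℤ.* + 1 ≡ v ℤ.* v ℤ.+ r
      lemma = ℤSolver.solve-∀

    pos-square : ∀ v r → + v ℤ.* + v ℤ.+ + r ≡ + (v ℕ.* v ℕ.+ r)
    pos-square v r = ≡.cong (ℤ._+ + r) (≡.sym (ℤₚ.pos-* v v))

    ∑-y : ∑ᶻ N (λ a → ℤ.- y a) ≡ ℤ.- (ℤ.- (+ u ℤ.* + r) ℤ.+ + v ℤ.* + s)
    ∑-y = ≡.trans (∑ᶻ-neg N y) (≡.cong ℤ.-_ ∑y)

    ∑[-y]² : ∑ᶻ N (λ a → (ℤ.- y a) ℤ.* (ℤ.- y a)) ≡ (+ v) ℤ.^ 2 ℤ.* + s ℤ.+ (+ u) ℤ.^ 2 ℤ.* + r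
    ∑[-y]² = ≡.trans (ℤ∑.∑-cong N (λ a _ → square (y a))) (≡.trans ∑y² (ℤₚ.+-comm ((+ u) ℤ.^ 2 ℤ.* + r) _))
      where
      square : ∀ z → (ℤ.- z) ℤ.* (ℤ.- z) ≡ z ℤ.* z
      square = ℤSolver.solve-∀

  -- Cases (3), (4) and (6) are cases (1), (2) and (5) for -y, with the pairs (u, r) and (v, s)
  -- exchanged.
  parameterCases :
    ( (u ≡ 1 × s ≡ 1 × v ℕ.* (v ℕ.+ 1) ℕ.< 2 ℕ.* m × r ℕ.+ 1 ℕ.< N)
    ⊎ (u ≡ 1 × s ≡ 1 × v ℕ.* (v ℕ.+ 1) ≡ 2 ℕ.* m × r ℕ.+ v ℕ.^ 2 ℕ.< N)
    ⊎ (v ≡ 1 × r ≡ 1 × u ℕ.* (u ℕ.+ 1) ℕ.< 2 ℕ.* m × s ℕ.+ 1 ℕ.< N)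
    ⊎ (v ≡ 1 × r ≡ 1 × u ℕ.* (u ℕ.+ 1) ≡ 2 ℕ.* m × s ℕ.+ u ℕ.^ 2 ℕ.< N)
    ⊎ (u ≡ 1 × v ≡ 1 × s ≡ m × r ℕ.+ m ℕ.< N)
    ⊎ (u ≡ 1 × v ≡ 1 × r ≡ m × s ℕ.+ m ℕ.< N)) → ThreeValued N y
  parameterCases (inj₁ (≡.refl , ≡.refl , v[v+1]<2m , r+1<N)) =
    threeValued-< C 2≤m 1≤v 1≤r (≡.subst (ℕ._< 2 ℕ.* m) (v[v+1] v) v[v+1]<2m) r+1<N
      (≡.trans ∑y (sum⁺ (+ v) (+ r))) (≡.trans ∑y² (≡.trans (squares (+ v) (+ r)) (pos-square v r)))
  parameterCases (inj₂ (inj₁ (≡.refl , ≡.refl , v[v+1]≡2m , r+v²<N))) =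
    threeValued-≡ C 2≤m 1≤v 1≤r (≡.trans (≡.sym (v[v+1] v)) v[v+1]≡2m) (≡.subst (λ x → r ℕ.+ x ℕ.< N) (v^2 v) r+v²<N)
      (≡.trans ∑y (sum⁺ (+ v) (+ r))) (≡.trans ∑y² (≡.trans (squares (+ v) (+ r)) (pos-square v r)))
  parameterCases (inj₂ (inj₂ (inj₁ (≡.refl , ≡.refl , u[u+1]<2m , s+1<N)))) =
    ThreeValued-neg (threeValued-< C⁻ 2≤m 1≤u 1≤s (≡.subst (ℕ._< 2 ℕ.* m) (v[v+1] u) u[u+1]<2m) s+1<N
      (≡.trans ∑-y (sum⁻ (+ u) (+ s))) (≡.trans ∑[-y]² (≡.trans (squares (+ u) (+ s)) (pos-square u s))))
  parameterCases (inj₂ (inj₂ (inj₂ (inj₁ (≡.refl , ≡.refl , u[u+1]≡2m , s+u²<N))))) =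
    ThreeValued-neg (threeValued-≡ C⁻ 2≤m 1≤u 1≤s (≡.trans (≡.sym (v[v+1] u)) u[u+1]≡2m) (≡.subst (λ x → s ℕ.+ x ℕ.< N) (v^2 u) s+u²<N)
      (≡.trans ∑-y (sum⁻ (+ u) (+ s))) (≡.trans ∑[-y]² (≡.trans (squares (+ u) (+ s)) (pos-square u s))))
  parameterCases (inj₂ (inj₂ (inj₂ (inj₂ (inj₁ (≡.refl , ≡.refl , ≡.refl , r+m<N)))))) =
    threeValued-m C 2≤m 1≤r r+m<N (≡.trans ∑y (sum (+ m) (+ r))) (≡.trans ∑y² (squareSum (+ m) (+ r)))
    where
    sum : ∀ m r → ℤ.- (+ 1 ℤ.* r) ℤ.+ + 1 ℤ.* m ≡ m ℤ.- r
    sum = ℤSolver.solve-∀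
    squareSum : ∀ m r → + 1 ℤ.* r ℤ.+ + 1 ℤ.* m ≡ m ℤ.+ r
    squareSum = ℤSolver.solve-∀
  parameterCases (inj₂ (inj₂ (inj₂ (inj₂ (inj₂ (≡.refl , ≡.refl , ≡.refl , s+m<N)))))) =
    ThreeValued-neg (threeValued-m C⁻ 2≤m 1≤s s+m<N (≡.trans ∑-y (sum (+ m) (+ s))) (≡.trans ∑[-y]² (squareSum (+ m) (+ s))))
    where
    sum : ∀ m s → ℤ.- (ℤ.- (+ 1 ℤ.* m) ℤ.+ + 1 ℤ.* s) ≡ m ℤ.- s
    sum = ℤSolver.solve-∀
    squareSum : ∀ m s → + 1 ℤ.* s ℤ.+ + 1 ℤ.* m ≡ m ℤ.+ s
    squareSum = ℤSolver.solve-∀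

divisorOfPower : ∀ {p} → Prime p → ∀ i {n} → n ∣ℕ p ℕ.^ i → n ≡ 1 ⊎ p ∣ℕ n
divisorOfPower {p} p-prime i {n} n∣pⁱ with p ℕ∣.∣? n
... | yes p∣n = inj₂ p∣n
... | no  p∤n = inj₁ (ℕ∣.∣1⇒≡1 (cancel i n∣pⁱ))
  where
  coprime : Coprime n p
  coprime (d∣n , d∣p) = [ id , (λ { ≡.refl → contradiction d∣n p∤n }) ]′ (prime⇒irreducible p-prime d∣p)
  cancel : ∀ i → n ∣ℕ p ℕ.^ i → n ∣ℕ 1
  cancel zero    n∣1 = n∣1
  cancel (suc i) n∣  = cancel i (coprime-divisor coprime n∣)

-- The hypotheses of the theorem applied to the periods

module PeriodCoefficients
  {c ℓ₁ ℓ₂ c′ ℓ₁′ ℓ₂′} (K : CharZeroFieldWithRootsOfUnity c ℓ₁ ℓ₂)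
  {n₀ : ℕ} (F : FiniteField c′ ℓ₁′ ℓ₂′ (suc n₀))
  {γ : FiniteField.Carrier F} (γ-primitive : FiniteField.IsPrimitiveElement F γ)
  {p : ℕ} (f : ℕ) (p-prime : Prime p) (order : suc n₀ ≡ p ℕ.^ suc f)
  {N : ℕ} (2<N : 2 ℕ.< N) (N∣n₀ : N ∣ℕ n₀)
  (κ : ℕ) (divides : CharacterSums.DividesGaussSums K p (suc f) F γ N (p ℕ.^ κ))
  (maximal : ∀ j → CharacterSums.DividesGaussSums K p (suc f) F γ N (p ℕ.^ j) → p ℕ.^ j ℕ.≤ p ℕ.^ κ)
  (d : ℤ) (td≡-1 : + (p ℕ.^ κ) ℤ.* d ≡ ℤ.- (+ 1) [mod N ])
  {m : ℕ} (m-gcd : IsGCDOf (OrderModDivisor p N) m) (2≤m : 2 ℕ.≤ m) where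
  open CharZeroFieldWithRootsOfUnity K using (_≈_; _#_; *-congˡ; trans; sym; +-congˡ; #⇒invertible)

  private
    1<p = ℕ.nonTrivial⇒n>1 p {{prime⇒nonTrivial p-prime}}
    k = ℕ∣.quotient N∣n₀
    n₀≡kN : n₀ ≡ k ℕ.* N
    n₀≡kN = ℕ∣._∣_.equality N∣n₀
    instance
      p≢0 : NonZero p
      p≢0 = prime⇒nonZero p-prime
      n₀≢0 : NonZero n₀
      n₀≢0 = ℕ.>-nonZero (ℕ.s≤s⁻¹ (≡.subst (1 ℕ.<_) (≡.sym order) (ℕₚ.<-≤-trans 1<p (ℕₚ.m≤m*n p (p ℕ.^ f) {{ℕₚ.m^n≢0 p f}}))))
      N≢0 : NonZero N
      N≢0 = ℕ.>-nonZero (ℕₚ.<-trans (s≤s z≤n) 2<N)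
      k≢0 : NonZero k
      k≢0 = ℕ.≢-nonZero λ k≡0 → ℕ.≢-nonZero⁻¹ n₀ (≡.trans n₀≡kN (≡.cong (ℕ._* N) k≡0))

    coprime-p : Coprime N p
    coprime-p {i} (i∣N , i∣p) = ℕ∣.∣1⇒≡1 (ℕ∣.∣m+n∣m⇒∣n {i} {n₀} {1} i∣q (ℕ∣.∣-trans i∣N N∣n₀))
      where
      i∣q : i ∣ℕ n₀ ℕ.+ 1
      i∣q = ≡.subst (i ∣ℕ_) (≡.trans (≡.sym order) (ℕₚ.+-comm 1 n₀)) (ℕ∣.∣-trans i∣p (ℕ∣.m∣m*n (p ℕ.^ f)))

    module Ord = Orders coprime-p m-gcd 2≤m

    N∣td+1 : + N ℤ∣.∣ + (p ℕ.^ κ) ℤ.* d ℤ.- ℤ.- + 1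
    N∣td+1 = ℤ∣.∣ᵤ⇒∣ td≡-1
    -- Hypothesis (i) enters here: it says that (t d + 1) / N is an integer.
    e = ℤ∣.quotient N∣td+1
    Ne≡td+1 : + N ℤ.* e ≡ + (p ℕ.^ κ) ℤ.* d ℤ.+ + 1
    Ne≡td+1 = ≡.trans (ℤₚ.*-comm (+ N) e) (≡.sym (ℤ∣._∣_.equality N∣td+1))

  open IntegerPeriods K F γ-primitive f p-prime order {N} {k} n₀≡kN Ord.coprime-p∸1 κ divides d e Ne≡td+1
    using (t; t≢0; y; y-periodic; y-frobenius; η-y; η≈; ∑y≡d; secondMoment; lagMoment; p∣y⇒divides)

  private
    T = + t

    c∣q : ∀ c → (∀ a → c ℤ∣.∣ y a) → c ℤ∣.∣ + suc n₀
    c∣q c c∣y = ≡.subst (c ℤ∣.∣_) (≡.trans (≡.cong ℤ.-_ (lagMoment (ℕₚ.<-trans (s≤s (s≤s z≤n)) 2<N))) (ℤₚ.neg-involutive (+ suc n₀)))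
      (ℤ∣.∣m⇒∣-m (ℤ∣.∣n⇒∣m*n (T ℤ.* T) (ℤ∣.∣m∣n⇒∣m-n (ℤ∣.∣n⇒∣m*n (+ N) (∑ᶻ-∣ N (λ a → ℤ∣.∣m⇒∣m*n (y (a ℕ.+ 1)) (c∣y a))))
        (ℤ∣.∣m⇒∣m*n d (≡.subst (c ℤ∣.∣_) ∑y≡d (∑ᶻ-∣ N c∣y))))))

    contentOne : ∀ c → (∀ a → c ℤ∣.∣ y a) → ℤ.∣ c ∣ ≡ 1
    contentOne c c∣y = [ id , (λ p∣c → contradiction
      (maximal (suc κ) (p∣y⇒divides (λ a → ℤ∣.∣ᵤ⇒∣ {+ p} {y a} (ℕ∣.∣-trans p∣c (ℤ∣.∣⇒∣ᵤ {c} {y a} (c∣y a))))))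
      (ℕₚ.<⇒≱ (ℕₚ.^-monoʳ-< p 1<p (ℕₚ.n<1+n κ)))) ]′
      (divisorOfPower p-prime (suc f) (≡.subst (ℤ.∣ c ∣ ∣ℕ_) order (ℤ∣.∣⇒∣ᵤ (c∣q c c∣y))))

  coefficients = y

  coefficients-periodic : PeriodicCoefficients N m p coefficients
  coefficients-periodic = record
    { periodic = y-periodic ; frobenius = y-frobenius ; orbit-injective = Ord.orbit-injective ; contentOne = contentOne }

  coefficients-sum : ∑ᶻ N coefficients ≡ d
  coefficients-sum = ∑y≡d

  -- Hypothesis (ii) and `secondMoment` share the term (N - 1) q. Eliminating it leaves N t² Σ y² =
  -- N t² B, and N and t are nonzero.
  coefficients-squares : ∀ B → (+ N ℤ.- + 1) ℤ.* + suc n₀ ℤ.+ (+ (p ℕ.^ κ)) ℤ.^ 2 ℤ.* d ℤ.^ 2 ≡ + N ℤ.* (+ (p ℕ.^ κ)) ℤ.^ 2 ℤ.* B →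
                         ∑ᶻ N (λ a → coefficients a ℤ.* coefficients a) ≡ B
  coefficients-squares B eq = cancel (+ N) T d B _ _ secondMoment eq
    where
    cancel : ∀ n t d B S Q → {{ℤ.NonZero n}} → {{ℤ.NonZero t}} → t ℤ.* t ℤ.* (n ℤ.* S ℤ.- d ℤ.* d) ≡ Q →
             Q ℤ.+ t ℤ.^ 2 ℤ.* d ℤ.^ 2 ≡ n ℤ.* t ℤ.^ 2 ℤ.* B → S ≡ B
    cancel n t d B S Q eq₁ eq₂ = ℤₚ.*-cancelˡ-≡ n S B (ℤₚ.*-cancelˡ-≡ t (n ℤ.* S) (n ℤ.* B) (ℤₚ.*-cancelˡ-≡ t (t ℤ.* (n ℤ.* S)) (t ℤ.* (n ℤ.* B)) (begin
      t ℤ.* (t ℤ.* (n ℤ.* S))  ≡⟨ split t (n ℤ.* S) d ⟩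
      t ℤ.* t ℤ.* (n ℤ.* S ℤ.- d ℤ.* d) ℤ.+ t ℤ.^ 2 ℤ.* d ℤ.^ 2      ≡⟨ ≡.cong (ℤ._+ t ℤ.^ 2 ℤ.* d ℤ.^ 2) eq₁ ⟩
      Q ℤ.+ t ℤ.^ 2 ℤ.* d ℤ.^ 2  ≡⟨ eq₂ ⟩
      n ℤ.* t ℤ.^ 2 ℤ.* B  ≡⟨ rearrange n t B ⟩
      t ℤ.* (t ℤ.* (n ℤ.* B))  ∎)))
      where
      open ≡.≡-Reasoning
      split : ∀ t s d → t ℤ.* (t ℤ.* s) ≡ t ℤ.* t ℤ.* (s ℤ.- d ℤ.* d) ℤ.+ (t ℤ.* (t ℤ.* + 1)) ℤ.* (d ℤ.* (d ℤ.* + 1))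
      split = ℤSolver.solve-∀
      rearrange : ∀ n t B → n ℤ.* (t ℤ.* (t ℤ.* + 1)) ℤ.* B ≡ t ℤ.* (t ℤ.* (n ℤ.* B))
      rearrange = ℤSolver.solve-∀

  coefficients⇒periods : ThreeValued N coefficients → CharacterSums.TakesExactlyThreeValues K p (suc f) F (CharacterSums.η K p (suc f) F γ N)
  coefficients⇒periods (w , distinct , attained , exhaustive) =
      (λ i → ι (value (w i)))
    , (λ i j i≢j → ι-# (λ eq → distinct i j i≢j (value-injective (w i) (w j) eq)))
    , (λ i → let a , a<N , eq = attained i in fromℕ< a<N , trans (η≈ (fromℕ< a<N))
        (trans (reflexive (≡.cong η (Finₚ.toℕ-fromℕ< a<N))) (trans (η-y a) (reflexive (≡.cong (λ z → ι (value z)) eq)))))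
    , (λ a → let i , eq = exhaustive (toℕ a) (Finₚ.toℕ<n a) in i , trans (η≈ a) (trans (η-y (toℕ a)) (reflexive (≡.cong (λ z → ι (value z)) eq))))
    where
    open CharZeroFieldWithRootsOfUnity K using (commutativeRing; reflexive; heytingField)
    open IntegerScalars commutativeRing
    open HeytingFieldProperties heytingField using (invertibleˡ⇒#; x-0≈x)
    open AlgebraicIntegers K using (ι#0)
    open GaussPeriods K F γ-primitive f p-prime order
      (ResidueTrace.residueTrace K F γ-primitive f p-prime order) (ResidueTrace.residueTrace-spec K F γ-primitive f p-prime order)
      {N} {k} n₀≡kN Ord.coprime-p∸1 using (η)
    value : ℤ → ℤ
    value z = T ℤ.* z ℤ.- e
    value-injective : ∀ x z → value x ≡ value z → x ≡ z
    value-injective x z eq = ℤₚ.*-cancelˡ-≡ T x z (ℤ+-cancelʳ (ℤ.- e) (T ℤ.* x) (T ℤ.* z) eq)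
    -- The conclusion asks for apartness, not mere inequality; in characteristic zero a nonzero
    -- integer difference is invertible in `K`.
    ι-# : ∀ {x z} → x ≢ z → ι x # ι z
    ι-# {x} {z} x≢z =
      let b , left , _ = #⇒invertible (ι#0 {x ℤ.- z} (λ eq → x≢z (ℤₚ.i-j≡0⇒i≡j x z eq)))
      in invertibleˡ⇒# (b , trans (*-congˡ (sym (trans (x-0≈x _) (trans (ι-+ x (ℤ.- z)) (+-congˡ (ι-neg z)))))) left)

open import Data.Nat.Base using (_+_; _*_; _∸_; _^_; _≤_; _<_)
open import Data.Nat.Divisibility using (_∣_)

theorem3p4 : ∀ {c ℓ₁ ℓ₂ c′ ℓ₁′ ℓ₂′ : Level}
    (K : CharZeroFieldWithRootsOfUnity c ℓ₁ ℓ₂)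
    (p f q : ℕ) → Prime p → 1 ≤ f → q ≡ p ^ f →
    (F : FiniteField c′ ℓ₁′ ℓ₂′ q) →
    let open CharacterSums K p f F in
    (N : ℕ) → 2 < N → N ∣ (q ∸ 1) →
    (γ : FiniteField.Carrier F) → FiniteField.IsPrimitiveElement F γ →
    (t : ℕ) → IsLargestPowerDividingGaussSums γ N t →
    (u v r s : ℕ) → 1 ≤ u → 1 ≤ v → 1 ≤ r → 1 ≤ s →
    let d = ℤ.- (+ u ℤ.* + r) ℤ.+ + v ℤ.* + s in
    + t ℤ.* d ≡ ℤ.- (+ 1) [mod N ] →
    (+ N ℤ.- + 1) ℤ.* + q ℤ.+ (+ t) ℤ.^ 2 ℤ.* d ℤ.^ 2
    ≡ + N ℤ.* (+ t) ℤ.^ 2 ℤ.* ((+ u) ℤ.^ 2 ℤ.* + r ℤ.+ (+ v) ℤ.^ 2 ℤ.* + s) →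
    (m : ℕ) → IsGCDOf (OrderModDivisor p N) m → 2 ≤ m →
    ( (u ≡ 1 × s ≡ 1 × v * (v + 1) < 2 * m × r + 1 < N)
    ⊎ (u ≡ 1 × s ≡ 1 × v * (v + 1) ≡ 2 * m × r + v ^ 2 < N)
    ⊎ (v ≡ 1 × r ≡ 1 × u * (u + 1) < 2 * m × s + 1 < N)
    ⊎ (v ≡ 1 × r ≡ 1 × u * (u + 1) ≡ 2 * m × s + u ^ 2 < N)
    ⊎ (u ≡ 1 × v ≡ 1 × s ≡ m × r + m < N)
    ⊎ (u ≡ 1 × v ≡ 1 × r ≡ m × s + m < N)) →
    TakesExactlyThreeValues (η γ N)
-- A power of a prime is not 0. The remaining clause writes q as suc n₀, where n₀ is the order of γ.
theorem3p4 K p (suc f) zero p-prime _ 0≡pᶠ F N 2<N N∣ γ γ-prim =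
  contradiction (≡.sym 0≡pᶠ) (ℕ.≢-nonZero⁻¹ (p ^ suc f) {{ℕₚ.m^n≢0 p (suc f) {{prime⇒nonZero p-prime}}}})
theorem3p4 K p (suc f) (suc n₀) p-prime _ order F N 2<N N∣n₀ γ γ-prim
  .(p ^ κ) ((κ , ≡.refl) , divides , maximal) u v r s 1≤u 1≤v 1≤r 1≤s td≡-1 moments m m-gcd 2≤m hypotheses =
  coefficients⇒periods (parameterCases coefficients-periodic 2≤m 1≤u 1≤v 1≤r 1≤s coefficients-sum (coefficients-squares _ moments) hypotheses)
  where
  instance
    N≢0 : NonZero N
    N≢0 = ℕ.>-nonZero (ℕₚ.<-trans (s≤s z≤n) 2<N)
  open PeriodCoefficients K F γ-prim f p-prime order 2<N N∣n₀ κ divides maximal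
    (ℤ.- (+ u ℤ.* + r) ℤ.+ + v ℤ.* + s) td≡-1 m-gcd 2≤m
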